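{- Let $g\ge 1$ and let $\mathcal{M}^g$ be the set of maps of genus $g$ all of whose faces have even degree. For $\varepsilon\in\{+,-\}$, define $\Psi^{\varepsilon}\colon\mathcal{M}^g\to\mathcal{M}^g$ by letting $\Psi^{\varepsilon}(\mathbf{m})$ be the first coordinate of $\Phi(\mathbf{m},\boldsymbol{\lambda}_\mathbf{m},\varepsilon)$. Then $\Psi^{+}$ and $\Psi^{ - }$ are inverse bijections of each other. Furthermore, they preserve the number of edges of the map, and they preserve the type of the map when the faces are labeled.
   Context: A map is a cellular embedding of a finite connected graph (multiple edges and loops allowed) into a compact orientable surface, up to homeomorphism, with a distinguished corner (the root); its incident vertex is the root vertex. The type of a map with faces labeled $f_1,\dots,f_r$ is $(\deg f_1,\dots,\deg f_r)$. A half-edge is an oriented edge, from tail $e^-$ to head $e^+$. A path is a sequence $(e_1,\dots,e_k)$ of half-edges with $e_i^+=e_{i+1}^-$; it is simple if the vertices it visits are pairwise distinct. Concatenation is denoted $\bullet$. A loop is a path with $e_k^+=e_1^-$; it is simple if $(e_1,\dots,e_{k-1})$ is simple; it is noncontractible if its traced closed curve is not null-homotopic on the surface. Rotation $\Phi$: given $\mathbf{m}$, a noncontractible simple loop $\boldsymbol{\gamma}=(\gamma_1,\dots,\gamma_k)$ and $\varepsilon\in\{+,-\}$, cut the surface along $\boldsymbol{\gamma}$, obtaining a left copy $(\gamma^\ell_i)_i$ and a right copy $(\gamma^r_i)_i$ on two boundary components; glue $\gamma^r_i$ to $\gamma^\ell_{i+1}$ if $\varepsilon=+$, resp. $\gamma^\ell_{i-1}$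 if $\varepsilon=-$ (indices mod $k$); the resulting map $\tilde{\mathbf{m}}$ inherits root and face labels; $\tilde{\boldsymbol{\gamma}}$ is the image loop formed by the glued half-edges, and $\tilde\varepsilon=-\varepsilon$. $\Phi(\mathbf{m},\boldsymbol{\gamma},\varepsilon):=(\tilde{\mathbf{m}},\tilde{\boldsymbol{\gamma}},\tilde\varepsilon)$. Rightmost noncontractible simple loop $\boldsymbol{\lambda}_\mathbf{m}$: let $\mathcal{S}$ be the set of paths $\mathbf{p}\bullet\boldsymbol{\gamma}$ with $\mathbf{p}$ a simple path starting at the root vertex and $\boldsymbol{\gamma}$ a noncontractible simple loop intersecting $\mathbf{p}$ only at the origin of $\boldsymbol{\gamma}$ (the end of $\mathbf{p}$). Build $\boldsymbol{\wp}$ iteratively: $\wp_1$ is the first half-edge, turning counterclockwise around the root vertex starting from the root corner, that is the first half-edge of some element of $\mathcal{S}$; given $(\wp_1,\dots,\wp_i)$, if it belongs to $\mathcal{S}$ stop, otherwise let $\wp_{i+1}$ be the first half-edge after $\wp_i$ counterclockwise around $\wp_i^+$ such that some element of $\mathcal{S}$ has prefix $(\wp_1,\dots,\wp_{i+1})$. Writing the final path as $\boldsymbol{\wp}=\mathbf{p}\bullet\boldsymbol{\gamma}\in\mathcal{S}$, set $\boldsymbol{\lambda}_\mathbf{m}:=\boldsymbol{\gamma}$. -}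

module Defs where

open import Data.Nat using (ℕ; zero; suc; _+_; _*_; _<_; _≤ᵇ_)
open import Data.Nat.Divisibility using (_∣_)
open import Data.Fin using (Fin; toℕ) renaming (_≟_ to _≟F_)
open import Data.Bool using (Bool; true; false; if_then_else_; _∧_)
open import Data.List using (List; []; _∷_; _++_; map; reverse; allFin; upTo; length; filterᵇ)
open import Data.List.Relation.Unary.All using (All)
open import Data.List.Relation.Unary.AllPairs using (AllPairs)
open import Data.Product using (Σ; ∃; ∃₂; _×_; _,_)
open import Data.Unit using (⊤)
open import Data.Empty using (⊥)
open import Function using (_∘_)
open import Function.Definitions using (Injective)
open import Relation.Nullary using (¬_; does)
open import Relation.Binary.PropositionalEquality using (_≡_; _≢_)
open import Relation.Binary.Construct.Closure.Equivalence using (EqClosure)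

iter : ∀ {A : Set} → (A → A) → ℕ → A → A
iter f zero    x = x
iter f (suc k) x = f (iter f k x)

SameOrbit : ∀ {n} → (Fin n → Fin n) → Fin n → Fin n → Set
SameOrbit p d e = ∃ λ k → iter p k d ≡ e

allB : ∀ {A : Set} → List A → (A → Bool) → Bool
allB []       P = true
allB (x ∷ xs) P = P x ∧ allB xs P

countB : ∀ {n} → (Fin n → Bool) → ℕ
countB {n} P = length (filterᵇ P (allFin n))

isRep : ∀ {n} → (Fin n → Fin n) → Fin n → Bool
isRep {n} p d = allB (upTo n) (λ k → toℕ d ≤ᵇ toℕ (iter p k d))

numOrbits : ∀ {n} → (Fin n → Fin n) → ℕ
numOrbits p = countB (isRep p)

orbitList : ∀ {n} → (Fin n → Fin n) → Fin n → ℕ → List (Fin n)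
orbitList p d zero    = []
orbitList p d (suc m) = d ∷ orbitList p (p d) m

lastOf : ∀ {A : Set} → A → List A → A
lastOf x []       = x
lastOf x (y ∷ ys) = lastOf y ys

headOf : ∀ {A : Set} → List A → A → A
headOf []      g = g
headOf (x ∷ _) g = x

cycGo : ∀ {n} → Fin n → List (Fin n) → Fin n → Fin n
cycGo first []           d = d
cycGo first (y ∷ [])     d = if does (d ≟F y) then first else d
cycGo first (y ∷ z ∷ zs) d = if does (d ≟F y) then z else cycGo first (z ∷ zs) d

cycFwd : ∀ {n} → List (Fin n) → Fin n → Fin n
cycFwd []       d = d
cycFwd (x ∷ xs) d = cycGo x (x ∷ xs) d

cycBwd : ∀ {n} → List (Fin n) → Fin n → Fin n
cycBwd γ = cycFwd (reverse γ)

-- Rooted maps with labelled faces, as combinatorial maps on darts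
-- (= half-edges) Fin n.  σ: counterclockwise rotation of the darts
-- around their tail vertex;  α: reversal of a half-edge;
-- faces are the cycles of φ = σ ∘ α.  The root corner is the corner
-- immediately preceding (clockwise of) the dart 'root' around its tail.
-- lab d is the label of the face containing the corner preceding d.

record Map (n r : ℕ) : Set where
  field
    σ    : Fin n → Fin n
    α    : Fin n → Fin n
    root : Fin n
    lab  : Fin n → Fin r

module _ {n r : ℕ} (M : Map n r) where
  open Map M

  φ : Fin n → Fin n
  φ = σ ∘ α

  data Conn (d : Fin n) : Fin n → Set where
    here : Conn d d
    viaσ : ∀ {e} → Conn d e → Conn d (σ e)
    viaα : ∀ {e} → Conn d e → Conn d (α e)

  record IsMap : Set where
    field
      σ-inj     : Injective _≡_ _≡_ σ
      α-invol   : ∀ d → α (α d) ≡ d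
      α-free    : ∀ d → α d ≢ d
      connected : ∀ d e → Conn d e
      lab-face  : ∀ d → lab (φ d) ≡ lab d
      lab-inj   : ∀ d e → lab d ≡ lab e → SameOrbit φ d e
      lab-surj  : ∀ i → ∃ λ d → lab d ≡ i

  numVertices numEdges numFaces : ℕ
  numVertices = numOrbits σ
  numEdges    = numOrbits α
  numFaces    = numOrbits φ

  -- Euler formula  V - E + F = 2 - 2g
  HasGenus : ℕ → Set
  HasGenus g = numVertices + numFaces + 2 * g ≡ numEdges + 2

  faceDeg : Fin r → ℕ
  faceDeg i = countB (λ d → does (lab d ≟F i))

  EvenFaces : Set
  EvenFaces = ∀ i → 2 ∣ faceDeg i

  InMg : ℕ → Set
  InMg g = IsMap × HasGenus g × EvenFaces

  -- Homotopy of closed walks (words in darts, α d = d⁻¹), generated by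
  -- backtrack insertion and face-boundary insertion.
  data HStep : List (Fin n) → List (Fin n) → Set where
    back : ∀ xs ys d → HStep (xs ++ ys) (xs ++ d ∷ α d ∷ ys)
    face : ∀ xs ys d k → iter φ (suc k) d ≡ d →
           HStep (xs ++ ys) (xs ++ orbitList φ d (suc k) ++ ys)

  Contractible : List (Fin n) → Set
  Contractible γ = EqClosure HStep γ []

  -- vertices: σ-orbits; the tail of dart d is its vertex, the head is that of α d
  SameV : Fin n → Fin n → Set
  SameV = SameOrbit σ

  DistinctV : Fin n → Fin n → Set
  DistinctV d e = ¬ SameV d e

  Walk : List (Fin n) → Set
  Walk []           = ⊤
  Walk (x ∷ [])     = ⊤
  Walk (x ∷ y ∷ zs) = SameV (α x) y × Walk (y ∷ zs)

  -- p • γ is in the set S:  p simple path from root vertex, γ noncontractible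
  -- simple loop meeting p only at its origin (= end of p)
  InSSplit : List (Fin n) → List (Fin n) → Set
  InSSplit p []       = ⊥
  InSSplit p (g ∷ gs) =
      Walk (p ++ g ∷ gs)
    × SameV root (headOf p g)
    × SameV (α (lastOf g gs)) g
    × AllPairs DistinctV (g ∷ gs)
    × AllPairs DistinctV (p ++ g ∷ [])
    × All (λ x → All (λ y → DistinctV x y) (g ∷ gs)) p
    × ¬ Contractible (g ∷ gs)

  InS : List (Fin n) → Set
  InS w = ∃₂ λ p γ → w ≡ p ++ γ × InSSplit p γ

  Pref : List (Fin n) → Set
  Pref q = ∃ λ rest → InS (q ++ rest)

  Greedy : List (Fin n) → Set
  Greedy w =
      InS w
    × (∀ q rest → rest ≢ [] → w ≡ q ++ rest → ¬ InS q)
    × (∀ x rest → w ≡ x ∷ rest →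
         ∃ λ j → x ≡ iter σ j root
               × (∀ j' → j' < j → ¬ Pref (iter σ j' root ∷ [])))
    × (∀ q y z rest → w ≡ q ++ y ∷ z ∷ rest →
         ∃ λ j → z ≡ iter σ (suc j) (α y)
               × (∀ j' → j' < j → ¬ Pref (q ++ y ∷ iter σ (suc j') (α y) ∷ [])))

  IsRightmost : List (Fin n) → Set
  IsRightmost γ = ∃ λ p → Greedy (p ++ γ) × InSSplit p γ

data Sign : Set where
  plus minus : Sign

neg : Sign → Sign
neg plus  = minus
neg minus = plus

Φ : ∀ {n r} → Sign → Map n r → List (Fin n) → Map n r
Φ plus M γ = record
  { σ    = cycFwd γ ∘ Map.σ M ∘ cycBwd (map (Map.α M) γ)
  ; α    = Map.α M
  ; root = cycFwd γ (Map.root M)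
  ; lab  = Map.lab M ∘ cycBwd γ }
Φ minus M γ = record
  { σ    = cycBwd γ ∘ Map.σ M ∘ cycFwd (map (Map.α M) γ)
  ; α    = Map.α M
  ; root = cycBwd γ (Map.root M)
  ; lab  = Map.lab M ∘ cycFwd γ }

record _≅_ {n r} (M M' : Map n r) : Set where
  field
    f      : Fin n → Fin n
    f⁻¹    : Fin n → Fin n
    inv₁   : ∀ d → f (f⁻¹ d) ≡ d
    inv₂   : ∀ d → f⁻¹ (f d) ≡ d
    f-σ    : ∀ d → f (Map.σ M d) ≡ Map.σ M' (f d)
    f-α    : ∀ d → f (Map.α M d) ≡ Map.α M' (f d)
    f-root : f (Map.root M) ≡ Map.root M'
    f-lab  : ∀ d → Map.lab M' (f d) ≡ Map.lab M d

{-# OPTIONS --safe #-}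

-- The rightmost path p ++ γ always reaches γ from the right: otherwise p followed by
-- the reversal of γ would be explored earlier.  A rotation along γ only regroups the
-- right sectors of the vertices of γ with the next left sectors, so in the rotated map
-- the image of p ++ γ has the same darts on its right as before.  If the exploration of
-- the rotated map left this image, the detour, read in the original map, would either
-- give an earlier lasso there, or close up into a contractible loop that lies to the
-- right of γ; the disc bounded by this loop survives the rotation.  So the rightmost
-- loop of the rotated map is the image of γ, and rotating back gives the original map.
--
-- This needs the fact that a simple loop is contractible only if it bounds a disc, in a
-- decidable form.  A tree-cotree decomposition of a side of the loop either covers all
-- edges, and then the side is simply connected, or leaves an edge, and then there is a
-- mod 2 cocycle, supported inside this side, that is odd on some cycle.  If both sides
-- have such a cocycle, then a lift of the loop to the double cover given by their sum is
-- nonseparating, and hence neither this lift nor the loop is contractible.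

module Submission where

open import Defs
open import Data.Nat as ℕ using (ℕ; zero; suc; _+_; _*_; _∸_; _≤_; _<_; z≤n; s≤s)
import Data.Nat.Properties as ℕₚ
open import Data.Nat.Divisibility using (_∣_)
open import Data.Fin as Fin using (Fin; toℕ) renaming (_≟_ to _≟F_)
import Data.Fin.Properties as Finₚ
open import Data.Bool as Bool using (Bool; true; false; if_then_else_; _xor_; not; T)
import Data.Bool.Properties as Boolₚ
open import Data.List using (List; []; _∷_; _++_; map; reverse; allFin; upTo; length; filterᵇ; foldr; [_])
import Data.List.Properties as Listₚ
open import Data.List.Relation.Unary.All as All using (All; []; _∷_)
import Data.List.Relation.Unary.All.Properties as Allₚ
open import Data.List.Relation.Unary.Any as Any using (Any; here; there)
import Data.List.Relation.Unary.Any.Properties as Anyₚ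
open import Data.List.Relation.Unary.AllPairs as AllPairs using (AllPairs; []; _∷_)
import Data.List.Relation.Unary.AllPairs.Properties as AllPairsₚ
open import Data.List.Membership.Propositional using (_∈_; _∉_; find; lose)
import Data.List.Membership.Propositional.Properties as ∈ₚ
open import Data.Product using (∃; ∃₂; _×_; _,_; proj₁; proj₂)
open import Data.Sum using (_⊎_; inj₁; inj₂; [_,_]′)
open import Data.Unit using (⊤; tt)
open import Data.Empty using (⊥; ⊥-elim)
open import Function using (_∘_; id; case_of_)
open import Function.Definitions using (Injective)
open import Relation.Nullary using (¬_; Dec; yes; no; does)
open import Relation.Nullary.Decidable using (map′; _×-dec_; _⊎-dec_; ¬?; dec-true; dec-false)
open import Relation.Binary.PropositionalEquality using (_≡_; _≢_; refl; sym; trans; cong; cong₂; subst; isEquivalence; setoid; module ≡-Reasoning)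
open import Relation.Binary.Construct.Closure.Equivalence using (EqClosure)
import Relation.Binary.Construct.Closure.Equivalence as EqC
open import Relation.Binary.Definitions using (DecidableEquality)
open import Algebra.Bundles using (Group; module CommutativeRing)
import Algebra.Properties.Group as GroupProperties
open import Level using (0ℓ)
import Data.List.Relation.Binary.Permutation.Propositional as Perm↭
import Data.List.Relation.Binary.Permutation.Propositional.Properties as Perm↭ₚ
import Data.List.Relation.Binary.Permutation.Setoid.Properties as Perm↭ₛ
open import Data.Product.Properties using (≡-dec)

-- Orbits of a permutation

-- A rotation shifts the darts of γ by a cyclic permutation `c` and leaves their reversals in place.
-- It conjugates the face permutation by `c`, so faces cause no difficulty; all changes concern the
-- vertices along γ. Both signs are treated at once, for an arbitrary shift `c` with inverse `c⁻`.
-- The obstacle is contractibility: `c` carries face words to face words, but in general not the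
-- backtracks `d , α d` with `d` on γ, so a contraction in `M` cannot be replayed in the rotated
-- map. What can be carried over is a disc with no edge of γ in its interior. For this reason `Disc`
-- quantifies over representations in all groups: in the word group of `M` it yields contractions in
-- `M`, and in the word group of the rotated map, with relabelled darts, it yields contractions
-- there. The proof is constructive, so the exploration must decide whether a path extends to an
-- element of `S`. This forces an explicit certificate for each outcome of the classification of
-- simple loops: a disc, or a mod 2 cocycle that is odd on the loop or on one of its lifts.

iter-+ : ∀ {A : Set} (p : A → A) a b {x} → iter p (a + b) x ≡ iter p a (iter p b x)
iter-+ p zero    b = refl
iter-+ p (suc a) b = cong p (iter-+ p a b)

iter-comm : ∀ {A : Set} (p : A → A) k {x} → iter p k (p x) ≡ p (iter p k x)
iter-comm p zero    = refl
iter-comm p (suc k) = cong p (iter-comm p k)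

iter-inj : ∀ {A : Set} {p : A → A} → Injective _≡_ _≡_ p → ∀ k {x y} → iter p k x ≡ iter p k y → x ≡ y
iter-inj inj zero    eq = eq
iter-inj inj (suc k) eq = iter-inj inj k (inj eq)

module Perm {n : ℕ} (p : Fin n → Fin n) (inj : Injective _≡_ _≡_ p) where

  abstract
    -- Pigeonhole on the first `n + 1` iterates. The bound by `n` turns orbit membership into a
    -- finite search.
    period : ∀ d → ∃ λ k → suc k ≤ n × iter p (suc k) d ≡ d
    period d with Finₚ.pigeonhole (ℕₚ.n<1+n n) (λ i → iter p (toℕ i) d)
    ... | i , j , i<j , eq with ℕₚ.m≤n⇒∃[o]m+o≡n i<j
    ... | k , i+k≡j = k , ℕₚ.≤-trans (ℕₚ.≤-trans (ℕₚ.m≤n+m (suc k) (toℕ i)) (ℕₚ.≤-reflexive (trans (ℕₚ.+-suc (toℕ i) k) i+k≡j)))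
                                     (ℕₚ.≤-pred (Finₚ.toℕ<n j))
                        , sym (iter-inj inj (toℕ i) (trans eq (trans (cong (λ m → iter p m d) (sym (trans (ℕₚ.+-suc (toℕ i) k) i+k≡j)))
                                                                 (iter-+ p (toℕ i) (suc k)))))

    orbit-bounded : ∀ {d e k} → iter p (suc k) d ≡ d → SameOrbit p d e → ∃ λ j → j ≤ k × iter p j d ≡ e
    orbit-bounded {d} {k = k} per (zero , eq) = zero , z≤n , eq
    orbit-bounded {d} {k = k} per (suc m , refl) with orbit-bounded per (m , refl)
    ... | j , j≤k , eq with j ℕ.≟ k
    ...   | yes refl = zero , z≤n , trans (sym per) (cong p eq)
    ...   | no j≢k   = suc j , ℕₚ.≤∧≢⇒< j≤k j≢k , cong p eq

    orbit-< : ∀ {d e} → SameOrbit p d e → ∃ λ j → j < n × iter p j d ≡ e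
    orbit-< {d} so with period d
    ... | k , k<n , per with orbit-bounded per so
    ... | j , j≤k , eq = j , ℕₚ.≤-<-trans j≤k k<n , eq

    ~refl : ∀ {d} → SameOrbit p d d
    ~refl = zero , refl

    ~step : ∀ {d} → SameOrbit p d (p d)
    ~step = 1 , refl

    ~trans : ∀ {d e f} → SameOrbit p d e → SameOrbit p e f → SameOrbit p d f
    ~trans {d} (a , refl) (b , refl) = b + a , iter-+ p b a

    ~sym : ∀ {d e} → SameOrbit p d e → SameOrbit p e d
    ~sym {d} so with period d
    ... | k , k<n , per with orbit-bounded per so
    ... | j , j≤k , refl = suc (k ∸ j) , trans (sym (iter-+ p (suc (k ∸ j)) j))
                                               (trans (cong (λ m → iter p (suc m) d) (ℕₚ.m∸n+n≡m j≤k)) per)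

    ~post : ∀ {d e} → SameOrbit p d (p e) → SameOrbit p d e
    ~post so = ~trans so (~sym ~step)

    ~reflexive : ∀ {d e} → d ≡ e → SameOrbit p d e
    ~reflexive refl = ~refl

    _~?_ : ∀ d e → Dec (SameOrbit p d e)
    d ~? e = map′ (λ { (i , eq) → toℕ i , eq })
                  (λ so → let (j , j<n , eq) = orbit-< so in
                     Fin.fromℕ< j<n , trans (cong (λ m → iter p m d) (Finₚ.toℕ-fromℕ< j<n)) eq)
                  (Finₚ.any? (λ i → iter p (toℕ i) d ≟F e))

    inverse : ∀ d → ∃ λ e → p e ≡ d
    inverse d with period d
    ... | k , _ , per = iter p k d , per

    -- Minimality ensures that the starting dart occurs only once in its orbit list; `last-in-face`
    -- relies on this.
    minPeriod : ∀ d → ∃ λ k → iter p (suc k) d ≡ d × (∀ j → j < k → iter p (suc j) d ≢ d)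
    minPeriod d with period d
    ... | k , _ , per = go k zero (trans (cong (λ m → iter p (suc m) d) (ℕₚ.+-identityʳ k)) per) (λ j ())
      where
      go : ∀ fuel k → iter p (suc (fuel + k)) d ≡ d → (∀ j → j < k → iter p (suc j) d ≢ d) →
           ∃ λ k → iter p (suc k) d ≡ d × (∀ j → j < k → iter p (suc j) d ≢ d)
      go zero    k per below = k , per , below
      go (suc f) k per below with iter p (suc k) d ≟F d
      ... | yes eq = k , eq , below
      ... | no ne  = go f (suc k) (trans (cong (λ m → iter p (suc m) d) (ℕₚ.+-suc f k)) per)
                       λ j j<sk → case ℕₚ.m≤n⇒m<n∨m≡n (ℕₚ.≤-pred j<sk) of λ where
                         (inj₁ j<k) → below j j<k
                         (inj₂ refl) → ne

-- The darts met when turning from s towards t, both ends excluded.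
data Arc {n : ℕ} (p : Fin n → Fin n) (s t : Fin n) : Fin n → Set where
  first : p s ≢ t → Arc p s t (p s)
  next  : ∀ {x} → Arc p s t x → p x ≢ t → Arc p s t (p x)

arc-iter : ∀ {n} {p : Fin n → Fin n} {s t x} → Arc p s t x →
           ∃ λ m → x ≡ iter p (suc m) s × (∀ j → j ≤ m → iter p (suc j) s ≢ t)
arc-iter (first ne) = zero , refl , λ { .zero z≤n → ne }
arc-iter {p = p} (next a ne) with arc-iter a
... | m , refl , below = suc m , refl , λ j j≤sm → case ℕₚ.m≤n⇒m<n∨m≡n j≤sm of λ where
        (inj₁ j<sm) → below j (ℕₚ.≤-pred j<sm)
        (inj₂ refl) → ne

iter-arc : ∀ {n} {p : Fin n → Fin n} {s t} m → (∀ j → j ≤ m → iter p (suc j) s ≢ t) → Arc p s t (iter p (suc m) s)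
iter-arc zero    below = first (below zero z≤n)
iter-arc (suc m) below = next (iter-arc m λ j j≤m → below j (ℕₚ.m≤n⇒m≤1+n j≤m)) (below (suc m) ℕₚ.≤-refl)

module Arcs {n : ℕ} (p : Fin n → Fin n) (inj : Injective _≡_ _≡_ p) where
  open Perm p inj

  arc-~ : ∀ {s t x} → Arc p s t x → SameOrbit p s x
  arc-~ a with arc-iter a
  ... | m , refl , _ = suc m , refl

  arc≢end : ∀ {s t x} → Arc p s t x → x ≢ t
  arc≢end (first ne)  = ne
  arc≢end (next _ ne) = ne

  arc≢start : ∀ {s t x} → SameOrbit p s t → Arc p s t x → x ≢ s
  arc≢start {s} {t} s~t a refl with arc-iter a
  ... | m , s≡ , below with orbit-bounded (sym s≡) s~t
  ... | zero  , _   , eq = below m ℕₚ.≤-refl (trans (sym s≡) eq)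
  ... | suc j , j≤m , eq = below j (ℕₚ.<⇒≤ j≤m) eq

  -- Induction by turning on: after `x`, every dart strictly before `t` still lies on the arc, so
  -- the step can be repeated until `t` is reached.
  arc-onwards : ∀ {s t x} (P : Fin n → Set) → SameOrbit p s t → Arc p s t x → P x →
                (∀ y → Arc p s t y → P y → P (p y)) → P t
  arc-onwards {s} {t} {x} P s~t ax px step with ~trans (~sym (arc-~ ax)) s~t
  ... | zero  , refl = px
  ... | suc k , eq = go k ax px eq
    where
    go : ∀ k {x} → Arc p s t x → P x → iter p (suc k) x ≡ t → P t
    go k {x} ax px eq with p x ≟F t
    ... | yes refl = step x ax px
    go zero ax px eq | no ne = ⊥-elim (ne eq)
    go (suc k) {x} ax px eq | no ne = go k (next ax ne) (step x ax px) (trans (cong p (iter-comm p k)) eq)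

  arc-through : ∀ {s t} (P : Fin n → Set) → SameOrbit p s t → P (p s) →
                (∀ y → Arc p s t y → P y → P (p y)) → P t
  arc-through {s} {t} P s~t ps step with p s ≟F t
  ... | yes refl = ps
  ... | no ne    = arc-onwards P s~t (first ne) ps step

  arc-cases : ∀ {s t d} → s ≢ t → SameOrbit p s t → SameOrbit p s d →
              d ≡ s ⊎ d ≡ t ⊎ Arc p s t d ⊎ Arc p t s d
  arc-cases s≢t s~t (zero , refl) = inj₁ refl
  arc-cases {s} {t} s≢t s~t (suc k , refl) = case arc-cases {d = iter p k s} s≢t s~t (k , refl) of λ where
      (inj₁ eq)               → subst (λ y → Goal (p y)) (sym eq) (atS s refl)
      (inj₂ (inj₁ eq))        → subst (λ y → Goal (p y)) (sym eq) (atT t refl)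
      (inj₂ (inj₂ (inj₁ a)))  → st a
      (inj₂ (inj₂ (inj₂ a)))  → ts a
    where
    Goal : Fin n → Set
    Goal d = d ≡ s ⊎ d ≡ t ⊎ Arc p s t d ⊎ Arc p t s d
    atS : ∀ y → y ≡ s → Goal (p y)
    atS y refl with p s ≟F t
    ... | yes eq = inj₂ (inj₁ eq)
    ... | no ne  = inj₂ (inj₂ (inj₁ (first ne)))
    atT : ∀ y → y ≡ t → Goal (p y)
    atT y refl with p t ≟F s
    ... | yes eq = inj₁ eq
    ... | no ne  = inj₂ (inj₂ (inj₂ (first ne)))
    st : ∀ {y} → Arc p s t y → Goal (p y)
    st {y} a with p y ≟F t
    ... | yes eq = inj₂ (inj₁ eq)
    ... | no ne  = inj₂ (inj₂ (inj₁ (next a ne)))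
    ts : ∀ {y} → Arc p t s y → Goal (p y)
    ts {y} a with p y ≟F s
    ... | yes eq = inj₁ eq
    ... | no ne  = inj₂ (inj₂ (inj₂ (next a ne)))

  -- A common dart stays on the arc from `t` to `s` while one turns on along the other arc, until
  -- that arc ends at `t`, which cannot lie on an arc that starts there.
  arc-disjoint : ∀ {s t d} → s ≢ t → SameOrbit p s t → Arc p s t d → ¬ Arc p t s d
  arc-disjoint {s} {t} s≢t s~t ast ats =
    arc≢start (~sym s~t) (arc-onwards (Arc p t s) s~t ast ats step) refl
    where
    step : ∀ y → Arc p s t y → Arc p t s y → Arc p t s (p y)
    step y ay by with p y ≟F s
    ... | no ne  = next by ne
    ... | yes eq with p y ≟F t
    ...   | yes eq′ = ⊥-elim (s≢t (trans (sym eq) eq′))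
    ...   | no ne′  = ⊥-elim (arc≢start s~t (next ay ne′) eq)

-- Mod 2 cocycles and their lifts to double covers

xor-cancel : ∀ a {b c} → a xor b ≡ a xor c → b ≡ c
xor-cancel false eq = eq
xor-cancel true {false} {false} eq = refl
xor-cancel true {true}  {true}  eq = refl

xor-cancel² : ∀ a b → (a xor b) xor b ≡ a
xor-cancel² a b = trans (Boolₚ.xor-assoc a b b) (trans (cong (a xor_) (Boolₚ.xor-same b)) (Boolₚ.xor-identityʳ a))

xor-swap : ∀ a b c → a xor (b xor c) ≡ b xor (a xor c)
xor-swap false b     c = refl
xor-swap true  false c = refl
xor-swap true  true  c = refl

xor-mid : ∀ a b c d → (a xor b) xor (c xor d) ≡ (a xor c) xor (b xor d)
xor-mid a b c d = trans (Boolₚ.xor-assoc a b (c xor d))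
                        (trans (cong (a xor_) (xor-swap b c d)) (sym (Boolₚ.xor-assoc a c (b xor d))))

xor-true : ∀ a b → a xor b ≡ true → a ≡ true ⊎ b ≡ true
xor-true true  b eq = inj₁ refl
xor-true false b eq = inj₂ eq

sumB : ∀ {X : Set} → (X → Bool) → List X → Bool
sumB f = foldr (λ x b → f x xor b) false

sumB-cong : ∀ {X : Set} {f g : X → Bool} {xs} → All (λ x → f x ≡ g x) xs → sumB f xs ≡ sumB g xs
sumB-cong []         = refl
sumB-cong (eq ∷ eqs) = cong₂ _xor_ eq (sumB-cong eqs)

sumB-false : ∀ {X : Set} {f : X → Bool} {xs} → All (λ x → f x ≡ false) xs → sumB f xs ≡ false
sumB-false []         = refl
sumB-false (eq ∷ eqs) = cong₂ _xor_ eq (sumB-false eqs)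

sumB-++ : ∀ {X : Set} (f : X → Bool) xs {ys} → sumB f (xs ++ ys) ≡ sumB f xs xor sumB f ys
sumB-++ f []       = refl
sumB-++ f (x ∷ xs) = trans (cong (f x xor_) (sumB-++ f xs)) (sym (Boolₚ.xor-assoc (f x) _ _))

orbitSum : ∀ {X : Set} → (X → X) → (X → Bool) → X → ℕ → Bool
orbitSum p f x zero    = false
orbitSum p f x (suc m) = f x xor orbitSum p f (p x) m

orbitSum-list : ∀ {n} (p : Fin n → Fin n) f d m → sumB f (orbitList p d m) ≡ orbitSum p f d m
orbitSum-list p f d zero    = refl
orbitSum-list p f d (suc m) = cong (f d xor_) (orbitSum-list p f (p d) m)

module _ {X : Set} (p : X → X) where

  orbitSum-cong : ∀ {f g} → (∀ x → f x ≡ g x) → ∀ x m → orbitSum p f x m ≡ orbitSum p g x m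
  orbitSum-cong eq x zero    = refl
  orbitSum-cong eq x (suc m) = cong₂ _xor_ (eq x) (orbitSum-cong eq (p x) m)

  orbitSum-xor : ∀ f g x m → orbitSum p (λ y → f y xor g y) x m ≡ orbitSum p f x m xor orbitSum p g x m
  orbitSum-xor f g x zero    = refl
  orbitSum-xor f g x (suc m) = trans (cong ((f x xor g x) xor_) (orbitSum-xor f g (p x) m)) (xor-mid (f x) (g x) _ _)

  orbitSum-last : ∀ f x m → orbitSum p f x (suc m) ≡ orbitSum p f x m xor f (iter p m x)
  orbitSum-last f x zero    = Boolₚ.xor-identityʳ (f x)
  orbitSum-last f x (suc m) = begin
      f x xor orbitSum p f (p x) (suc m)                        ≡⟨ cong (f x xor_) (orbitSum-last f (p x) m) ⟩
      f x xor (orbitSum p f (p x) m xor f (iter p m (p x)))     ≡⟨ Boolₚ.xor-assoc (f x) _ _ ⟨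
      orbitSum p f x (suc m) xor f (iter p m (p x))             ≡⟨ cong (λ y → orbitSum p f x (suc m) xor f y) (iter-comm p m) ⟩
      orbitSum p f x (suc m) xor f (iter p (suc m) x)           ∎
    where open ≡-Reasoning

  orbitSum-shift : ∀ f x m → orbitSum p f (p x) m ≡ orbitSum p (f ∘ p) x m
  orbitSum-shift f x zero    = refl
  orbitSum-shift f x (suc m) = cong (f (p x) xor_) (orbitSum-shift f (p x) m)

  orbitSum-rotate : ∀ f x m → iter p m x ≡ x → orbitSum p (f ∘ p) x m ≡ orbitSum p f x m
  orbitSum-rotate f x m per = trans (sym (orbitSum-shift f x m)) (xor-cancel (f x) (begin
      orbitSum p f x (suc m)                    ≡⟨ orbitSum-last f x m ⟩
      orbitSum p f x m xor f (iter p m x)       ≡⟨ cong (λ y → orbitSum p f x m xor f y) per ⟩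
      orbitSum p f x m xor f x                  ≡⟨ Boolₚ.xor-comm _ (f x) ⟩
      f x xor orbitSum p f x m                  ∎))
    where open ≡-Reasoning

-- A walk along the orbits of p that changes orbit by crossing edges; the list
-- records the darts at which it crosses.  For p = φ this is a walk in the dual map.
data Trail {X : Set} (p α : X → X) : X → List X → X → Set where
  stop  : ∀ {x} → Trail p α x [] x
  fwd   : ∀ {x ds y} → Trail p α (p x) ds y → Trail p α x ds y
  bwd   : ∀ {x ds y} → Trail p α x ds y → Trail p α (p x) ds y
  cross : ∀ {x ds y} → Trail p α (α x) ds y → Trail p α x (x ∷ ds) y

trail-++ : ∀ {X : Set} {p α : X → X} {x xs y ys z} → Trail p α x xs y → Trail p α y ys z → Trail p α x (xs ++ ys) z
trail-++ stop      u = u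
trail-++ (fwd t)   u = fwd (trail-++ t u)
trail-++ (bwd t)   u = bwd (trail-++ t u)
trail-++ (cross t) u = cross (trail-++ t u)

module Crossing {X : Set} (_≟_ : DecidableEquality X) (p α : X → X)
  (p-inj : Injective _≡_ _≡_ p) (α-invol : ∀ x → α (α x) ≡ x) where

  trail-reverse : ∀ {x ds y} → Trail p α x ds y → ∃ λ es → Trail p α y es x × (∀ {e} → e ∈ es → α e ∈ ds)
  trail-reverse stop    = [] , stop , λ ()
  trail-reverse (fwd t) = let (es , u , h) = trail-reverse t in es , subst (λ l → Trail p α _ l _) (Listₚ.++-identityʳ es) (trail-++ u (bwd stop)) , h
  trail-reverse (bwd t) = let (es , u , h) = trail-reverse t in es , subst (λ l → Trail p α _ l _) (Listₚ.++-identityʳ es) (trail-++ u (fwd stop)) , h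
  trail-reverse (cross {x} t) = let (es , u , h) = trail-reverse t in
    es ++ α x ∷ [] , trail-++ u (cross (subst (λ w → Trail p α w [] x) (sym (α-invol x)) stop)) ,
    λ e∈ → case ∈ₚ.∈-++⁻ es e∈ of λ where
      (inj₁ e∈es)       → there (h e∈es)
      (inj₂ (here refl)) → here (α-invol x)

  onEdge : X → X → Bool
  onEdge s d = does (s ≟ d) xor does (s ≟ α d)

  -- The mod 2 intersection number of an edge with the trail that crosses at `ds`. The type `X` is
  -- arbitrary because the same count is made in the double cover.
  crossings : List X → X → Bool
  crossings ds d = sumB (λ s → onEdge s d) ds

  crossings-α : ∀ ds d → crossings ds (α d) ≡ crossings ds d
  crossings-α ds d = sumB-cong (All.universal eq ds)
    where
    eq : ∀ s → onEdge s (α d) ≡ onEdge s d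
    eq s = trans (Boolₚ.xor-comm (does (s ≟ α d)) _) (cong (λ e → does (s ≟ e) xor does (s ≟ α d)) (α-invol d))

  onEdge-off : ∀ {s d} → s ≢ d → s ≢ α d → onEdge s d ≡ false
  onEdge-off {s} {d} ne ne′ rewrite dec-false (s ≟ d) ne | dec-false (s ≟ α d) ne′ = refl

  onEdge-self : ∀ {s} → s ≢ α s → onEdge s s ≡ true
  onEdge-self {s} ne rewrite dec-true (s ≟ s) refl | dec-false (s ≟ α s) ne = refl

  crossings-off : ∀ {ds d} → All (λ s → s ≢ d × s ≢ α d) ds → crossings ds d ≡ false
  crossings-off off = sumB-false (All.map (λ (ne , ne′) → onEdge-off ne ne′) off)

  crossings-support : ∀ ds {d} → crossings ds d ≡ true → d ∈ ds ⊎ α d ∈ ds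
  crossings-support (s ∷ ds) {d} eq with s ≟ d | s ≟ α d | crossings-support ds {d}
  ... | yes refl | _        | _  = inj₁ (here refl)
  ... | no _     | yes refl | _  = inj₂ (here refl)
  ... | no _     | no _     | ih = [ inj₁ ∘ there , inj₂ ∘ there ]′ (ih eq)

  private
    count : X → ℕ → X → Bool
    count z m e = orbitSum p (λ d → does (e ≟ d)) z m

    count-p : ∀ {z m} → iter p m z ≡ z → ∀ e → count z m (p e) ≡ count z m e
    count-p {z} {m} per e = trans (sym (orbitSum-rotate p (λ d → does (p e ≟ d)) z m per)) (orbitSum-cong p eq z m)
      where
      eq : ∀ d → does (p e ≟ p d) ≡ does (e ≟ d)
      eq d with e ≟ d
      ... | yes refl = dec-true (p e ≟ p e) refl
      ... | no ne    = dec-false (p e ≟ p d) (ne ∘ p-inj)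

    does-α : ∀ s d → does (s ≟ α d) ≡ does (α s ≟ d)
    does-α s d with s ≟ α d
    ... | yes refl = sym (dec-true (α (α d) ≟ d) (α-invol d))
    ... | no ne    = sym (dec-false (α s ≟ d) (λ { refl → ne (sym (α-invol s)) }))

    count-cross : ∀ s z m → orbitSum p (onEdge s) z m ≡ count z m s xor count z m (α s)
    count-cross s z m = trans (orbitSum-xor p _ _ z m) (cong (count z m s xor_) (orbitSum-cong p (does-α s) z m))

    orbitSum-0 : ∀ z m → orbitSum p (λ _ → false) z m ≡ false
    orbitSum-0 z zero    = refl
    orbitSum-0 z (suc m) = orbitSum-0 (p z) m

    -- Moves along `p` do not change how often the orbit of `z` contains the current dart, and a
    -- crossing changes it by what `onEdge` contributes. The sum telescopes to the two ends of the
    -- trail.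
    crossings-sum : ∀ {x ds y z m} → iter p m z ≡ z → Trail p α x ds y →
                    orbitSum p (crossings ds) z m ≡ count z m x xor count z m y
    crossings-sum {x} {z = z} {m} per stop = trans (orbitSum-0 z m) (sym (Boolₚ.xor-same (count z m x)))
    crossings-sum {x} {m = m} per (fwd t) = trans (crossings-sum {m = m} per t) (cong (_xor _) (count-p {m = m} per x))
    crossings-sum {m = m} per (bwd {x} t) = trans (crossings-sum {m = m} per t) (cong (_xor _) (sym (count-p {m = m} per x)))
    crossings-sum {x} {_ ∷ ds} {y} {z} {m} per (cross t) = begin
        orbitSum p (λ d → onEdge x d xor crossings ds d) z m        ≡⟨ orbitSum-xor p _ _ z m ⟩
        orbitSum p (onEdge x) z m xor orbitSum p (crossings ds) z m ≡⟨ cong₂ _xor_ (count-cross x z m) (crossings-sum {m = m} per t) ⟩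
        (count z m x xor count z m (α x)) xor (count z m (α x) xor count z m y)
                                                                    ≡⟨ Boolₚ.xor-assoc (count z m x) _ _ ⟩
        count z m x xor (count z m (α x) xor (count z m (α x) xor count z m y))
                            ≡⟨ cong (count z m x xor_) (sym (Boolₚ.xor-assoc (count z m (α x)) _ _)) ⟩
        count z m x xor ((count z m (α x) xor count z m (α x)) xor count z m y)
                            ≡⟨ cong (λ b → count z m x xor (b xor count z m y)) (Boolₚ.xor-same (count z m (α x))) ⟩
        count z m x xor count z m y ∎
      where open ≡-Reasoning

  closed-crossings : ∀ {x ds} → Trail p α x ds x → ∀ z m → iter p m z ≡ z → orbitSum p (crossings ds) z m ≡ false
  closed-crossings {x} t z m per = trans (crossings-sum {m = m} per t) (Boolₚ.xor-same (count z m x))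

module Representation {n r : ℕ} (M : Map n r) {A : Set} (act : Fin n → A → A) where
  open Map M using (α)

  run : List (Fin n) → A → A
  run []       a = a
  run (d ∷ ds) a = run ds (act d a)

  run-++ : ∀ xs {ys} a → run (xs ++ ys) a ≡ run ys (run xs a)
  run-++ []       a = refl
  run-++ (x ∷ xs) a = run-++ xs (act x a)

  -- An action of the darts that is trivial on backtracks and face boundaries factors through
  -- homotopy. It is applied to sums in Z/2 and to pairs of a sheet and a sum collected in the
  -- cover.
  contractible-run : (∀ d a → act (α d) (act d a) ≡ a) →
    (∀ d k a → iter (φ M) (suc k) d ≡ d → run (orbitList (φ M) d (suc k)) a ≡ a) →
    ∀ {γ} → Contractible M γ → ∀ a → run γ a ≡ a
  contractible-run back-act face-act c a = EqC.gfold isEquivalence (λ xs → run xs a) step c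
    where
    step : ∀ {xs ys} → HStep M xs ys → run xs a ≡ run ys a
    step (back xs ys d)       = trans (run-++ xs a) (trans (cong (run ys) (sym (back-act d _))) (sym (run-++ xs a)))
    step (face xs ys d k per) = begin
        run (xs ++ ys) a                            ≡⟨ run-++ xs a ⟩
        run ys (run xs a)                           ≡⟨ cong (run ys) (face-act d k _ per) ⟨
        run ys (run (orbitList (φ M) d (suc k)) (run xs a)) ≡⟨ run-++ (orbitList (φ M) d (suc k)) _ ⟨
        run (orbitList (φ M) d (suc k) ++ ys) (run xs a)    ≡⟨ run-++ xs a ⟨
        run (xs ++ orbitList (φ M) d (suc k) ++ ys) a       ∎
      where open ≡-Reasoning

record Cocycle {X : Set} (p α : X → X) (u : X → Bool) : Set where
  field
    sym-α : ∀ d → u (α d) ≡ u d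
    faces : ∀ d k → iter p (suc k) d ≡ d → orbitSum p u d (suc k) ≡ false

cocycle-xor : ∀ {X : Set} {p α : X → X} {u v} → Cocycle p α u → Cocycle p α v → Cocycle p α (λ d → u d xor v d)
cocycle-xor {u = u} {v} cu cv = record
  { sym-α = λ d → cong₂ _xor_ (Cocycle.sym-α cu d) (Cocycle.sym-α cv d)
  ; faces = λ d k per → trans (orbitSum-xor _ u v d (suc k)) (cong₂ _xor_ (Cocycle.faces cu d k per) (Cocycle.faces cv d k per)) }

crossing-cocycle : ∀ {X : Set} (_≟_ : DecidableEquality X) (p α : X → X) (p-inj : Injective _≡_ _≡_ p)
  (α-invol : ∀ x → α (α x) ≡ x) {x ds} → Trail p α x ds x →
  Cocycle p α (Crossing.crossings _≟_ p α p-inj α-invol ds)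
crossing-cocycle _≟_ p α p-inj α-invol {ds = ds} t = record
  { sym-α = Crossing.crossings-α _≟_ p α p-inj α-invol ds
  ; faces = λ d k per → Crossing.closed-crossings _≟_ p α p-inj α-invol t d (suc k) per }

module _ {n r : ℕ} (M : Map n r) {u : Fin n → Bool} (cu : Cocycle (φ M) (Map.α M) u) where
  open Map M using (α)

  cocycle-contractible : ∀ {γ} → Contractible M γ → sumB u γ ≡ false
  cocycle-contractible {γ} c = trans (sym (trans (run-sum γ false) (Boolₚ.xor-identityʳ _)))
      (contractible-run (λ d a → trans (cong (_xor (u d xor a)) (Cocycle.sym-α cu d)) (trans (sym (Boolₚ.xor-assoc (u d) (u d) a)) (cong (_xor a) (Boolₚ.xor-same (u d)))))
         (λ d k a per → trans (run-sum (orbitList (φ M) d (suc k)) a)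
            (cong (_xor a) (trans (orbitSum-list (φ M) u d (suc k)) (Cocycle.faces cu d k per)))) c false)
    where
    open Representation M (λ d b → u d xor b)
    run-sum : ∀ ds b → run ds b ≡ sumB u ds xor b
    run-sum []       b = refl
    run-sum (d ∷ ds) b = trans (run-sum ds _) (trans (xor-swap (sumB u ds) (u d) b) (sym (Boolₚ.xor-assoc (u d) (sumB u ds) b)))

  -- The double cover determined by u: a dart carries the sheet of its tail.
  α̃ φ̃ : Bool × Fin n → Bool × Fin n
  α̃ (s , d) = s xor u d , α d
  φ̃ (s , d) = s xor u d , φ M d

  iter-φ̃ : ∀ k s d → iter φ̃ k (s , d) ≡ (s xor orbitSum (φ M) u d k , iter (φ M) k d)
  iter-φ̃ zero    s d = cong (_, d) (sym (Boolₚ.xor-identityʳ s))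
  iter-φ̃ (suc k) s d = trans (cong φ̃ (iter-φ̃ k s d))
    (cong (_, _) (trans (Boolₚ.xor-assoc s _ _) (cong (s xor_) (sym (orbitSum-last (φ M) u d k)))))

  -- The state consists of the current sheet and the sum of `w` along the lift so far. The lift of γ
  -- stays on sheet `false` since `u` vanishes on γ, and a face lifts to a closed face since `u`
  -- sums to zero around it.
  cover-contractible : ∀ {w} → Cocycle φ̃ α̃ w → ∀ {γ} → All (λ d → u d ≡ false) γ → Contractible M γ →
                       sumB (λ d → w (false , d)) γ ≡ false
  cover-contractible {w} cw {γ} u≡0 c =
      trans (sym (Boolₚ.xor-identityʳ _)) (trans (sym (cong proj₂ (run-lift γ u≡0 false))) (cong proj₂ (contractible-run back-act face-act c (false , false))))
    where
    open Representation M {A = Bool × Bool} (λ d (s , t) → s xor u d , w (s , d) xor t)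
    run-lift : ∀ ds → All (λ d → u d ≡ false) ds → ∀ t → run ds (false , t) ≡ (false , sumB (λ d → w (false , d)) ds xor t)
    run-lift []       []        t = refl
    run-lift (d ∷ ds) (eq ∷ es) t rewrite eq =
      trans (run-lift ds es _) (cong (false ,_) (trans (xor-swap (sumB (λ e → w (false , e)) ds) (w (false , d)) t) (sym (Boolₚ.xor-assoc (w (false , d)) _ t))))
    back-act : ∀ d a → _ ≡ a
    back-act d (s , t) = cong₂ _,_
      (trans (cong ((s xor u d) xor_) (Cocycle.sym-α cu d)) (xor-cancel² s (u d)))
      (trans (cong (_xor (w (s , d) xor t)) (Cocycle.sym-α cw (s , d)))
        (trans (sym (Boolₚ.xor-assoc (w (s , d)) (w (s , d)) t)) (cong (_xor t) (Boolₚ.xor-same (w (s , d))))))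
    run-orbit : ∀ d m s t → run (orbitList (φ M) d m) (s , t) ≡ (s xor orbitSum (φ M) u d m , orbitSum φ̃ w (s , d) m xor t)
    run-orbit d zero    s t = cong (_, t) (sym (Boolₚ.xor-identityʳ s))
    run-orbit d (suc m) s t = trans (run-orbit (φ M d) m _ _) (cong₂ _,_ (Boolₚ.xor-assoc s (u d) _)
       (trans (xor-swap (orbitSum φ̃ w _ m) (w (s , d)) t) (sym (Boolₚ.xor-assoc (w (s , d)) _ t))))
    face-act : ∀ d k a → iter (φ M) (suc k) d ≡ d → run (orbitList (φ M) d (suc k)) a ≡ a
    face-act d k (s , t) per = trans (run-orbit d (suc k) s t) (cong₂ _,_ s≡ (cong (_xor t) (Cocycle.faces cw (s , d) k
        (trans (iter-φ̃ (suc k) s d) (cong₂ _,_ s≡ per)))))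
      where
      s≡ : s xor orbitSum (φ M) u d (suc k) ≡ s
      s≡ = trans (cong (s xor_) (Cocycle.faces cu d k per)) (Boolₚ.xor-identityʳ s)

-- Spanning trees of orbit graphs

⊆-length : ∀ {A : Set} {xs ys : List A} → AllPairs _≢_ xs → (∀ {x} → x ∈ xs → x ∈ ys) → length xs ≤ length ys
⊆-length []          sub = z≤n
⊆-length {xs = x ∷ xs} (x∉ ∷ uniq) sub with ∈ₚ.∈-∃++ (sub (here refl))
... | as , bs , refl = ℕₚ.≤-trans (s≤s (⊆-length uniq sub′))
                         (ℕₚ.≤-reflexive (trans (cong suc (Listₚ.length-++ as)) (trans (sym (ℕₚ.+-suc (length as) (length bs))) (sym (Listₚ.length-++ as)))))
  where
  sub′ : ∀ {y} → y ∈ xs → y ∈ as ++ bs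
  sub′ {y} y∈ with ∈ₚ.∈-++⁻ as (sub (there y∈))
  ... | inj₁ y∈as          = ∈ₚ.∈-++⁺ˡ y∈as
  ... | inj₂ (here refl)   = ⊥-elim (All.lookup x∉ y∈ refl)
  ... | inj₂ (there y∈bs)  = ∈ₚ.∈-++⁺ʳ as y∈bs

unique-length : ∀ {n} {xs : List (Fin n)} → AllPairs _≢_ xs → length xs ≤ n
unique-length {n} uniq = ℕₚ.≤-trans (⊆-length uniq (λ {x} _ → ∈ₚ.∈-allFin x)) (ℕₚ.≤-reflexive (Listₚ.length-tabulate id))

EdgeIn : ∀ {n} → (Fin n → Fin n) → List (Fin n) → Fin n → Set
EdgeIn α ds d = d ∈ ds ⊎ α d ∈ ds

abstract
  _∈?_ : ∀ {n} (d : Fin n) ds → Dec (d ∈ ds)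
  d ∈? ds = Any.any? (d ≟F_) ds

  edgeIn? : ∀ {n} (α : Fin n → Fin n) ds d → Dec (EdgeIn α ds d)
  edgeIn? α ds d = (d ∈? ds) ⊎-dec (α d ∈? ds)

-- Prim's algorithm on the graph whose vertices are the orbits of p and whose
-- edges are the pairs {d , α d}: the tree darts ds each enter a fresh orbit.
module Growth {n : ℕ} (p α : Fin n → Fin n) (p-inj : Injective _≡_ _≡_ p) (α-invol : ∀ d → α (α d) ≡ d) where
  open Perm p p-inj

  Visited : List (Fin n) → Fin n → Set
  Visited vs d = Any (λ v → SameOrbit p v d) vs

  abstract
    visited? : ∀ vs d → Dec (Visited vs d)
    visited? vs d = Any.any? (λ v → v ~? d) vs

  visited-~ : ∀ {vs d e} → SameOrbit p d e → Visited vs d → Visited vs e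
  visited-~ d~e = Any.map (λ v~d → ~trans v~d d~e)

  data Grow (A : Fin n → Set) (x₀ : Fin n) : List (Fin n) → List (Fin n) → Set where
    start : Grow A x₀ (x₀ ∷ []) []
    grow  : ∀ {vs ds d} → Grow A x₀ vs ds → A d → Visited vs d → ¬ Visited vs (α d) → Grow A x₀ (α d ∷ vs) (d ∷ ds)

  Complete : (Fin n → Set) → List (Fin n) → Set
  Complete A vs = ∀ d → A d → Visited vs d → Visited vs (α d)

  module _ {A : Fin n → Set} {x₀ : Fin n} where

    grow-distinct : ∀ {vs ds} → Grow A x₀ vs ds → AllPairs (λ v w → ¬ SameOrbit p v w) vs
    grow-distinct start            = [] ∷ []
    grow-distinct (grow {vs} g _ _ fresh) = All.tabulate (λ w∈ s → fresh (lose w∈ (~sym s))) ∷ grow-distinct g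

    grow-unique : ∀ {vs ds} → Grow A x₀ vs ds → AllPairs _≢_ vs
    grow-unique g = AllPairs.map (λ { ¬s refl → ¬s ~refl }) (grow-distinct g)

    grow-root : ∀ {vs ds} → Grow A x₀ vs ds → Visited vs x₀
    grow-root start          = here ~refl
    grow-root (grow g _ _ _) = there (grow-root g)

    grow-length : ∀ {vs ds} → Grow A x₀ vs ds → length vs ≡ suc (length ds)
    grow-length start          = refl
    grow-length (grow g _ _ _) = cong suc (grow-length g)

    grow-allowed : ∀ {vs ds} → Grow A x₀ vs ds → All A ds
    grow-allowed start          = []
    grow-allowed (grow g a _ _) = a ∷ grow-allowed g

    grow-tails : ∀ {vs ds} → Grow A x₀ vs ds → All (Visited vs) ds
    grow-tails start            = []
    grow-tails (grow g _ vis _) = there vis ∷ All.map there (grow-tails g)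

    grow-heads : ∀ {vs ds} → Grow A x₀ vs ds → All (Visited vs ∘ α) ds
    grow-heads start          = []
    grow-heads (grow g _ _ _) = here ~refl ∷ All.map there (grow-heads g)

    orbit-trail : ∀ {x y} → SameOrbit p x y → Trail p α x [] y
    orbit-trail (k , eq) = go k eq
      where
      go : ∀ k {x y} → iter p k x ≡ y → Trail p α x [] y
      go zero    refl = stop
      go (suc k) eq   = fwd (go k (trans (iter-comm p k) eq))

    grow-trail : ∀ {vs ds d} → Grow A x₀ vs ds → Visited vs d → ∃ λ es → Trail p α x₀ es d × All (_∈ ds) es
    grow-trail start (here s) = [] , orbit-trail s , []
    grow-trail (grow {d = d} g _ vis _) (here s) =
      let (es , t , sub) = grow-trail g vis in
      es ++ d ∷ [] , trail-++ t (cross (orbit-trail s)) , Allₚ.++⁺ (All.map there sub) (here refl ∷ [])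
    grow-trail (grow g _ _ _) (there v) =
      let (es , t , sub) = grow-trail g v in es , t , All.map there sub

    module _ (A? : ∀ d → Dec (A d)) where

      abstract
        grow-complete : ∀ {vs ds} → Grow A x₀ vs ds → ∃₂ λ ws es → Grow A x₀ ws es × Complete A ws ×
                        (∀ {v} → v ∈ vs → v ∈ ws) × (∀ {d} → d ∈ ds → d ∈ es)
        -- Each round adds an entry to a repetition-free list in `Fin n`, so `n` rounds of fuel
        -- suffice.
        grow-complete {vs} g = go n g (ℕₚ.m≤m+n n _)
          where
          go : ∀ fuel {vs ds} → Grow A x₀ vs ds → n ≤ fuel + length vs → ∃₂ λ ws es → Grow A x₀ ws es × Complete A ws ×
               (∀ {v} → v ∈ vs → v ∈ ws) × (∀ {d} → d ∈ ds → d ∈ es)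
          go fuel {vs} g le with Finₚ.any? (λ d → A? d ×-dec (visited? vs d ×-dec ¬? (visited? vs (α d))))
          ... | no none = _ , _ , g , (λ d a vis → case visited? vs (α d) of λ where
                              (yes v) → v
                              (no ¬v) → ⊥-elim (none (d , a , vis , ¬v))) , id , id
          ... | yes (d , a , vis , ¬v) with fuel
          ...   | zero   = ⊥-elim (ℕₚ.<-irrefl refl (ℕₚ.≤-trans (s≤s le) (unique-length (grow-unique (grow g a vis ¬v)))))
          ...   | suc f  = let (ws , es , g′ , c , sub , sub′) = go f (grow g a vis ¬v) (ℕₚ.≤-trans le (ℕₚ.≤-reflexive (sym (ℕₚ.+-suc f _)))) in
                           ws , es , g′ , c , sub ∘ there , sub′ ∘ there

module Basics {n r : ℕ} {M : Map n r} (isMap : IsMap M) where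
  open Map M using (σ; α)
  open IsMap isMap

  α-inj : Injective _≡_ _≡_ α
  α-inj {x} {y} eq = trans (sym (α-invol x)) (trans (cong α eq) (α-invol y))

  φ-inj : Injective _≡_ _≡_ (φ M)
  φ-inj = α-inj ∘ σ-inj

  module Faces = Growth (φ M) α φ-inj α-invol
  module Vertices = Growth σ α σ-inj α-invol

-- Representations in groups

module Words {n r : ℕ} (M : Map n r) (α-invol : ∀ d → Map.α M (Map.α M d) ≡ d) where
  open Map M using (α)

  infix 4 _≈w_
  _≈w_ : List (Fin n) → List (Fin n) → Set
  _≈w_ = EqClosure (HStep M)

  ≈w-refl : ∀ {x} → x ≈w x
  ≈w-refl = EqC.reflexive (HStep M)

  ≈w-trans : ∀ {x y z} → x ≈w y → y ≈w z → x ≈w z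
  ≈w-trans = EqC.transitive (HStep M)

  ≈w-sym : ∀ {x y} → x ≈w y → y ≈w x
  ≈w-sym = EqC.symmetric (HStep M)

  ≈w-step : ∀ {x y} → HStep M x y → x ≈w y
  ≈w-step = EqC.return

  ++-congˡ : ∀ zs {xs ys} → xs ≈w ys → zs ++ xs ≈w zs ++ ys
  ++-congˡ zs = EqC.gmap (zs ++_) step
    where
    step : ∀ {xs ys} → HStep M xs ys → HStep M (zs ++ xs) (zs ++ ys)
    step (back xs ys d) rewrite sym (Listₚ.++-assoc zs xs ys) | sym (Listₚ.++-assoc zs xs (d ∷ α d ∷ ys)) = back (zs ++ xs) ys d
    step (face xs ys d k per) rewrite sym (Listₚ.++-assoc zs xs ys)
                                    | sym (Listₚ.++-assoc zs xs (orbitList (φ M) d (suc k) ++ ys)) = face (zs ++ xs) ys d k per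

  ++-congʳ : ∀ zs {xs ys} → xs ≈w ys → xs ++ zs ≈w ys ++ zs
  ++-congʳ zs = EqC.gmap (_++ zs) step
    where
    step : ∀ {xs ys} → HStep M xs ys → HStep M (xs ++ zs) (ys ++ zs)
    step (back xs ys d) rewrite Listₚ.++-assoc xs ys zs | Listₚ.++-assoc xs (d ∷ α d ∷ ys) zs = back xs (ys ++ zs) d
    step (face xs ys d k per) rewrite Listₚ.++-assoc xs ys zs | Listₚ.++-assoc xs (orbitList (φ M) d (suc k) ++ ys) zs
                                    | Listₚ.++-assoc (orbitList (φ M) d (suc k)) ys zs = face xs (ys ++ zs) d k per

  reversal : List (Fin n) → List (Fin n)
  reversal w = reverse (map α w)

  reversal-∷ : ∀ d w → reversal (d ∷ w) ≡ reversal w ++ [ α d ]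
  reversal-∷ d w = Listₚ.unfold-reverse (α d) (map α w)

  reversal-inverseˡ : ∀ w → reversal w ++ w ≈w []
  reversal-inverseˡ []      = ≈w-refl
  reversal-inverseˡ (d ∷ w) rewrite reversal-∷ d w | Listₚ.++-assoc (reversal w) [ α d ] (d ∷ w) =
    ≈w-trans (≈w-sym (≈w-step (subst (λ e → HStep M (reversal w ++ w) (reversal w ++ α d ∷ e ∷ w)) (α-invol d) (back (reversal w) w (α d)))))
             (reversal-inverseˡ w)

  reversal-inverseʳ : ∀ w → w ++ reversal w ≈w []
  reversal-inverseʳ []      = ≈w-refl
  reversal-inverseʳ (d ∷ w) rewrite reversal-∷ d w | sym (Listₚ.++-assoc w (reversal w) [ α d ]) =
    ≈w-trans (++-congˡ [ d ] (++-congʳ [ α d ] (reversal-inverseʳ w))) (≈w-sym (≈w-step (back [] [] d)))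

  ++-cong : ∀ {x y u v} → x ≈w y → u ≈w v → x ++ u ≈w y ++ v
  ++-cong {y = y} {u} p q = ≈w-trans (++-congʳ u p) (++-congˡ y q)

  reversal-cong : ∀ {x y} → x ≈w y → reversal x ≈w reversal y
  reversal-cong {x} {y} p =
    ≈w-trans (subst (λ z → z ≈w reversal x ++ (x ++ reversal y)) (Listₚ.++-identityʳ _)
                 (++-congˡ (reversal x) (≈w-trans (≈w-sym (reversal-inverseʳ y)) (++-congʳ (reversal y) (≈w-sym p)))))
             (subst (_≈w reversal y) (Listₚ.++-assoc (reversal x) x (reversal y)) (++-congʳ (reversal y) (reversal-inverseˡ x)))

  -- Words need not be walks: this is the group with one generator for each dart, in which
  -- backtracks and face boundaries are trivial. Being the identity in it is `Contractible` by
  -- definition.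
  wordGroup : Group 0ℓ 0ℓ
  wordGroup = record
    { Carrier = List (Fin n) ; _≈_ = _≈w_ ; _∙_ = _++_ ; ε = [] ; _⁻¹ = reversal
    ; isGroup = record
      { isMonoid = record
        { isSemigroup = record
          { isMagma = record { isEquivalence = EqC.isEquivalence (HStep M) ; ∙-cong = ++-cong }
          ; assoc = λ x y z → subst (_≈w (x ++ y ++ z)) (sym (Listₚ.++-assoc x y z)) ≈w-refl }
        ; identity = (λ x → ≈w-refl) , λ x → subst (_≈w x) (sym (Listₚ.++-identityʳ x)) ≈w-refl }
      ; inverse = reversal-inverseˡ , reversal-inverseʳ
      ; ⁻¹-cong = reversal-cong } }

  contractible-rotate : ∀ xs ys → Contractible M (xs ++ ys) → Contractible M (ys ++ xs)
  contractible-rotate xs ys c =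
    ≈w-trans (≈w-sym (≈w-trans (++-congʳ (ys ++ xs) (reversal-inverseˡ xs)) ≈w-refl))
      (subst (_≈w []) (sym (trans (Listₚ.++-assoc (reversal xs) xs (ys ++ xs)) (cong (reversal xs ++_) (sym (Listₚ.++-assoc xs ys xs)))))
        (≈w-trans (++-congˡ (reversal xs) (++-congʳ xs c)) (reversal-inverseˡ xs)))

  contractible-reversal : ∀ {xs} → Contractible M xs → Contractible M (reversal xs)
  contractible-reversal {xs} c = ≈w-trans (subst (λ z → z ≈w reversal xs ++ xs) (Listₚ.++-identityʳ _) (++-congˡ (reversal xs) (≈w-sym c))) (reversal-inverseˡ xs)

  reversal² : ∀ xs → reversal (reversal xs) ≡ xs
  reversal² xs = begin
      reverse (map α (reverse (map α xs)))  ≡⟨ cong reverse (Listₚ.reverse-map α (map α xs)) ⟩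
      reverse (reverse (map α (map α xs)))  ≡⟨ Listₚ.reverse-involutive _ ⟩
      map α (map α xs)                      ≡⟨ Listₚ.map-∘ xs ⟨
      map (α ∘ α) xs                        ≡⟨ Listₚ.map-cong α-invol xs ⟩
      map id xs                             ≡⟨ Listₚ.map-id xs ⟩
      xs                                    ∎
    where open ≡-Reasoning

xorGroup : Group 0ℓ 0ℓ
xorGroup = CommutativeRing.+-group Boolₚ.xor-∧-commutativeRing

module Reps (H : Group 0ℓ 0ℓ) {n r : ℕ} (M : Map n r) (isMap : IsMap M) where
  open Map M using (σ; α)
  open IsMap isMap
  private module G = Group H
  open G using (Carrier; _≈_; _∙_; ε; _⁻¹)
  open GroupProperties H using (⁻¹-anti-homo-∙; ε⁻¹≈ε; inverseˡ-unique; inverseʳ-unique; identityˡ-unique)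
  open import Relation.Binary.Reasoning.Setoid G.setoid

  open Basics isMap

  prod : (Fin n → Carrier) → List (Fin n) → Carrier
  prod ρ = foldr (λ d a → ρ d ∙ a) ε

  prod-ε : ∀ {ρ ds} → All (λ d → ρ d ≈ ε) ds → prod ρ ds ≈ ε
  prod-ε []         = G.refl
  prod-ε (eq ∷ eqs) = G.trans (G.∙-cong eq (prod-ε eqs)) (G.identityˡ ε)

  -- The relations are imposed on darts of `D` only, so that a region can be represented on its own,
  -- with no condition on the rest of the map.
  record Rep (D : Fin n → Set) (ρ : Fin n → Carrier) : Set where
    field
      inv   : ∀ d → D d → ρ d ∙ ρ (α d) ≈ ε
      faces : ∀ d k → D d → iter (φ M) (suc k) d ≡ d → prod ρ (orbitList (φ M) d (suc k)) ≈ ε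

  VertexConst : (Fin n → Carrier) → Set
  VertexConst f = ∀ d → f (σ d) ≈ f d

  const-~ : ∀ {f} → VertexConst f → ∀ {d e} → SameV M d e → f e ≈ f d
  const-~ fc (zero , refl)  = G.refl
  const-~ fc (suc k , refl) = G.trans (fc _) (const-~ fc (k , refl))

  const-φ : ∀ {f} → VertexConst f → ∀ d → f (α d) ≈ f (φ M d)
  const-φ fc d = G.sym (fc (α d))

  -- The gauge transformation by a function `f` on vertices: products along a walk change only by
  -- the values of `f` at its ends, so products around faces are conjugated.
  gauge : (Fin n → Carrier) → (Fin n → Carrier) → Fin n → Carrier
  gauge f ρ d = (f d ∙ ρ d) ∙ f (α d) ⁻¹

  gauge-trivial : ∀ f ρ {d} → gauge f ρ d ≈ ε → f d ∙ ρ d ≈ f (α d)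
  gauge-trivial f ρ {d} eq = G.trans (inverseˡ-unique _ _ eq) (GroupProperties.⁻¹-involutive H (f (α d)))

  trivial-gauge : ∀ f ρ {d} → f d ∙ ρ d ≈ f (α d) → gauge f ρ d ≈ ε
  trivial-gauge f ρ {d} eq = G.trans (G.∙-congʳ eq) (G.inverseʳ _)

  cancel-mid : ∀ a b c d → (a ∙ b ⁻¹) ∙ ((b ∙ c) ∙ d) ≈ (a ∙ c) ∙ d
  cancel-mid a b c d = begin
    (a ∙ b ⁻¹) ∙ ((b ∙ c) ∙ d)   ≈⟨ G.assoc _ _ _ ⟨
    ((a ∙ b ⁻¹) ∙ (b ∙ c)) ∙ d   ≈⟨ G.∙-congʳ (G.assoc _ _ _) ⟩
    (a ∙ (b ⁻¹ ∙ (b ∙ c))) ∙ d   ≈⟨ G.∙-congʳ (G.∙-congˡ (G.assoc _ _ _)) ⟨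
    (a ∙ ((b ⁻¹ ∙ b) ∙ c)) ∙ d   ≈⟨ G.∙-congʳ (G.∙-congˡ (G.∙-congʳ (G.inverseˡ b))) ⟩
    (a ∙ (ε ∙ c)) ∙ d            ≈⟨ G.∙-congʳ (G.∙-congˡ (G.identityˡ c)) ⟩
    (a ∙ c) ∙ d                  ∎

  module _ {f : Fin n → Carrier} (fc : VertexConst f) {ρ : Fin n → Carrier} where

    gauge-prod : ∀ d m → prod (gauge f ρ) (orbitList (φ M) d m) ≈ (f d ∙ prod ρ (orbitList (φ M) d m)) ∙ f (iter (φ M) m d) ⁻¹
    gauge-prod d zero    = G.sym (G.trans (G.∙-congʳ (G.identityʳ _)) (G.inverseʳ _))
    gauge-prod d (suc m) = begin
      ((f d ∙ ρ d) ∙ f (α d) ⁻¹) ∙ prod (gauge f ρ) (orbitList (φ M) (φ M d) m)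
        ≈⟨ G.∙-cong (G.∙-congˡ (G.⁻¹-cong (const-φ fc d))) (gauge-prod (φ M d) m) ⟩
      ((f d ∙ ρ d) ∙ f (φ M d) ⁻¹) ∙ ((f (φ M d) ∙ prod ρ (orbitList (φ M) (φ M d) m)) ∙ f (iter (φ M) m (φ M d)) ⁻¹)
        ≈⟨ cancel-mid _ _ _ _ ⟩
      ((f d ∙ ρ d) ∙ prod ρ (orbitList (φ M) (φ M d) m)) ∙ f (iter (φ M) m (φ M d)) ⁻¹
        ≈⟨ G.∙-cong (G.assoc _ _ _) (G.reflexive (cong (λ e → f e ⁻¹) (iter-comm (φ M) m))) ⟩
      (f d ∙ (ρ d ∙ prod ρ (orbitList (φ M) (φ M d) m))) ∙ f (iter (φ M) (suc m) d) ⁻¹ ∎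

    gauge-rep : ∀ {D} → Rep D ρ → Rep D (gauge f ρ)
    gauge-rep rep = record
      { inv = λ d Dd → begin
          gauge f ρ d ∙ gauge f ρ (α d)                              ≈⟨ cancel-mid _ _ _ _ ⟩
          ((f d ∙ ρ d) ∙ ρ (α d)) ∙ f (α (α d)) ⁻¹                   ≈⟨ G.∙-congʳ (G.assoc _ _ _) ⟩
          (f d ∙ (ρ d ∙ ρ (α d))) ∙ f (α (α d)) ⁻¹                   ≈⟨ G.∙-cong (G.∙-congˡ (Rep.inv rep d Dd)) (G.reflexive (cong (λ e → f e ⁻¹) (α-invol d))) ⟩
          (f d ∙ ε) ∙ f d ⁻¹                                         ≈⟨ G.∙-congʳ (G.identityʳ _) ⟩
          f d ∙ f d ⁻¹                                               ≈⟨ G.inverseʳ _ ⟩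
          ε                                                          ∎
      ; faces = λ d k Dd per → begin
          prod (gauge f ρ) (orbitList (φ M) d (suc k))               ≈⟨ gauge-prod d (suc k) ⟩
          (f d ∙ prod ρ (orbitList (φ M) d (suc k))) ∙ f (iter (φ M) (suc k) d) ⁻¹
             ≈⟨ G.∙-cong (G.∙-congˡ (Rep.faces rep d k Dd per)) (G.reflexive (cong (λ e → f e ⁻¹) per)) ⟩
          (f d ∙ ε) ∙ f d ⁻¹                                         ≈⟨ G.∙-congʳ (G.identityʳ _) ⟩
          f d ∙ f d ⁻¹                                               ≈⟨ G.inverseʳ _ ⟩
          ε                                                          ∎ }

  module _ {D : Fin n → Set} {ρ : Fin n → Carrier} (rep : Rep D ρ) where

    rep-α : ∀ {d} → D d ⊎ D (α d) → ρ d ≈ ε → ρ (α d) ≈ ε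
    rep-α {d} (inj₁ Dd) eq  = G.trans (G.sym (G.identityˡ _)) (G.trans (G.∙-congʳ (G.sym eq)) (Rep.inv rep d Dd))
    rep-α {d} (inj₂ Dαd) eq = G.trans (G.sym (G.identityʳ _)) (G.trans (G.∙-congˡ (G.trans (G.sym eq) (G.reflexive (cong ρ (sym (α-invol d)))))) (Rep.inv rep (α d) Dαd))

    -- The face relation has a single factor that is not known to be trivial, which must then be
    -- trivial too.
    last-in-face : ∀ x → D x → (∀ e → SameOrbit (φ M) x e → e ≢ x → ρ e ≈ ε) → ρ x ≈ ε
    last-in-face x Dx triv with Perm.minPeriod (φ M) φ-inj x
    ... | k , per , below = begin
        ρ x                                         ≈⟨ G.identityʳ _ ⟨
        ρ x ∙ ε                                     ≈⟨ G.∙-congˡ (rest k (φ M x) λ j j<k → (suc j , sym (iter-comm (φ M) j)) , λ eq → below j j<k (trans (sym (iter-comm (φ M) j)) eq)) ⟨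
        ρ x ∙ prod ρ (orbitList (φ M) (φ M x) k)    ≈⟨ Rep.faces rep x k Dx per ⟩
        ε                                           ∎
      where
      rest : ∀ k y → (∀ j → j < k → SameOrbit (φ M) x (iter (φ M) j y) × iter (φ M) j y ≢ x) → prod ρ (orbitList (φ M) y k) ≈ ε
      rest zero    y h = G.refl
      rest (suc k) y h = G.trans (G.∙-cong (triv y (proj₁ (h 0 (s≤s z≤n))) (proj₂ (h 0 (s≤s z≤n))))
          (rest k (φ M y) λ j j<k → subst (λ e → SameOrbit (φ M) x e × e ≢ x) (sym (iter-comm (φ M) j)) (h (suc j) (s≤s j<k)))) (G.identityˡ ε)

    -- Faces are removed in the reverse order of their discovery.
    peel : ∀ {A b vs ds} → Faces.Grow A b vs ds → (∀ d → Faces.Visited vs d → D d) →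
           (∀ d → Faces.Visited vs d → ¬ SameOrbit (φ M) b d → ¬ EdgeIn α ds d → ρ d ≈ ε) →
           ∀ d → EdgeIn α ds d → ρ d ≈ ε
    peel Faces.start inD triv d (inj₁ ())
    peel Faces.start inD triv d (inj₂ ())
    peel {b = b} (Faces.grow {vs} {ds} {d} g a vis fresh) inD triv = result
      where
      open Perm (φ M) φ-inj using (~trans; ~sym)
      outside : ∀ e → SameOrbit (φ M) (α d) e → ¬ Faces.Visited vs e
      outside e s v = fresh (Faces.visited-~ (~sym s) v)
      ραd : ρ (α d) ≈ ε
      ραd = last-in-face (α d) (inD _ (here (Perm.~refl (φ M) φ-inj))) λ e s e≢ → triv e (here s)
        (λ b~e → outside e s (Faces.visited-~ b~e (Faces.grow-root g)))
        λ where
          (inj₁ (here refl))  → outside e s vis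
          (inj₁ (there e∈))   → outside e s (All.lookup (Faces.grow-tails g) e∈)
          (inj₂ (here eq))    → e≢ (trans (sym (α-invol e)) (cong α eq))
          (inj₂ (there αe∈))  → outside e s (subst (Faces.Visited vs) (α-invol e) (All.lookup (Faces.grow-heads g) αe∈))
      ρd : ρ d ≈ ε
      ρd = G.trans (G.reflexive (cong ρ (sym (α-invol d)))) (rep-α (inj₁ (inD _ (here (Perm.~refl (φ M) φ-inj)))) ραd)
      new : ∀ e → e ≡ d ⊎ α e ≡ d → ρ e ≈ ε
      new e (inj₁ refl) = ρd
      new e (inj₂ eq)   = G.trans (G.reflexive (cong ρ (trans (sym (α-invol e)) (cong α eq)))) ραd
      ih : ∀ e → EdgeIn α ds e → ρ e ≈ ε
      ih = peel g (λ e v → inD e (there v)) λ e v b≁e ¬in → case ((e ≟F d) ⊎-dec (α e ≟F d)) of λ where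
        (yes e≡) → new e e≡
        (no e≢)  → triv e (there v) b≁e λ where
          (inj₁ (here eq))   → e≢ (inj₁ eq)
          (inj₁ (there e∈))  → ¬in (inj₁ e∈)
          (inj₂ (here eq))   → e≢ (inj₂ eq)
          (inj₂ (there e∈))  → ¬in (inj₂ e∈)
      result : ∀ e → EdgeIn α (d ∷ ds) e → ρ e ≈ ε
      result e (inj₁ (here eq))  = new e (inj₁ eq)
      result e (inj₂ (here eq))  = new e (inj₂ eq)
      result e (inj₁ (there e∈)) = ih e (inj₁ e∈)
      result e (inj₂ (there e∈)) = ih e (inj₂ e∈)

  module _ (ρ : Fin n → Carrier) where
    open Perm σ σ-inj

    -- A new vertex receives the value forced by the tree dart that enters it. As the vertex is
    -- fresh, no value chosen earlier is affected.
    treePotential : ∀ {A t vs ds} → Vertices.Grow A t vs ds → ∃ λ f → VertexConst f × All (λ d → f d ∙ ρ d ≈ f (α d)) ds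
    treePotential Vertices.start = (λ _ → ε) , (λ _ → G.refl) , []
    treePotential (Vertices.grow {vs} {ds} {d} g a vis fresh) with treePotential g
    ... | f , fc , tel = f′ , fc′ , new ∷ All.zipWith (λ {e} ((tl , hd) , eq) → old tl hd eq) (All.zip (Vertices.grow-tails g , Vertices.grow-heads g) , tel)
      where
      pick : ∀ {y} → Dec (SameOrbit σ (α d) y) → Carrier
      pick {y} (yes _) = f d ∙ ρ d
      pick {y} (no _)  = f y
      f′ : Fin n → Carrier
      f′ y = pick (α d ~? y)
      f′-old : ∀ {y} → Vertices.Visited vs y → f′ y ≈ f y
      f′-old {y} v with α d ~? y
      ... | yes s = ⊥-elim (fresh (Vertices.visited-~ (~sym s) v))
      ... | no _  = G.refl
      f′-new : f′ (α d) ≈ f d ∙ ρ d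
      f′-new with α d ~? α d
      ... | yes _ = G.refl
      ... | no ¬s = ⊥-elim (¬s ~refl)
      fc′ : VertexConst f′
      fc′ y with α d ~? σ y | α d ~? y
      ... | yes _ | yes _ = G.refl
      ... | no _  | no _  = fc y
      ... | yes s | no ¬s = ⊥-elim (¬s (~post s))
      ... | no ¬s | yes s = ⊥-elim (¬s (~trans s ~step))
      new : f′ d ∙ ρ d ≈ f′ (α d)
      new = G.trans (G.∙-congʳ (f′-old vis)) (G.sym f′-new)
      old : ∀ {e} → Vertices.Visited vs e → Vertices.Visited vs (α e) → f e ∙ ρ e ≈ f (α e) → f′ e ∙ ρ e ≈ f′ (α e)
      old tl hd eq = G.trans (G.∙-congʳ (f′-old tl)) (G.trans eq (G.sym (f′-old hd)))

  telescope : ∀ {f ρ} → VertexConst f → ∀ g gs → All (λ d → f d ∙ ρ d ≈ f (α d)) (g ∷ gs) → Walk M (g ∷ gs) →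
              f g ∙ prod ρ (g ∷ gs) ≈ f (α (lastOf g gs))
  telescope fc g [] (eq ∷ []) w = G.trans (G.∙-congˡ (G.identityʳ _)) eq
  telescope {f} {ρ} fc g (h ∷ hs) (eq ∷ eqs) (gh , w) = begin
    f g ∙ (ρ g ∙ prod ρ (h ∷ hs))   ≈⟨ G.assoc _ _ _ ⟨
    (f g ∙ ρ g) ∙ prod ρ (h ∷ hs)   ≈⟨ G.∙-congʳ eq ⟩
    f (α g) ∙ prod ρ (h ∷ hs)       ≈⟨ G.∙-congʳ (const-~ fc gh) ⟨
    f h ∙ prod ρ (h ∷ hs)           ≈⟨ telescope fc h hs eqs w ⟩
    f (α (lastOf h hs))             ∎

  closed-trivial : ∀ {f ρ} → VertexConst f → ∀ g gs → All (λ d → f d ∙ ρ d ≈ f (α d)) (g ∷ gs) → Walk M (g ∷ gs) →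
                   SameV M (α (lastOf g gs)) g → prod ρ (g ∷ gs) ≈ ε
  closed-trivial fc g gs eqs w closed =
    GroupProperties.identityʳ-unique H _ _ (G.trans (telescope fc g gs eqs w) (G.sym (const-~ fc closed)))

-- Cyclic successors, paths and loops

module _ {A : Set} {R : A → A → Set} (R-sym : ∀ {x y} → R x y → R y x) where

  allPairs-↭ : ∀ {xs ys} → xs Perm↭.↭ ys → AllPairs R xs → AllPairs R ys
  allPairs-↭ p = Perm↭ₛ.AllPairs-resp-↭ (setoid A) R-sym ((λ { refl r → r }) , (λ { refl r → r })) (Perm↭.↭⇒↭ₛ p)

  allPairs-lookup : ∀ {xs x y} → AllPairs R xs → x ∈ xs → y ∈ xs → x ≡ y ⊎ R x y
  allPairs-lookup (_ ∷ _)   (here refl) (here refl) = inj₁ refl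
  allPairs-lookup (r ∷ _)   (here refl) (there y∈)  = inj₂ (All.lookup r y∈)
  allPairs-lookup (r ∷ _)   (there x∈)  (here refl) = inj₂ (R-sym (All.lookup r x∈))
  allPairs-lookup (_ ∷ rs)  (there x∈)  (there y∈)  = allPairs-lookup rs x∈ y∈

allPairs-from : ∀ {A : Set} {R : A → A → Set} {xs} → AllPairs _≢_ xs → (∀ {x y} → x ∈ xs → y ∈ xs → x ≢ y → R x y) → AllPairs R xs
allPairs-from []       h = []
allPairs-from (u ∷ us) h = All.tabulate (λ y∈ → h (here refl) (there y∈) (All.lookup u y∈)) ∷ allPairs-from us (λ x∈ y∈ → h (there x∈) (there y∈))

allPairs-++ˡ : ∀ {A : Set} {R : A → A → Set} xs {ys} → AllPairs R (xs ++ ys) → AllPairs R xs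
allPairs-++ˡ []       ps       = []
allPairs-++ˡ (x ∷ xs) (p ∷ ps) = Allₚ.++⁻ˡ xs p ∷ allPairs-++ˡ xs ps

allPairs-++ʳ : ∀ {A : Set} {R : A → A → Set} xs {ys} → AllPairs R (xs ++ ys) → AllPairs R ys
allPairs-++ʳ []       ps       = ps
allPairs-++ʳ (x ∷ xs) (p ∷ ps) = allPairs-++ʳ xs ps

allPairs-++-cross : ∀ {A : Set} {R : A → A → Set} xs {ys x y} → AllPairs R (xs ++ ys) → x ∈ xs → y ∈ ys → R x y
allPairs-++-cross (x ∷ xs) (p ∷ ps) (here refl) y∈ = All.lookup (Allₚ.++⁻ʳ xs p) y∈
allPairs-++-cross (x ∷ xs) (p ∷ ps) (there x∈)  y∈ = allPairs-++-cross xs ps x∈ y∈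

reverse-splits : ∀ {A : Set} as {x y : A} bs → reverse (as ++ x ∷ y ∷ bs) ≡ reverse bs ++ y ∷ x ∷ reverse as
reverse-splits as {x} {y} bs = begin
    reverse (as ++ x ∷ y ∷ bs)                 ≡⟨ Listₚ.reverse-++ as (x ∷ y ∷ bs) ⟩
    reverse (x ∷ y ∷ bs) ++ reverse as         ≡⟨ cong (_++ reverse as) (Listₚ.unfold-reverse x (y ∷ bs)) ⟩
    (reverse (y ∷ bs) ++ [ x ]) ++ reverse as  ≡⟨ Listₚ.++-assoc (reverse (y ∷ bs)) [ x ] _ ⟩
    reverse (y ∷ bs) ++ x ∷ reverse as         ≡⟨ cong (_++ x ∷ reverse as) (Listₚ.unfold-reverse y bs) ⟩
    (reverse bs ++ [ y ]) ++ x ∷ reverse as    ≡⟨ Listₚ.++-assoc (reverse bs) [ y ] _ ⟩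
    reverse bs ++ y ∷ x ∷ reverse as           ∎
  where open ≡-Reasoning

CycNext : ∀ {A : Set} → List A → A → A → Set
CycNext xs x y = (∃₂ λ as bs → xs ≡ as ++ x ∷ y ∷ bs) ⊎ (∃₂ λ as bs → xs ≡ as ++ [ x ] × xs ≡ y ∷ bs)

module _ {A : Set} where

  cycNext-from : ∀ {xs} {x : A} → x ∈ xs → ∃ λ y → CycNext xs x y
  cycNext-from {xs} {x} x∈ with ∈ₚ.∈-∃++ x∈
  ... | as     , y ∷ bs , eq   = y , inj₁ (as , bs , eq)
  ... | []     , []     , refl = x , inj₂ ([] , [] , refl , refl)
  ... | a ∷ as , []     , refl = a , inj₂ (a ∷ as , as ++ [ x ] , refl , refl)

  cycNext-∈ʳ : ∀ {xs} {x y : A} → CycNext xs x y → y ∈ xs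
  cycNext-∈ʳ (inj₁ (as , bs , refl)) = ∈ₚ.∈-++⁺ʳ as (there (here refl))
  cycNext-∈ʳ (inj₂ (_ , _ , _ , refl)) = here refl

  cycNext-∈ˡ : ∀ {xs} {x y : A} → CycNext xs x y → x ∈ xs
  cycNext-∈ˡ (inj₁ (as , bs , refl)) = ∈ₚ.∈-++⁺ʳ as (here refl)
  cycNext-∈ˡ (inj₂ (as , _ , refl , _)) = ∈ₚ.∈-++⁺ʳ as (here refl)

  cycNext-reverse : ∀ {xs} {x y : A} → CycNext xs x y → CycNext (reverse xs) y x
  cycNext-reverse (inj₁ (as , bs , refl)) = inj₁ (reverse bs , reverse as , reverse-splits as bs)
  cycNext-reverse {y = y} (inj₂ (as , bs , eq , eq′)) =
    inj₂ (reverse bs , reverse as , trans (cong reverse eq′) (Listₚ.unfold-reverse y bs) , trans (cong reverse eq) (Listₚ.reverse-++ as _))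

  cycNext-to : ∀ {xs} {y : A} → y ∈ xs → ∃ λ x → CycNext xs x y
  cycNext-to {xs} {y} y∈ with cycNext-from (Anyₚ.reverse⁺ y∈)
  ... | x , nx = x , subst (λ zs → CycNext zs x y) (Listₚ.reverse-involutive xs) (cycNext-reverse nx)

  cycNext-map : ∀ {B : Set} (f : A → B) {xs x y} → CycNext xs x y → CycNext (map f xs) (f x) (f y)
  cycNext-map f (inj₁ (as , bs , refl)) = inj₁ (map f as , map f bs , Listₚ.map-++ f as _)
  cycNext-map f (inj₂ (as , bs , eq , eq′)) = inj₂ (map f as , map f bs , trans (cong (map f) eq) (Listₚ.map-++ f as _) , cong (map f) eq′)

  cyc-induct : ∀ {xs} (P : A → Set) → (∀ {y z} → CycNext xs y z → P y → P z) → ∀ {x y} → x ∈ xs → P x → y ∈ xs → P y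
  cyc-induct {h ∷ t} P step {x} x∈ px y∈ with ∈ₚ.∈-∃++ x∈
  -- The property is pushed from `x` to the last entry, wraps around to the head, and from there
  -- runs through the whole list.
  ... | as , bs , eq = All.lookup (chain [] h t refl (let (cs , l , eq′ , pl) = last-of as x bs eq px in step (inj₂ (cs , t , eq′ , refl)) pl)) y∈
    where
    onward : ∀ as z w zs → h ∷ t ≡ as ++ z ∷ w ∷ zs → P z → P w
    onward as z w zs eq = step (inj₁ (as , zs , eq))
    shift : ∀ as z zs → h ∷ t ≡ as ++ z ∷ zs → h ∷ t ≡ (as ++ [ z ]) ++ zs
    shift as z zs eq = trans eq (sym (Listₚ.++-assoc as [ z ] zs))
    chain : ∀ as z zs → h ∷ t ≡ as ++ z ∷ zs → P z → All P (z ∷ zs)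
    chain as z []        eq pz = pz ∷ []
    chain as z (w ∷ zs)  eq pz = pz ∷ chain (as ++ [ z ]) w zs (shift as z (w ∷ zs) eq) (onward as z w zs eq pz)
    last-of : ∀ as z zs → h ∷ t ≡ as ++ z ∷ zs → P z → ∃₂ λ cs l → h ∷ t ≡ cs ++ [ l ] × P l
    last-of as z []       eq pz = as , z , eq , pz
    last-of as z (w ∷ zs) eq pz = last-of (as ++ [ z ]) w zs (shift as z (w ∷ zs) eq) (onward as z w zs eq pz)

unique-⊎ : ∀ {A : Set} (as : List A) {x bs} → AllPairs _≢_ (as ++ x ∷ bs) → x ∉ as
unique-⊎ (a ∷ as) (u ∷ us) (here refl) = All.lookup u (∈ₚ.∈-++⁺ʳ as (here refl)) refl
unique-⊎ (a ∷ as) (u ∷ us) (there x∈)  = unique-⊎ as us x∈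

module _ {n : ℕ} where

  private
    skip : ∀ {x a u v : Fin n} → x ≢ a → (if does (x ≟F a) then u else v) ≡ v
    skip {x} {a} ne rewrite dec-false (x ≟F a) ne = refl

    cycGo-next : ∀ f as {x y : Fin n} {bs} → x ∉ as → cycGo f (as ++ x ∷ y ∷ bs) x ≡ y
    cycGo-next f []            {x} x∉ rewrite dec-true (x ≟F x) refl = refl
    cycGo-next f (a ∷ [])      {x} {bs = bs} x∉ = trans (skip (x∉ ∘ here)) (cycGo-next f [] {x} {bs = bs} λ ())
    cycGo-next f (a ∷ b ∷ as)  x∉ = trans (skip (x∉ ∘ here)) (cycGo-next f (b ∷ as) (x∉ ∘ there))

    cycGo-last : ∀ f as {x : Fin n} → x ∉ as → cycGo f (as ++ [ x ]) x ≡ f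
    cycGo-last f []            {x} x∉ rewrite dec-true (x ≟F x) refl = refl
    cycGo-last f (a ∷ [])      {x} x∉ = trans (skip (x∉ ∘ here)) (cycGo-last f [] {x} λ ())
    cycGo-last f (a ∷ b ∷ as)  x∉ = trans (skip (x∉ ∘ here)) (cycGo-last f (b ∷ as) (x∉ ∘ there))

    cycGo-fix : ∀ f xs {x : Fin n} → x ∉ xs → cycGo f xs x ≡ x
    cycGo-fix f []           x∉ = refl
    cycGo-fix f (a ∷ [])     x∉ = skip (x∉ ∘ here)
    cycGo-fix f (a ∷ b ∷ xs) x∉ = trans (skip (x∉ ∘ here)) (cycGo-fix f (b ∷ xs) (x∉ ∘ there))

    cycFwd-go : ∀ {h : Fin n} {t xs} → xs ≡ h ∷ t → ∀ d → cycFwd xs d ≡ cycGo h xs d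
    cycFwd-go refl d = refl

  cycFwd-next : ∀ {xs} {x y : Fin n} → AllPairs _≢_ xs → CycNext xs x y → cycFwd xs x ≡ y
  cycFwd-next uniq (inj₁ ([] , bs , refl))     = cycGo-next _ [] {bs = bs} λ ()
  cycFwd-next uniq (inj₁ (a ∷ as , bs , refl)) = cycGo-next a (a ∷ as) (unique-⊎ (a ∷ as) uniq)
  cycFwd-next {x = x} {y} uniq (inj₂ (as , bs , eq , eq′)) =
    trans (cycFwd-go eq′ x) (trans (cong (λ zs → cycGo y zs x) eq) (cycGo-last y as (unique-⊎ as (subst (AllPairs _≢_) eq uniq))))

  cycFwd-fix : ∀ {xs} {x : Fin n} → x ∉ xs → cycFwd xs x ≡ x
  cycFwd-fix {[]}     x∉ = refl
  cycFwd-fix {h ∷ xs} x∉ = cycGo-fix h (h ∷ xs) x∉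

  cycFwd-cycNext : ∀ {xs} {x : Fin n} → AllPairs _≢_ xs → x ∈ xs → CycNext xs x (cycFwd xs x)
  cycFwd-cycNext {xs} {x} uniq x∈ with cycNext-from x∈
  ... | y , nx = subst (CycNext xs x) (sym (cycFwd-next uniq nx)) nx

  unique-reverse : ∀ {xs : List (Fin n)} → AllPairs _≢_ xs → AllPairs _≢_ (reverse xs)
  unique-reverse {xs} = allPairs-↭ (λ ne → ne ∘ sym) (Perm↭.↭-sym (Perm↭ₚ.↭-reverse xs))

  cycBwd-next : ∀ {xs} {x y : Fin n} → AllPairs _≢_ xs → CycNext xs x y → cycBwd xs y ≡ x
  cycBwd-next uniq nx = cycFwd-next (unique-reverse uniq) (cycNext-reverse nx)

  cycBwd-fix : ∀ {xs} {x : Fin n} → x ∉ xs → cycBwd xs x ≡ x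
  cycBwd-fix x∉ = cycFwd-fix (x∉ ∘ Anyₚ.reverse⁻)

  cycBwd-cycFwd : ∀ {xs} → AllPairs _≢_ xs → ∀ (x : Fin n) → cycBwd xs (cycFwd xs x) ≡ x
  cycBwd-cycFwd {xs} uniq x with x ∈? xs
  ... | yes x∈ = cycBwd-next uniq (cycFwd-cycNext uniq x∈)
  ... | no x∉  = trans (cong (cycBwd xs) (cycFwd-fix x∉)) (cycBwd-fix x∉)

  cycFwd-cycBwd : ∀ {xs} → AllPairs _≢_ xs → ∀ (x : Fin n) → cycFwd xs (cycBwd xs x) ≡ x
  cycFwd-cycBwd {xs} uniq x = trans (cong (λ zs → cycFwd zs (cycBwd xs x)) (sym (Listₚ.reverse-involutive xs))) (cycBwd-cycFwd (unique-reverse uniq) x)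

  cycFwd-map : ∀ {xs} {f f⁻ : Fin n → Fin n} → (∀ x → f (f⁻ x) ≡ x) → (∀ x → f⁻ (f x) ≡ x) →
               AllPairs _≢_ xs → ∀ d → cycFwd (map f xs) d ≡ f (cycFwd xs (f⁻ d))
  cycFwd-map {xs} {f} {f⁻} ff⁻ f⁻f uniq d with f⁻ d ∈? xs
  ... | yes x∈ = cycFwd-next (AllPairsₚ.map⁺ (AllPairs.map (λ ne eq → ne (trans (sym (f⁻f _)) (trans (cong f⁻ eq) (f⁻f _)))) uniq))
                   (subst (λ z → CycNext (map f xs) z (f (cycFwd xs (f⁻ d)))) (ff⁻ d) (cycNext-map f (cycFwd-cycNext uniq x∈)))
  ... | no x∉ = trans (cycFwd-fix λ d∈ → let (x , x∈ , eq) = ∈ₚ.∈-map⁻ f d∈ in x∉ (subst (_∈ xs) (sym (trans (cong f⁻ eq) (f⁻f x))) x∈))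
                      (sym (trans (cong f (cycFwd-fix x∉)) (ff⁻ d)))

  cycBwd-map : ∀ {xs} {f f⁻ : Fin n → Fin n} → (∀ x → f (f⁻ x) ≡ x) → (∀ x → f⁻ (f x) ≡ x) →
               AllPairs _≢_ xs → ∀ d → cycBwd (map f xs) d ≡ f (cycBwd xs (f⁻ d))
  cycBwd-map {xs} {f} ff⁻ f⁻f uniq d = trans (cong (λ zs → cycFwd zs d) (sym (Listₚ.reverse-map f xs))) (cycFwd-map ff⁻ f⁻f (unique-reverse uniq) d)

module Paths {n r : ℕ} (M : Map n r) (isMap : IsMap M) where
  open Map M using (σ; α)
  open IsMap isMap
  open Perm σ σ-inj public
  open Basics isMap public

  distinct-sym : ∀ {x y} → DistinctV M x y → DistinctV M y x
  distinct-sym ne s = ne (~sym s)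

  distinct-≡ : ∀ {xs x y} → AllPairs (DistinctV M) xs → x ∈ xs → y ∈ xs → SameV M x y → x ≡ y
  distinct-≡ ps x∈ y∈ s with allPairs-lookup distinct-sym ps x∈ y∈
  ... | inj₁ eq = eq
  ... | inj₂ ne = ⊥-elim (ne s)

  distinct-unique : ∀ {xs} → AllPairs (DistinctV M) xs → AllPairs _≢_ xs
  distinct-unique = AllPairs.map λ { ne refl → ne ~refl }

  Path : Fin n → List (Fin n) → Fin n → Set
  Path d []       e = SameV M d e
  Path d (x ∷ xs) e = SameV M d x × Path (α x) xs e

  path-start : ∀ {d d′} xs {e} → SameV M d′ d → Path d xs e → Path d′ xs e
  path-start []       s p       = ~trans s p
  path-start (x ∷ xs) s (q , p) = ~trans s q , p

  path-end : ∀ {d} xs {e e′} → SameV M e e′ → Path d xs e → Path d xs e′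
  path-end []       s p       = ~trans p s
  path-end (x ∷ xs) s (q , p) = q , path-end xs s p

  path-++ : ∀ {d} xs {e ys f} → Path d xs e → Path e ys f → Path d (xs ++ ys) f
  path-++ []       {ys = ys} p q = path-start ys p q
  path-++ (x ∷ xs) (s , p) q     = s , path-++ xs p q

  path-split : ∀ {d} xs {y ys f} → Path d (xs ++ y ∷ ys) f → Path d xs y × Path y (y ∷ ys) f
  path-split []       (s , p) = s , ~refl , p
  path-split (x ∷ xs) (s , p) = let (q , r) = path-split xs p in (s , q) , r

  path-last : ∀ {d} x xs {e} → Path d (x ∷ xs) e → SameV M (α (lastOf x xs)) e
  path-last x []       (_ , s) = s
  path-last x (y ∷ ys) (_ , p) = path-last y ys p

  path-walk : ∀ {d} xs {e} → Path d xs e → Walk M xs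
  path-walk []           p = tt
  path-walk (x ∷ [])     p = tt
  path-walk (x ∷ y ∷ xs) (_ , s , p) = s , path-walk (y ∷ xs) (~refl , p)

  walk-path : ∀ x xs {e} → Walk M (x ∷ xs) → SameV M (α (lastOf x xs)) e → Path x (x ∷ xs) e
  walk-path x []       w       s = ~refl , s
  walk-path x (y ∷ ys) (q , w) s = ~refl , path-start (y ∷ ys) q (walk-path y ys w s)

  reversal : List (Fin n) → List (Fin n)
  reversal = Words.reversal M α-invol

  path-reversal : ∀ {d} xs {e} → Path d xs e → Path e (reversal xs) d
  path-reversal []       s       = ~sym s
  path-reversal {d} (x ∷ xs) {e} (s , p) rewrite Words.reversal-∷ M α-invol x xs =
    path-++ (reversal xs) (path-reversal xs p) (~refl , subst (λ z → SameV M z d) (sym (α-invol x)) (~sym s))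

  Closed : List (Fin n) → Set
  Closed xs = ∃ λ d → Path d xs d

  closed-rotate : ∀ xs {ys} → Closed (xs ++ ys) → Closed (ys ++ xs)
  closed-rotate xs {[]}     c       = subst Closed (Listₚ.++-identityʳ xs) c
  closed-rotate xs {y ∷ ys} (d , p) = let (q , r) = path-split xs p in y , path-++ (y ∷ ys) r q

  closed-next : ∀ {xs x y} → Closed xs → CycNext xs x y → SameV M (α x) y
  closed-next (d , p) (inj₁ (as , bs , refl)) = proj₁ (proj₂ (proj₂ (path-split as p)))
  closed-next (d , p) (inj₂ (as , bs , eq , eq′)) =
    ~trans (proj₂ (proj₂ (path-split as (subst (λ zs → Path d zs d) eq p)))) (proj₁ (subst (λ zs → Path d zs d) eq′ p))

  closed-map : ∀ {xs} (f : Fin n → Fin n) → (∀ {x y} → CycNext xs x y → SameV M (α (f x)) (f y)) → Closed (map f xs)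
  closed-map {[]}     f joins = Map.root M , ~refl
  closed-map {g ∷ gs} f joins = f g , go [] g gs refl
    where
    go : ∀ as x xs → g ∷ gs ≡ as ++ x ∷ xs → Path (f x) (map f (x ∷ xs)) (f g)
    go as x []       eq = ~refl , joins (inj₂ (as , gs , eq , refl))
    go as x (y ∷ ys) eq = ~refl , path-start (map f (y ∷ ys)) (joins (inj₁ (as , ys , eq)))
                            (go (as ++ [ x ]) y ys (trans eq (sym (Listₚ.++-assoc as [ x ] (y ∷ ys)))))

  record SimpleLoop (xs : List (Fin n)) : Set where
    field
      closed   : Closed xs
      distinct : AllPairs (DistinctV M) xs
    unique : AllPairs _≢_ xs
    unique = distinct-unique distinct
    joined : ∀ {x y} → CycNext xs x y → SameV M (α x) y
    joined = closed-next closed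
    tail-inj : ∀ {x y} → x ∈ xs → y ∈ xs → SameV M x y → x ≡ y
    tail-inj = distinct-≡ distinct
    -- The head of a dart is the tail of its successor, so `tail-inj` applies to the successors.
    head-inj : ∀ {x y} → x ∈ xs → y ∈ xs → SameV M (α x) (α y) → x ≡ y
    head-inj {x} {y} x∈ y∈ s with cycNext-from x∈ | cycNext-from y∈
    ... | x′ , nx | y′ , ny =
      trans (sym (cycBwd-next unique nx))
        (trans (cong (cycBwd xs) (tail-inj (cycNext-∈ʳ nx) (cycNext-∈ʳ ny) (~trans (~sym (joined nx)) (~trans s (joined ny)))))
               (cycBwd-next unique ny))

  open SimpleLoop

  loop-rotate : ∀ xs {ys} → SimpleLoop (xs ++ ys) → SimpleLoop (ys ++ xs)
  loop-rotate xs {ys} l = record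
    { closed = closed-rotate xs (closed l) ; distinct = allPairs-↭ distinct-sym (Perm↭ₚ.++-comm xs ys) (distinct l) }

  loop-reversal : ∀ {xs} → SimpleLoop xs → SimpleLoop (reversal xs)
  loop-reversal {xs} l = record
    { closed = proj₁ (closed l) , path-reversal xs (proj₂ (closed l))
    ; distinct = allPairs-↭ distinct-sym (Perm↭.↭-sym (Perm↭ₚ.↭-reverse (map α xs)))
        (AllPairsₚ.map⁺ (allPairs-from (unique l) λ x∈ y∈ ne s → ne (head-inj l x∈ y∈ s))) }

  reversal-∈ : ∀ {xs d} → d ∈ xs → α d ∈ reversal xs
  reversal-∈ d∈ = Anyₚ.reverse⁺ (∈ₚ.∈-map⁺ α d∈)

  reversal-∈⁻ : ∀ {xs d} → d ∈ reversal xs → α d ∈ xs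
  reversal-∈⁻ {xs} d∈ with ∈ₚ.∈-map⁻ α (Anyₚ.reverse⁻ d∈)
  ... | x , x∈ , refl = subst (_∈ xs) (sym (α-invol x)) x∈

-- The sides of a simple loop

-- Certificate that `D` is not simply connected. The support condition asks for both sides of an
-- edge in `D`: the cocycle then vanishes on the border and beyond it, and the cocycles of the two
-- sides of a loop can be added without interfering.
record Handle {n r : ℕ} (M : Map n r) (D : Fin n → Set) : Set where
  open Map M using (σ; α)
  field
    u       : Fin n → Bool
    cocycle : Cocycle (φ M) α u
    support : ∀ d → u d ≡ true → D d × D (α d)
    base    : Fin n
    base∈D  : D base
    word    : List (Fin n)
    loop    : Trail σ α base word base
    inside  : All (λ d → D d ⊎ D (α d)) word
    odd     : sumB u word ≡ true

-- Simple connectivity of the union of the faces in D, expressed by the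
-- triviality of all its representations.
Disc : ∀ {n r} {M : Map n r} → IsMap M → (Fin n → Set) → Set₁
Disc {n} {M = M} isMap D = ∀ H (ρ : Fin n → Group.Carrier H) → Reps.Rep H M isMap D ρ →
  ∃ λ (f : Fin n → Group.Carrier H) → Reps.VertexConst H M isMap f ×
    (∀ d → D d ⊎ D (Map.α M d) → Group._≈_ H (Group._∙_ H (f d) (ρ d)) (f (Map.α M d)))

-- Tree-cotree decomposition of a union of faces

module TreeCotree {n r : ℕ} {M : Map n r} (isMap : IsMap M) {A : Fin n → Set} {b : Fin n} {fs ks : List (Fin n)}
  (gK : Basics.Faces.Grow isMap A b fs ks) where
  open Map M using (σ; α)
  open IsMap isMap
  open Basics isMap

  D : Fin n → Set
  D = Faces.Visited fs

  Q : Fin n → Set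
  Q d = (D d ⊎ D (α d)) × ¬ EdgeIn α ks d

  Q? : ∀ d → Dec (Q d)
  Q? d = (Faces.visited? fs d ⊎-dec Faces.visited? fs (α d)) ×-dec ¬? (edgeIn? α ks d)

  edge-sym : ∀ {ds d} → EdgeIn α ds d → EdgeIn α ds (α d)
  edge-sym {ds} {d} (inj₁ d∈)  = inj₂ (subst (_∈ ds) (sym (α-invol d)) d∈)
  edge-sym (inj₂ αd∈) = inj₁ αd∈

  edge-sym⁻ : ∀ {ds d} → EdgeIn α ds (α d) → EdgeIn α ds d
  edge-sym⁻ {ds} {d} e = subst (EdgeIn α ds) (α-invol d) (edge-sym e)

  Q-sym : ∀ {d} → Q d → Q (α d)
  Q-sym {d} (inj₁ Dd , ¬k)  = inj₂ (subst D (sym (α-invol d)) Dd) , ¬k ∘ edge-sym⁻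
  Q-sym (inj₂ Dαd , ¬k) = inj₁ Dαd , ¬k ∘ edge-sym⁻

  D-φ : ∀ {d} → D d → D (φ M d)
  D-φ = Faces.visited-~ (Perm.~step (φ M) φ-inj)

  D-φ⁻ : ∀ {d} → D (φ M d) → D d
  D-φ⁻ = Faces.visited-~ (Perm.~sym (φ M) φ-inj (Perm.~step (φ M) φ-inj))

  ks-interior : ∀ {d} → EdgeIn α ks d → D d × D (α d)
  ks-interior (inj₁ d∈)  = All.lookup (Faces.grow-tails gK) d∈ , All.lookup (Faces.grow-heads gK) d∈
  ks-interior {d} (inj₂ αd∈) = subst D (α-invol d) (All.lookup (Faces.grow-heads gK) αd∈) , All.lookup (Faces.grow-tails gK) αd∈

  D-trail : ∀ {d} → D d → ∃ λ es → Trail (φ M) α b es d × All (EdgeIn α ks) es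
  D-trail Dd = let (es , t , sub) = Faces.grow-trail gK Dd in es , t , All.map inj₁ sub

  module _ {t : Fin n} {vs ts : List (Fin n)} (gT : Vertices.Grow Q t vs ts) (cT : Vertices.Complete Q vs)
           (vb : Vertices.Visited vs b) where

    private
      W : Fin n → Set
      W = Vertices.Visited vs

      W-σ : ∀ {d} → W d → W (σ d)
      W-σ = Vertices.visited-~ (Perm.~step σ σ-inj)

      W-σ⁻ : ∀ {d} → W (σ d) → W d
      W-σ⁻ = Vertices.visited-~ (Perm.~sym σ σ-inj (Perm.~step σ σ-inj))

      indicator : Fin n → Bool
      indicator d = does (Vertices.visited? vs d)

      indicator-≡ : ∀ d e → (W d → W e) → (W e → W d) → indicator d ≡ indicator e
      indicator-≡ d e p q with Vertices.visited? vs d | Vertices.visited? vs e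
      ... | yes _ | yes _ = refl
      ... | no _  | no _  = refl
      ... | yes w | no ¬w = ⊥-elim (¬w (p w))
      ... | no ¬w | yes w = ⊥-elim (¬w (q w))

      indicator-W : ∀ d e → indicator d ≡ indicator e → W d → W e
      indicator-W d e eq w with Vertices.visited? vs d | Vertices.visited? vs e
      ... | _     | yes w′ = w′
      ... | no ¬w | no _   = ⊥-elim (¬w w)

    module X = Reps xorGroup M isMap

    -- If the tree did not span, its vertex indicator would be a non-constant
    -- potential that only jumps along cotree edges.
    private
      const-false : X.Rep D (λ _ → false)
      const-false = record { inv = λ _ _ → refl ; faces = λ d k _ _ → X.prod-ε {ρ = λ _ → false} (All.universal (λ _ → refl) (orbitList (φ M) d (suc k))) }

      Wσ : X.VertexConst indicator
      Wσ d = indicator-≡ (σ d) d W-σ⁻ W-σ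

      jump : Fin n → Bool
      jump = X.gauge indicator (λ _ → false)

      jump-Q : ∀ d → Q d → jump d ≡ false
      jump-Q d q = X.trivial-gauge indicator (λ _ → false) {d} (trans (Boolₚ.xor-identityʳ _) (indicator-≡ d (α d) (cT d q)
                      (λ w → subst W (α-invol d) (cT (α d) (Q-sym q) w))))

      jump-D : ∀ d → D d ⊎ D (α d) → jump d ≡ false
      jump-D d Dd with edgeIn? α ks d
      ... | no ¬k = jump-Q d (Dd , ¬k)
      ... | yes k = X.peel (X.gauge-rep Wσ const-false) gK (λ _ v → v) (λ e v _ ¬k → jump-Q e (inj₁ v , ¬k)) d k

      W-α : ∀ d → D d ⊎ D (α d) → W d → W (α d)
      W-α d Dd w = indicator-W d (α d) (trans (sym (Boolₚ.xor-identityʳ _)) (X.gauge-trivial indicator (λ _ → false) {d} (jump-D d Dd))) w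

      along : ∀ {x es y} → Trail (φ M) α x es y → All (EdgeIn α ks) es → D x → W x → W y
      along stop      _        Dx w = w
      along (fwd t)   ks∈      Dx w = along t ks∈ (D-φ Dx) (W-σ (W-α _ (inj₁ Dx) w))
      along (bwd {x} t) ks∈    Dx w = along t ks∈ (D-φ⁻ Dx) (subst W (α-invol x) (W-α (α x) (inj₂ (subst D (sym (α-invol x)) (D-φ⁻ Dx))) (W-σ⁻ w)))
      along (cross {x} t) (k ∷ ks∈) Dx w = along t ks∈ (proj₂ (ks-interior k)) (W-α x (inj₁ Dx) w)

    spans : ∀ {d} → D d → Vertices.Visited vs d
    spans Dd = let (es , t , k) = D-trail Dd in along t k (Faces.grow-root gK) vb

    private
      module CF = Crossing _≟F_ (φ M) α φ-inj α-invol
      module CV = Crossing _≟F_ σ α σ-inj α-invol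

    -- The edge `e` closes a dual cycle in the cotree and a primal cycle in the tree. Tree edges
    -- satisfy `Q`, hence are not in the cotree, so the two cycles meet exactly once, at `e`.
    handle : ∀ e → D e → D (α e) → ¬ EdgeIn α ks e → ¬ EdgeIn α ts e → Handle M D
    handle e De Dαe ¬k ¬t =
      let (es₁ , t₁ , k₁) = D-trail De
          (es₂ , t₂ , k₂) = D-trail Dαe
          (es₃ , t₃ , k₃) = CF.trail-reverse t₂
          rest = es₃ ++ es₁
          rest-k : All (EdgeIn α ks) rest
          rest-k = Allₚ.++⁺ (All.tabulate (λ s∈ → edge-sym⁻ (All.lookup k₂ (k₃ s∈)))) k₁
          (ws₁ , p₁ , v₁) = Vertices.grow-trail gT (spans De)
          (ws₂ , p₂ , v₂) = Vertices.grow-trail gT (spans Dαe)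
          (ws₃ , p₃ , v₃) = CV.trail-reverse p₂
          path = ws₃ ++ ws₁
          path-t : All (EdgeIn α ts) path
          path-t = Allₚ.++⁺ (All.tabulate (λ s∈ → inj₂ (All.lookup v₂ (v₃ s∈)))) (All.map inj₁ v₁)
          ts-Q : ∀ {d} → EdgeIn α ts d → Q d
          ts-Q {d} = λ where
            (inj₁ d∈)  → All.lookup (Vertices.grow-allowed gT) d∈
            (inj₂ αd∈) → subst Q (α-invol d) (Q-sym (All.lookup (Vertices.grow-allowed gT) αd∈))
      in record
      { u = CF.crossings (e ∷ rest)
      ; cocycle = crossing-cocycle _≟F_ (φ M) α φ-inj α-invol (cross (trail-++ t₃ t₁))
      ; support = λ d eq → case CF.crossings-support (e ∷ rest) eq of λ where
          (inj₁ (here refl)) → De , Dαe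
          (inj₁ (there d∈))  → ks-interior (All.lookup rest-k d∈)
          (inj₂ (here eq′))  → subst (λ z → D z × D (α z)) (trans (cong α (sym eq′)) (α-invol d)) (Dαe , subst D (sym (α-invol e)) De)
          (inj₂ (there αd∈)) → ks-interior (edge-sym⁻ (All.lookup rest-k αd∈))
      ; base = e
      ; base∈D = De
      ; word = e ∷ path
      ; loop = cross (trail-++ p₃ p₁)
      ; inside = inj₁ De ∷ All.map (proj₁ ∘ ts-Q) path-t
      ; odd = cong₂ _xor_
          (cong₂ _xor_ (CF.onEdge-self (λ eq → α-free e (sym eq)))
            (CF.crossings-off (All.map (λ { k → (λ { refl → ¬k k }) , (λ { refl → ¬k (edge-sym⁻ k) }) }) rest-k)))
          (sumB-false (All.map (λ {d} t∈ → CF.crossings-off {e ∷ rest} {d}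
             (((λ { refl → ¬t t∈ }) , λ { refl → ¬t (edge-sym t∈) }) ∷
              All.map (λ { k → (λ { refl → proj₂ (ts-Q t∈) k }) , (λ { refl → proj₂ (ts-Q t∈) (edge-sym⁻ k) }) }) rest-k)) path-t)) }

    -- A gauge change makes the tree edges trivial, and peeling off faces then makes the cotree
    -- edges trivial. The face of `b` is left over; its only dart not yet treated is `b`, which its
    -- relation makes trivial.
    disc : (∀ d → D d → EdgeIn α ks d ⊎ EdgeIn α ts d ⊎ d ≡ b) → Disc isMap D
    disc covered H ρ rep = f , fc , λ d Dd → R.gauge-trivial f ρ (trivial d Dd)
      where
      module R = Reps H M isMap
      open Group H using (_≈_; ε)
      potential = R.treePotential ρ gT
      f = proj₁ potential
      fc = proj₁ (proj₂ potential)
      g = R.gauge f ρ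
      rep′ : R.Rep D g
      rep′ = R.gauge-rep fc rep
      on-ts : ∀ d → D d → EdgeIn α ts d → g d ≈ ε
      on-ts d Dd (inj₁ d∈)  = R.trivial-gauge f ρ (All.lookup (proj₂ (proj₂ potential)) d∈)
      on-ts d Dd (inj₂ αd∈) = subst (λ z → g z ≈ ε) (α-invol d)
        (R.rep-α rep′ (inj₂ (subst D (sym (α-invol d)) Dd)) (R.trivial-gauge f ρ (All.lookup (proj₂ (proj₂ potential)) αd∈)))
      on-ks : ∀ d → EdgeIn α ks d → g d ≈ ε
      on-ks = R.peel rep′ gK (λ _ v → v) λ d v b≁d ¬k → case covered d v of λ where
        (inj₁ k)           → ⊥-elim (¬k k)
        (inj₂ (inj₁ t))    → on-ts d v t
        (inj₂ (inj₂ refl)) → ⊥-elim (b≁d (Perm.~refl (φ M) φ-inj))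
      on-D : ∀ d → D d → g d ≈ ε
      on-D d Dd = case covered d Dd of λ where
        (inj₁ k)           → on-ks d k
        (inj₂ (inj₁ t))    → on-ts d Dd t
        (inj₂ (inj₂ refl)) → R.last-in-face rep′ b Dd λ e s e≢b →
          let De = Faces.visited-~ s Dd in case covered e De of λ where
            (inj₁ k)         → on-ks e k
            (inj₂ (inj₁ t))  → on-ts e De t
            (inj₂ (inj₂ eq)) → ⊥-elim (e≢b eq)
      trivial : ∀ d → D d ⊎ D (α d) → g d ≈ ε
      trivial d (inj₁ Dd)  = on-D d Dd
      trivial d (inj₂ Dαd) = subst (λ z → g z ≈ ε) (α-invol d) (R.rep-α rep′ (inj₁ Dαd) (on-D (α d) Dαd))

sumB-single : ∀ {n} {u : Fin n → Bool} {xs x} → AllPairs _≢_ xs → x ∈ xs → u x ≡ true →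
              (∀ {y} → y ∈ xs → y ≢ x → u y ≡ false) → sumB u xs ≡ true
sumB-single {xs = x ∷ xs} (ne ∷ _) (here refl) ux rest =
  cong₂ _xor_ ux (sumB-false (All.tabulate (λ y∈ → rest (there y∈) (λ { refl → All.lookup ne y∈ refl }))))
sumB-single {xs = z ∷ xs} (ne ∷ uniq) (there x∈) ux rest =
  cong₂ _xor_ (rest (here refl) (λ { refl → All.lookup ne x∈ refl })) (sumB-single uniq x∈ ux (rest ∘ there))

-- The faces on the right of a simple loop

record Region {n r : ℕ} {M : Map n r} (isMap : IsMap M) (β : List (Fin n)) : Set₁ where
  open Map M using (σ; α)
  field
    D      : Fin n → Set
    D?     : ∀ d → Dec (D d)
    D-φ    : ∀ {d} → D d → D (φ M d)
    D-φ⁻   : ∀ {d} → D (φ M d) → D d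
    D-α    : ∀ {d} → D d → d ∉ β → D (α d)
    border : ∀ {d} → d ∈ β → D d
    out    : ∀ {d} → d ∈ β → ¬ D (α d)
    origin : Fin n
    origin∈ : origin ∈ β
    reach  : ∀ {d} → D d → ∃ λ es → Trail (φ M) α origin es d × All (λ e → D e × D (α e)) es
    shape  : Handle M D ⊎ Disc isMap D

module LoopRegion {n r : ℕ} {M : Map n r} (isMap : IsMap M) (b : Fin n) (bs : List (Fin n))
  (loop : Paths.SimpleLoop M isMap (b ∷ bs)) (no-return : ∀ {x} → x ∈ b ∷ bs → Map.α M x ∉ b ∷ bs) where
  open Map M using (σ; α)
  open IsMap isMap
  open Paths M isMap
  open SimpleLoop loop
  open Arcs σ σ-inj

  private
    β : List (Fin n)
    β = b ∷ bs

    A : Fin n → Set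
    A d = ¬ EdgeIn α β d

    dual = Faces.grow-complete {A = A} (λ d → ¬? (edgeIn? α β d)) (Faces.start {x₀ = b})
    fs = proj₁ dual
    ks = proj₁ (proj₂ dual)
    gK = proj₁ (proj₂ (proj₂ dual))

    module TC = TreeCotree isMap gK
    open TC using (D; Q; Q?)

    D-α : ∀ {d} → D d → A d → D (α d)
    D-α {d} Dd a = proj₁ (proj₂ (proj₂ (proj₂ dual))) d a Dd

    -- The dart β_{i+1} is reached from β_i by turning around their common vertex on the right of β.
    advance : ∀ {x y} → CycNext β x y → D x → D y
    advance {x} {y} nx Dx = arc-through D (joined nx) (TC.D-φ Dx) λ z az Dz →
        subst D (cong σ (α-invol z)) (TC.D-φ (D-α Dz λ where
          (inj₁ z∈)  → arc≢end az (tail-inj z∈ (cycNext-∈ʳ nx) (~trans (~sym (arc-~ az)) (joined nx)))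
          (inj₂ αz∈) → arc≢start (joined nx) az (trans (sym (α-invol z)) (cong α
             (head-inj αz∈ (cycNext-∈ˡ nx) (subst (λ w → SameV M w (α x)) (sym (α-invol z)) (~sym (arc-~ az))))))))

    border : ∀ {d} → d ∈ β → D d
    border = cyc-induct D advance (here refl) (Faces.grow-root gK)

    ks-off : ∀ {d} → EdgeIn α ks d → ¬ EdgeIn α β d
    ks-off (inj₁ d∈)     = All.lookup (Faces.grow-allowed gK) d∈
    ks-off {d} (inj₂ αd∈) e = All.lookup (Faces.grow-allowed gK) αd∈ (TC.edge-sym e)

    -- A dual path that joins the two sides of `x` without crossing β closes up through `x` to a
    -- dual curve that crosses β exactly once; `no-return` excludes that β runs through the edge of
    -- `x` a second time.
    nonseparating : ∀ {x} → x ∈ β → D (α x) → ¬ Contractible M β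
    nonseparating {x} x∈ Dαx c =
      let (es₁ , t₁ , k₁) = TC.D-trail Dαx
          (es₂ , t₂ , k₂) = TC.D-trail (border x∈)
          (es₃ , t₃ , k₃) = CF.trail-reverse t₁
          off : All A (es₃ ++ es₂)
          off = Allₚ.++⁺ (All.tabulate (λ e∈ → ks-off (TC.edge-sym⁻ (All.lookup k₁ (k₃ e∈))))) (All.map ks-off k₂)
          u = CF.crossings (x ∷ es₃ ++ es₂)
          rest : ∀ {y} → y ∈ β → CF.crossings (es₃ ++ es₂) y ≡ false
          rest y∈ = CF.crossings-off (All.map (λ a → (λ { refl → a (inj₁ y∈) }) , λ { refl → a (inj₂ (subst (_∈ β) (sym (α-invol _)) y∈)) }) off)
          odd : sumB u β ≡ true
          odd = sumB-single unique x∈ (cong₂ _xor_ (CF.onEdge-self (λ eq → α-free x (sym eq))) (rest x∈))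
                  λ y∈ y≢x → cong₂ _xor_ (CF.onEdge-off (y≢x ∘ sym) (λ { refl → no-return y∈ x∈ })) (rest y∈)
      in case trans (sym odd) (cocycle-contractible M (crossing-cocycle _≟F_ (φ M) α φ-inj α-invol (cross (trail-++ t₃ t₂))) c) of λ ()
      where module CF = Crossing _≟F_ (φ M) α φ-inj α-invol

    module _ (out : ∀ {x} → x ∈ β → ¬ D (α x)) where

      Q-β : ∀ {x} → x ∈ β → Q x
      Q-β x∈ = inj₁ (border x∈) , λ k → ks-off k (inj₁ x∈)

      -- Grafts a part of β onto the tree, dart by dart. All vertices visited so far are heads of
      -- other darts of β, and heads on a simple loop are distinct, so each dart enters a fresh
      -- vertex.
      along : ∀ xs {vs ts d e} → Vertices.Grow Q (α b) vs ts → AllPairs _≢_ xs → All (_∈ β) xs → Path d xs e → Vertices.Visited vs d →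
              All (λ v → ∃ λ w → w ∈ β × v ≡ α w × w ∉ xs) vs → ∃₂ λ ws us → Vertices.Grow Q (α b) ws us × All (_∈ us) xs × (∀ {t} → t ∈ ts → t ∈ us)
      along [] g _ _ _ _ _ = _ , _ , g , [] , id
      along (x ∷ xs) {ts = ts} g (ne ∷ uniq) (x∈ ∷ xs∈) (s , p) vis heads =
        let (ws , us , g′ , sub , keep) = along xs (Vertices.grow g (Q-β x∈) (Vertices.visited-~ s vis) fresh) uniq xs∈ p (here ~refl)
                (((x , x∈ , refl , λ x∈xs → All.lookup ne x∈xs refl) ∷ All.map (λ { (w , w∈ , eq , w∉) → w , w∈ , eq , w∉ ∘ there }) heads))
        in ws , us , g′ , keep (here refl) ∷ sub , keep ∘ there
        where
        fresh : ¬ Vertices.Visited _ (α x)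
        fresh v with find v
        ... | y , y∈ , y~ with All.lookup heads y∈
        ... | w , w∈ , refl , w∉ = w∉ (here (head-inj w∈ x∈ y~))

      region : Region isMap β
      -- The tree starts at the head of `b` with all other darts of β, so that `b` is the only
      -- border dart it can miss. This is the exception that `disc` allows.
      region with along bs Vertices.start (AllPairs.tail unique) (All.tabulate there) (proj₂ (proj₂ closed))
                    (here ~refl) ((b , here refl , refl , λ b∈ → All.lookup (AllPairs.head unique) b∈ refl) ∷ [])
      ... | _ , us , g₀ , bs∈us , _ with Vertices.grow-complete Q? g₀
      ... | vs , ts , gT , cT , _ , keep = record
        { D = D ; D? = Faces.visited? fs ; D-φ = TC.D-φ ; D-φ⁻ = TC.D-φ⁻
        ; D-α = λ Dd d∉ → D-α Dd λ where
            (inj₁ d∈)  → d∉ d∈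
            (inj₂ αd∈) → out αd∈ (subst D (sym (α-invol _)) Dd)
        ; border = border ; out = out ; origin = b ; origin∈ = here refl
        ; reach = λ Dd → let (es , t , k) = TC.D-trail Dd in es , t , All.map TC.ks-interior k
        ; shape = shape }
        where
        vb : Vertices.Visited vs b
        vb = subst (Vertices.Visited vs) (α-invol b) (cT (α b) (TC.Q-sym (Q-β (here refl))) (Vertices.grow-root gT))
        Leftover : Fin n → Set
        Leftover e = (D e × D (α e)) × ¬ EdgeIn α ks e × ¬ EdgeIn α ts e
        leftover? : Dec (∃ Leftover)
        leftover? = Finₚ.any? λ e → (Faces.visited? fs e ×-dec Faces.visited? fs (α e)) ×-dec (¬? (edgeIn? α ks e) ×-dec ¬? (edgeIn? α ts e))
        shape : Handle M D ⊎ Disc isMap D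
        shape with leftover?
        ... | yes (e , (De , Dαe) , ¬k , ¬t) = inj₁ (TC.handle gT cT vb e De Dαe ¬k ¬t)
        ... | no none = inj₂ (TC.disc gT cT vb covered)
          where
          covered : ∀ d → D d → EdgeIn α ks d ⊎ EdgeIn α ts d ⊎ d ≡ b
          covered d Dd with edgeIn? α ks d | edgeIn? α ts d
          ... | yes k | _     = inj₁ k
          ... | no _  | yes t = inj₂ (inj₁ t)
          ... | no ¬k | no ¬t with edgeIn? α β d
          ...   | no a = ⊥-elim (none (d , (Dd , D-α Dd a) , ¬k , ¬t))
          ...   | yes (inj₂ αd∈) = ⊥-elim (out αd∈ (subst D (sym (α-invol d)) Dd))
          ...   | yes (inj₁ (here eq)) = inj₂ (inj₂ eq)
          ...   | yes (inj₁ (there d∈)) = ⊥-elim (¬t (inj₁ (keep (All.lookup bs∈us d∈))))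

  side : ¬ Contractible M (b ∷ bs) ⊎ Region isMap (b ∷ bs)
  side with Any.any? (λ x → Faces.visited? fs (α x)) β
  ... | yes any = let (x , x∈ , Dαx) = find any in inj₁ (nonseparating x∈ Dαx)
  ... | no none = inj₂ (region λ x∈ Dαx → none (lose x∈ Dαx))

-- Paths inside a lifted region of the double cover

module CoverLift {n r : ℕ} {M : Map n r} (isMap : IsMap M) {u : Fin n → Bool} (cu : Cocycle (φ M) (Map.α M) u)
  (D : Fin n → Set) (D? : ∀ d → Dec (D d)) (D-φ : ∀ {d} → D d → D (φ M d)) (D-φ⁻ : ∀ {d} → D (φ M d) → D d)
  (border-unique : ∀ {x y} → D x → ¬ D (Map.α M x) → D y → ¬ D (Map.α M y) → SameV M x y → x ≡ y) where
  open Map M using (σ; α)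
  open IsMap isMap
  open Paths M isMap
  open Cocycle cu

  X : Set
  X = Bool × Fin n

  α̃′ φ̃′ : X → X
  α̃′ = α̃ M cu
  φ̃′ = φ̃ M cu

  α̃-invol : ∀ x → α̃′ (α̃′ x) ≡ x
  α̃-invol (s , d) = cong₂ _,_ (trans (cong ((s xor u d) xor_) (sym-α d)) (xor-cancel² s (u d))) (α-invol d)

  φ̃-inj : Injective _≡_ _≡_ φ̃′
  φ̃-inj {s , d} {t , e} eq with φ-inj (cong proj₂ eq)
  ... | refl = cong (_, d) (trans (sym (xor-cancel² s (u d))) (trans (cong (_xor u d) (cong proj₁ eq)) (xor-cancel² t (u d))))

  module C = Crossing (≡-dec Bool._≟_ _≟F_) φ̃′ α̃′ φ̃-inj α̃-invol

  Interior : X → Set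
  Interior (s , d) = D d × D (α d)

  infix 4 _≋_
  _≋_ : X → X → Set
  x ≋ y = ∃ λ es → Trail φ̃′ α̃′ x es y × All Interior es

  ≋-refl : ∀ {x} → x ≋ x
  ≋-refl = [] , stop , []

  ≋-trans : ∀ {x y z} → x ≋ y → y ≋ z → x ≋ z
  ≋-trans (es , t , i) (fs , u , j) = es ++ fs , trail-++ t u , Allₚ.++⁺ i j

  ≋-sym : ∀ {x y} → x ≋ y → y ≋ x
  ≋-sym (es , t , i) = let (fs , u , h) = C.trail-reverse t in
    fs , u , All.tabulate λ {e} e∈ → let (p , q) = All.lookup i (h e∈) in subst D (α-invol (proj₂ e)) q , p

  ≋-φ : ∀ {s d} → (s , d) ≋ φ̃′ (s , d)
  ≋-φ = [] , fwd stop , []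

  ≋-α : ∀ {s d} → D d → D (α d) → (s , d) ≋ α̃′ (s , d)
  ≋-α Dd Dαd = _ ∷ [] , cross stop , (Dd , Dαd) ∷ []

  ≋-≡ : ∀ {x y} → x ≡ y → x ≋ y
  ≋-≡ refl = ≋-refl

  private
    turn : ∀ {s d} → D d → D (α d) → (s , d) ≋ (s , σ d) × D (σ d)
    turn {s} {d} Dd Dαd =
      ≋-trans (≋-α Dd Dαd) (≋-trans ≋-φ (≋-≡ (cong₂ _,_ (trans (cong ((s xor u d) xor_) (sym-α d)) (xor-cancel² s (u d))) (cong σ (α-invol d))))) ,
      subst D (cong σ (α-invol d)) (D-φ Dαd)

    towards : ∀ {s d} m → D d → ((s , d) ≋ (s , iter σ m d) × D (iter σ m d)) ⊎
              (∃ λ y → SameV M d y × D y × ¬ D (α y) × (s , d) ≋ (s , y))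
    towards zero Dd = inj₁ (≋-refl , Dd)
    towards {s} {d} (suc m) Dd with towards {s} m Dd
    ... | inj₂ stuck = inj₂ stuck
    ... | inj₁ (r , Dy) with D? (α (iter σ m d))
    ...   | yes Dαy = let (r′ , D′) = turn Dy Dαy in inj₁ (≋-trans r r′ , D′)
    ...   | no ¬Dαy = inj₂ (_ , (m , refl) , Dy , ¬Dαy , r)

  -- Turn from `d` towards `e`, and from `e` towards `d`. A turn is stopped only by a border dart,
  -- and a vertex carries at most one of these: if both turns are stopped, they end at the same
  -- dart.
  ≋-vertex : ∀ {s d e} → D d → D e → SameV M d e → (s , d) ≋ (s , e)
  ≋-vertex {s} {d} {e} Dd De d~e with d~e | ~sym d~e
  ... | m , refl | k , eq with towards {s} m Dd | towards {s} k De
  ...   | inj₁ (r , _) | _ = r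
  ...   | inj₂ _ | inj₁ (r , _) = ≋-sym (≋-trans r (≋-≡ (cong (s ,_) eq)))
  ...   | inj₂ (y , d~y , Dy , ¬y , r) | inj₂ (z , e~z , Dz , ¬z , r′) with border-unique Dy ¬y Dz ¬z (~trans (~sym d~y) (~trans d~e e~z))
  ...     | refl = ≋-trans r (≋-sym r′)

  -- The primal path is shadowed by a dual one: each edge is followed along a side that belongs to
  -- `D`, where one move of the face permutation changes the sheet by `u`, and vertices are rounded
  -- inside `D`.
  lift-primal : ∀ {x ds y} → Trail σ α x ds y → All (λ d → D d ⊎ D (α d)) ds → ∀ {s x₀ y₀} → D x₀ → SameV M x₀ x → D y₀ → SameV M y₀ y →
                (s , x₀) ≋ (s xor sumB u ds , y₀)
  lift-primal stop _ {s} Dx sx Dy sy = ≋-trans (≋-vertex Dx Dy (~trans sx (~sym sy))) (≋-≡ (cong (_, _) (sym (Boolₚ.xor-identityʳ s))))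
  lift-primal (fwd t) i Dx sx Dy sy = lift-primal t i Dx (~trans sx ~step) Dy sy
  lift-primal (bwd t) i Dx sx Dy sy = lift-primal t i Dx (~post sx) Dy sy
  lift-primal (cross {d} {ds} t) (inj₁ Dd ∷ i) {s} Dx sx Dy sy =
    ≋-trans (≋-vertex Dx Dd sx) (≋-trans ≋-φ (≋-trans (lift-primal t i (D-φ Dd) (~sym ~step) Dy sy)
      (≋-≡ (cong (_, _) (Boolₚ.xor-assoc s (u d) (sumB u ds))))))
  lift-primal (cross {d} {ds} t) (inj₂ Dαd ∷ i) {s} Dx sx Dy sy =
    ≋-trans (≋-vertex Dx (D-φ Dαd) (~trans sx (~trans ~step (~reflexive (cong σ (sym (α-invol d)))))))
      (≋-trans (≋-sym (≋-trans (≋-φ {s xor u d}) (≋-≡ (cong (_, φ M (α d)) (trans (cong ((s xor u d) xor_) (sym-α d)) (xor-cancel² s (u d)))))))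
        (≋-trans (lift-primal t i Dαd ~refl Dy sy) (≋-≡ (cong (_, _) (Boolₚ.xor-assoc s (u d) (sumB u ds))))))

  lift-dual : ∀ {x es y} → Trail (φ M) α x es y → All (λ e → D e × D (α e)) es → ∃ λ δ → ∀ s → (s , x) ≋ (s xor δ , y)
  lift-dual stop i = false , λ s → ≋-≡ (cong (_, _) (sym (Boolₚ.xor-identityʳ s)))
  lift-dual (fwd {x} t) i = let (δ , l) = lift-dual t i in
    u x xor δ , λ s → ≋-trans ≋-φ (≋-trans (l (s xor u x)) (≋-≡ (cong (_, _) (Boolₚ.xor-assoc s (u x) δ))))
  lift-dual (bwd {x} t) i = let (δ , l) = lift-dual t i in
    u x xor δ , λ s → ≋-trans (≋-sym (≋-trans ≋-φ (≋-≡ (cong (_, _) (xor-cancel² s (u x))))))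
                        (≋-trans (l (s xor u x)) (≋-≡ (cong (_, _) (Boolₚ.xor-assoc s (u x) δ))))
  lift-dual (cross {x} t) ((Dx , Dαx) ∷ i) = let (δ , l) = lift-dual t i in
    u x xor δ , λ s → ≋-trans (≋-α Dx Dαx) (≋-trans (l (s xor u x)) (≋-≡ (cong (_, _) (Boolₚ.xor-assoc s (u x) δ))))

  -- The lift of the odd cycle of the handle, conjugated by a path from `d` to its base. That path
  -- shifts both sheets by the same `δ₁ xor δ₂`, which therefore cancels.
  change-sheet : (h : Handle M D) → sumB u (Handle.word h) ≡ true →
                 ∀ {o} → (∀ {d} → D d → ∃ λ es → Trail (φ M) α o es d × All (λ e → D e × D (α e)) es) →
                 ∀ {d} → D d → ∀ s → (s , d) ≋ (s xor true , d)
  change-sheet h flips reach {d} Dd s =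
    let open Handle h
        (_ , t₁ , i₁) = reach Dd
        (_ , t₂ , i₂) = reach base∈D
        (δ₁ , l₁) = lift-dual t₁ i₁
        (δ₂ , l₂) = lift-dual t₂ i₂
        to : ∀ s → (s , d) ≋ (s xor (δ₁ xor δ₂) , base)
        to s = ≋-trans (≋-sym (≋-trans (l₁ (s xor δ₁)) (≋-≡ (cong (_, d) (xor-cancel² s δ₁)))))
                 (≋-trans (l₂ (s xor δ₁)) (≋-≡ (cong (_, base) (Boolₚ.xor-assoc s δ₁ δ₂))))
        around : (s xor (δ₁ xor δ₂) , base) ≋ ((s xor true) xor (δ₁ xor δ₂) , base)
        around = ≋-trans (lift-primal loop inside base∈D ~refl base∈D ~refl)
                   (≋-≡ (cong (_, base) (trans (cong ((s xor (δ₁ xor δ₂)) xor_) flips)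
                      (trans (Boolₚ.xor-assoc s (δ₁ xor δ₂) true) (trans (cong (s xor_) (Boolₚ.xor-comm (δ₁ xor δ₂) true)) (sym (Boolₚ.xor-assoc s true (δ₁ xor δ₂))))))))
    in ≋-trans (to s) (≋-trans around (≋-sym (to (s xor true))))

-- Classification of simple loops

module _ {n r : ℕ} {M : Map n r} (isMap : IsMap M) where
  open Map M using (σ; α)
  open IsMap isMap
  open Paths M isMap
  open SimpleLoop

  region-border-unique : ∀ {β} → SimpleLoop β → (R : Region isMap β) → ∀ {x y} →
    Region.D R x → ¬ Region.D R (α x) → Region.D R y → ¬ Region.D R (α y) → SameV M x y → x ≡ y
  region-border-unique {β} l R {x} {y} Dx ¬Dx Dy ¬Dy s = tail-inj l (onβ Dx ¬Dx) (onβ Dy ¬Dy) s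
    where
    onβ : ∀ {z} → Region.D R z → ¬ Region.D R (α z) → z ∈ β
    onβ {z} Dz ¬Dz = case z ∈? β of λ where
      (yes z∈) → z∈
      (no z∉)  → ⊥-elim (¬Dz (Region.D-α R Dz z∉))

  module _ {β : List (Fin n)} (l : SimpleLoop β) (no-return : ∀ {x} → x ∈ β → α x ∉ β)
           (L : Region isMap β) (R : Region isMap (reversal β)) where
    private
      module L = Region L
      module R = Region R

      rev∈ : ∀ {x} → α x ∈ β → x ∈ reversal β
      rev∈ {x} αx∈ = subst (_∈ reversal β) (α-invol x) (reversal-∈ αx∈)

    -- A dual path in the interior of `R` does not cross β, so it cannot leave `L`. Followed back to
    -- the origin of `R`, it would put a dart of the reversed loop into `L`.
    regions-disjoint : ∀ {d} → L.D d → R.D d → ⊥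
    regions-disjoint Ld Rd with R.reach Rd
    ... | es , t , i = L.out (reversal-∈⁻ R.origin∈) (subst L.D (sym (α-invol R.origin)) (back-along t i Ld))
      where
      back-along : ∀ {x es y} → Trail (φ M) α x es y → All (λ e → R.D e × R.D (α e)) es → L.D y → L.D x
      back-along stop i Ly = Ly
      back-along (fwd t) i Ly = L.D-φ⁻ (back-along t i Ly)
      back-along (bwd t) i Ly = L.D-φ (back-along t i Ly)
      back-along (cross {x} t) ((Rx , Rαx) ∷ i) Ly =
        subst L.D (α-invol x) (L.D-α (back-along t i Ly) λ αx∈ → R.out (rev∈ αx∈) Rαx)

    module _ (hl : Handle M L.D) (hr : Handle M R.D) where
      private
        module HL = Handle hl
        module HR = Handle hr

        u : Fin n → Bool
        u d = HL.u d xor HR.u d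

        cu : Cocycle (φ M) α u
        cu = cocycle-xor HL.cocycle HR.cocycle

        bool-false : ∀ {a} → (a ≡ true → ⊥) → a ≡ false
        bool-false {false} h = refl
        bool-false {true}  h = ⊥-elim (h refl)

        HR≡0 : ∀ {d} → L.D d ⊎ L.D (α d) → HR.u d ≡ false
        HR≡0 {d} (inj₁ Ld)  = bool-false λ eq → regions-disjoint Ld (proj₁ (HR.support d eq))
        HR≡0 {d} (inj₂ Lαd) = bool-false λ eq → regions-disjoint Lαd (proj₂ (HR.support d eq))

        HL≡0 : ∀ {d} → R.D d ⊎ R.D (α d) → HL.u d ≡ false
        HL≡0 {d} (inj₁ Rd)  = bool-false λ eq → regions-disjoint (proj₁ (HL.support d eq)) Rd
        HL≡0 {d} (inj₂ Rαd) = bool-false λ eq → regions-disjoint (proj₂ (HL.support d eq)) Rαd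

        u-β : ∀ {d} → d ∈ β → u d ≡ false
        u-β {d} d∈ = cong₂ _xor_ (bool-false λ eq → L.out d∈ (proj₂ (HL.support d eq))) (HR≡0 (inj₁ (L.border d∈)))

        flips-l : sumB u HL.word ≡ true
        flips-l = trans (sumB-cong {f = u} {HL.u} (All.map (λ {d} Ld → trans (cong (HL.u d xor_) (HR≡0 Ld)) (Boolₚ.xor-identityʳ (HL.u d))) HL.inside)) HL.odd

        flips-r : sumB u HR.word ≡ true
        flips-r = trans (sumB-cong {f = u} {HR.u} (All.map (λ {d} Rd → cong (_xor HR.u d) (HL≡0 Rd)) HR.inside)) HR.odd

        module CL = CoverLift isMap cu L.D L.D? L.D-φ L.D-φ⁻ (region-border-unique l L)
        module CR = CoverLift isMap cu R.D R.D? R.D-φ R.D-φ⁻ (region-border-unique (loop-reversal l) R)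

        b : Fin n
        b = L.origin

        b∈ : b ∈ β
        b∈ = L.origin∈

        left-path : (false , b) CL.≋ (true , b)
        left-path = CL.change-sheet hl flips-l L.reach (L.border b∈) false

        right-path : (true , α b) CR.≋ (false , α b)
        right-path = CR.change-sheet hr flips-r R.reach (R.border (reversal-∈ b∈)) true

        es₁ = proj₁ left-path
        es₂ = proj₁ right-path

        crossed : List CL.X
        crossed = es₁ ++ (true , b) ∷ es₂ ++ (false , α b) ∷ []

        -- The dual curve in the double cover: through the left handle it changes
        -- sheet, crosses one lift of β, returns through the right handle, and
        -- crosses the other lift.
        curve : Trail CL.φ̃′ CL.α̃′ (false , b) crossed (false , b)
        curve = trail-++ (proj₁ (proj₂ left-path))
          (cross (subst (λ x → Trail CL.φ̃′ CL.α̃′ x (es₂ ++ (false , α b) ∷ []) (false , b)) (cong (_, α b) (sym (trans (cong not (u-β b∈)) refl)))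
            (trail-++ (proj₁ (proj₂ right-path))
              (cross (subst (λ x → Trail CL.φ̃′ CL.α̃′ x [] (false , b)) (sym (cong₂ _,_ (trans (Cocycle.sym-α cu b) (u-β b∈)) (α-invol b))) stop)))))

        w : CL.X → Bool
        w = CL.C.crossings crossed

        cw : Cocycle CL.φ̃′ CL.α̃′ w
        cw = crossing-cocycle (≡-dec Bool._≟_ _≟F_) CL.φ̃′ CL.α̃′ CL.φ̃-inj CL.α̃-invol curve

        w-split : ∀ x → w x ≡ CL.C.crossings es₁ x xor (CL.C.onEdge (true , b) x xor (CL.C.crossings es₂ x xor (CL.C.onEdge (false , α b) x xor false)))
        w-split x = trans (sumB-++ (λ s → CL.C.onEdge s x) es₁) (cong (λ z → CL.C.crossings es₁ x xor (CL.C.onEdge (true , b) x xor z)) (sumB-++ (λ s → CL.C.onEdge s x) es₂))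

        -- `es₁` and `es₂` cross only interior edges of the two regions, never a lift of β, and the
        -- crossing at `(true , b)` belongs to the other lift. Only the return crossing remains.
        w-off : ∀ {d} → d ∈ β → w (false , d) ≡ CL.C.onEdge (false , α b) (false , d)
        w-off {d} d∈ = trans (w-split (false , d)) (trans (cong₂ _xor_ off₁ (cong₂ _xor_ off₂ (cong (_xor (CL.C.onEdge (false , α b) (false , d) xor false)) off₃))) (Boolₚ.xor-identityʳ (CL.C.onEdge (false , α b) (false , d))))
          where
          off₁ : CL.C.crossings es₁ (false , d) ≡ false
          off₁ = CL.C.crossings-off (All.map (λ { (Le , Lαe) → (λ { refl → L.out d∈ Lαe }) , λ { refl → L.out d∈ Le } }) (proj₂ (proj₂ left-path)))
          off₂ : CL.C.onEdge (true , b) (false , d) ≡ false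
          off₂ = CL.C.onEdge-off {true , b} {false , d} (λ ()) λ eq → no-return d∈ (subst (_∈ β) (cong proj₂ eq) b∈)
          off₃ : CL.C.crossings es₂ (false , d) ≡ false
          off₃ = CL.C.crossings-off (All.map (λ { (Re , Rαe) → (λ { refl → R.out (reversal-∈ d∈) (subst R.D (sym (α-invol d)) Re) }) , λ { refl → R.out (reversal-∈ d∈) Rαe } }) (proj₂ (proj₂ right-path)))

        w-at-b : w (false , b) ≡ true
        w-at-b = trans (w-off b∈) (cong₂ _xor_ (dec-false (≡-dec Bool._≟_ _≟F_ (false , α b) (false , b)) (λ eq → α-free b (cong proj₂ eq)))
                    (dec-true (≡-dec Bool._≟_ _≟F_ (false , α b) (u b , α b)) (cong (_, α b) (sym (u-β b∈)))))

        w-elsewhere : ∀ {d} → d ∈ β → d ≢ b → w (false , d) ≡ false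
        w-elsewhere {d} d∈ d≢b = trans (w-off d∈) (CL.C.onEdge-off {false , α b} {false , d} (λ eq → no-return b∈ (subst (_∈ β) (sym (cong proj₂ eq)) d∈))
                                (λ eq → d≢b (α-inj (sym (cong proj₂ eq)))))

      handles-noncontractible : ¬ Contractible M β
      handles-noncontractible c = case trans (sym (cover-contractible M cu cw (All.tabulate u-β) c))
          (sumB-single (unique l) b∈ w-at-b w-elsewhere) of λ ()

  reversal-return : ∀ {β} → (∀ {x} → x ∈ β → α x ∉ β) → ∀ {x} → x ∈ reversal β → α x ∉ reversal β
  reversal-return {β} nr x∈ αx∈ = nr (reversal-∈⁻ x∈) (reversal-∈⁻ αx∈)

  disc-trivial : ∀ {D} → Disc isMap D → ∀ H ρ → Reps.Rep H M isMap D ρ → ∀ {xs} → Closed xs → All (λ d → D d ⊎ D (α d)) xs →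
                 Group._≈_ H (Reps.prod H M isMap ρ xs) (Group.ε H)
  disc-trivial dsc H ρ rep {[]} c i = Group.refl H
  disc-trivial dsc H ρ rep {x ∷ xs} (d , p) i =
    let (f , fc , eqs) = dsc H ρ rep in
    Reps.closed-trivial H M isMap fc x xs (All.map (eqs _) i) (path-walk (x ∷ xs) p) (~trans (path-last x xs p) (proj₁ p))

  prod-letters : ∀ xs → Reps.prod (Words.wordGroup M α-invol) M isMap [_] xs ≡ xs
  prod-letters []       = refl
  prod-letters (x ∷ xs) = cong (x ∷_) (prod-letters xs)

  -- Each dart represents itself in the word group of the map, where a trivial product is a
  -- contraction.
  disc-contractible : ∀ {D} → Disc isMap D → ∀ {xs} → Closed xs → All (λ d → D d ⊎ D (α d)) xs → Contractible M xs
  disc-contractible dsc {xs} c i = subst (Contractible M) (prod-letters xs)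
    (disc-trivial dsc (Words.wordGroup M α-invol) [_] (record
      { inv = λ d _ → Words.≈w-sym M α-invol (Words.≈w-step M α-invol (back [] [] d))
      ; faces = λ d k _ per → subst (Contractible M) (sym (prod-letters (orbitList (φ M) d (suc k))))
          (Words.≈w-sym M α-invol (Words.≈w-step M α-invol (subst (HStep M []) (Listₚ.++-identityʳ _) (face [] [] d k per)))) }) c i)

  -- The successor of `x` starts at the head of `x`, as does `α x`, so by simplicity it is `α x`;
  -- likewise `α x` is followed by `x`.
  backtrack : ∀ {β} → SimpleLoop β → ∀ {x} → x ∈ β → α x ∈ β → ∃ λ b → β ≡ b ∷ α b ∷ []
  backtrack {β} l {x} x∈ αx∈ = shape β refl
    where
    Two : Fin n → Set
    Two y = y ≡ x ⊎ y ≡ α x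
    two : ∀ {y} → y ∈ β → Two y
    two = cyc-induct Two (λ where
        nx (inj₁ refl) → inj₂ (sym (tail-inj l αx∈ (cycNext-∈ʳ nx) (joined l nx)))
        nx (inj₂ refl) → inj₁ (sym (tail-inj l x∈ (cycNext-∈ʳ nx) (subst (λ z → SameV M z _) (α-invol x) (joined l nx))))) x∈ (inj₁ refl)
    other : ∀ {y z} → Two y → Two z → y ≢ z → z ≡ α y
    other (inj₁ refl) (inj₁ refl) ne = ⊥-elim (ne refl)
    other (inj₁ refl) (inj₂ refl) ne = refl
    other (inj₂ refl) (inj₁ refl) ne = sym (α-invol x)
    other (inj₂ refl) (inj₂ refl) ne = ⊥-elim (ne refl)
    shape : ∀ zs → β ≡ zs → ∃ λ b → β ≡ b ∷ α b ∷ []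
    shape [] refl = case x∈ of λ ()
    shape (b ∷ []) refl = case x∈ of λ { (here refl) → case αx∈ of λ { (here eq) → ⊥-elim (α-free x eq) } }
    shape (b ∷ c ∷ []) refl with unique l
    ... | (ne ∷ []) ∷ _ = b , cong (λ z → b ∷ z ∷ []) (other (two (here refl)) (two (there (here refl))) ne)
    shape (b ∷ c ∷ d ∷ _) refl with unique l
    ... | (b≢c ∷ b≢d ∷ _) ∷ (c≢d ∷ _) ∷ _ =
      ⊥-elim (c≢d (trans (other (two (here refl)) (two (there (here refl))) b≢c) (sym (other (two (here refl)) (two (there (there (here refl)))) b≢d))))

  record BoundsDisc (β : List (Fin n)) : Set₁ where
    field
      D      : Fin n → Set
      D?     : ∀ d → Dec (D d)
      D-φ    : ∀ {d} → D d → D (φ M d)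
      D-α    : ∀ {d} → D d → d ∉ β → D (α d)
      border : ∀ {d} → d ∈ β → D d
      out    : ∀ {d} → d ∈ β → ¬ D (α d)
      filled : Disc isMap D

  private
    toDisc : ∀ {β} (R : Region isMap β) → Disc isMap (Region.D R) → BoundsDisc β
    toDisc R dsc = record { D = Region.D R ; D? = Region.D? R ; D-φ = Region.D-φ R ; D-α = Region.D-α R ; border = Region.border R ; out = Region.out R ; filled = dsc }

    side : ∀ {β} → SimpleLoop β → β ≢ [] → (∀ {x} → x ∈ β → α x ∉ β) → ¬ Contractible M β ⊎ Region isMap β
    side {[]}     l ne nr = ⊥-elim (ne refl)
    side {b ∷ bs} l ne nr = LoopRegion.side isMap b bs l nr

  reversal-[] : ∀ {β} → β ≢ [] → reversal β ≢ []
  reversal-[] {[]}     ne eq = ne refl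
  reversal-[] {b ∷ bs} ne eq with () ← subst (α b ∈_) eq (reversal-∈ {b ∷ bs} (here refl))

  noncontractible-reversal : ∀ {β} → ¬ Contractible M (reversal β) → ¬ Contractible M β
  noncontractible-reversal ¬c c = ¬c (Words.contractible-reversal M α-invol c)

  abstract
    -- `side` explores the faces on the right of a loop; applied to the reversal it explores the
    -- left. A loop that runs through an edge in both directions is set apart, since its sides are
    -- not defined in this way.
    classify : ∀ {β} → SimpleLoop β → β ≢ [] →
               ¬ Contractible M β ⊎ (∃ λ b → β ≡ b ∷ α b ∷ []) ⊎ BoundsDisc β ⊎ BoundsDisc (reversal β)
    classify {β} l ne = case Any.any? (λ x → α x ∈? β) β of λ where
        (yes any) → let (x , x∈ , αx∈) = find any in inj₂ (inj₁ (backtrack l x∈ αx∈))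
        (no none) → go (λ x∈ αx∈ → none (lose x∈ αx∈))
      where
      go : (∀ {x} → x ∈ β → α x ∉ β) → ¬ Contractible M β ⊎ (∃ λ b → β ≡ b ∷ α b ∷ []) ⊎ BoundsDisc β ⊎ BoundsDisc (reversal β)
      go nr = case side l ne nr of λ where
        (inj₁ ¬c) → inj₁ ¬c
        (inj₂ L)  → case side (loop-reversal l) (reversal-[] ne) (reversal-return nr) of λ where
          (inj₁ ¬c) → inj₁ (noncontractible-reversal ¬c)
          (inj₂ R)  → case (Region.shape L , Region.shape R) of λ where
            (inj₂ dsc , _)         → inj₂ (inj₂ (inj₁ (toDisc L dsc)))
            (inj₁ _ , inj₂ dsc)    → inj₂ (inj₂ (inj₂ (toDisc R dsc)))
            (inj₁ hl , inj₁ hr)    → inj₁ (handles-noncontractible l nr L R hl hr)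

    contractible? : ∀ {β} → SimpleLoop β → β ≢ [] → Dec (Contractible M β)
    contractible? {β} l ne = case classify l ne of λ where
      (inj₁ ¬c) → no ¬c
      (inj₂ (inj₁ (b , refl))) → yes (Words.≈w-sym M α-invol (Words.≈w-step M α-invol (back [] [] b)))
      (inj₂ (inj₂ (inj₁ bd))) → yes (disc-contractible (BoundsDisc.filled bd) (closed l) (All.tabulate (inj₁ ∘ BoundsDisc.border bd)))
      (inj₂ (inj₂ (inj₂ bd))) → yes (disc-contractible (BoundsDisc.filled bd) (closed l) (All.tabulate (λ d∈ → inj₂ (BoundsDisc.border bd (reversal-∈ d∈)))))

-- Counting orbits, and positive genus

filterᵇ-∈⁺ : ∀ {A : Set} (P : A → Bool) {x xs} → x ∈ xs → P x ≡ true → x ∈ filterᵇ P xs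
filterᵇ-∈⁺ P {x} (here refl) px rewrite px = here refl
filterᵇ-∈⁺ P {x} {y ∷ ys} (there x∈) px with P y
... | true  = there (filterᵇ-∈⁺ P x∈ px)
... | false = filterᵇ-∈⁺ P x∈ px

filterᵇ-∈⁻ : ∀ {A : Set} (P : A → Bool) {x} xs → x ∈ filterᵇ P xs → x ∈ xs × P x ≡ true
filterᵇ-∈⁻ P (y ∷ ys) x∈ with P y in eq
filterᵇ-∈⁻ P (y ∷ ys) (here refl) | true  = here refl , eq
filterᵇ-∈⁻ P (y ∷ ys) (there x∈)  | true  = let (a , b) = filterᵇ-∈⁻ P ys x∈ in there a , b
filterᵇ-∈⁻ P (y ∷ ys) x∈          | false = let (a , b) = filterᵇ-∈⁻ P ys x∈ in there a , b

filterᵇ-unique : ∀ {A : Set} (P : A → Bool) {xs} → AllPairs _≢_ xs → AllPairs _≢_ (filterᵇ P xs)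
filterᵇ-unique P [] = []
filterᵇ-unique P {x ∷ xs} (ne ∷ uniq) with P x
... | true  = All.tabulate (λ y∈ → All.lookup ne (proj₁ (filterᵇ-∈⁻ P xs y∈))) ∷ filterᵇ-unique P uniq
... | false = filterᵇ-unique P uniq

allB-true : ∀ {A : Set} {P : A → Bool} xs → allB xs P ≡ true → ∀ {x} → x ∈ xs → P x ≡ true
allB-true {P = P} (y ∷ ys) eq x∈ with P y in py
allB-true (y ∷ ys) eq (here refl) | true = py
allB-true (y ∷ ys) eq (there x∈)  | true = allB-true ys eq x∈

allB-false : ∀ {A : Set} {P : A → Bool} xs → allB xs P ≡ false → ∃ λ x → P x ≡ false
allB-false {P = P} (y ∷ ys) eq with P y in py
... | true  = allB-false ys eq
... | false = y , py

allFin-unique : ∀ n → AllPairs _≢_ (allFin n)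
allFin-unique n = AllPairsₚ.tabulate⁺ (λ ne → ne)

countB-∘ : ∀ {n} (P : Fin n → Bool) (f f⁻ : Fin n → Fin n) → (∀ d → f (f⁻ d) ≡ d) → (∀ d → f⁻ (f d) ≡ d) → countB (P ∘ f) ≤ countB P
countB-∘ {n} P f f⁻ ff⁻ f⁻f = ℕₚ.≤-trans (ℕₚ.≤-reflexive (sym (Listₚ.length-map f (filterᵇ (P ∘ f) (allFin n)))))
  (⊆-length (AllPairsₚ.map⁺ (AllPairs.map (λ ne eq → ne (trans (sym (f⁻f _)) (trans (cong f⁻ eq) (f⁻f _)))) (filterᵇ-unique (P ∘ f) (allFin-unique n))))
    λ y∈ → let (x , x∈ , eq) = ∈ₚ.∈-map⁻ f y∈ in
      filterᵇ-∈⁺ P (∈ₚ.∈-allFin _) (trans (cong P eq) (proj₂ (filterᵇ-∈⁻ (P ∘ f) (allFin n) x∈))))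

module Orbits {n : ℕ} (p : Fin n → Fin n) (inj : Injective _≡_ _≡_ p) where
  open Perm p inj

  rep-least : ∀ {d e} → isRep p d ≡ true → SameOrbit p d e → toℕ d ≤ toℕ e
  rep-least {d} r s with orbit-< s
  ... | k , k<n , refl = ℕₚ.≤ᵇ⇒≤ _ _ (subst T (sym (allB-true (upTo n) r (∈ₚ.∈-upTo⁺ k<n))) tt)

  rep-unique : ∀ {d e} → isRep p d ≡ true → isRep p e ≡ true → SameOrbit p d e → d ≡ e
  rep-unique rd re s = Finₚ.toℕ-injective (ℕₚ.≤-antisym (rep-least rd s) (rep-least re (~sym s)))

  representative : ∀ d → ∃ λ e → isRep p e ≡ true × SameOrbit p d e
  representative d = go (toℕ d) d ℕₚ.≤-refl
    where
    go : ∀ m d → toℕ d ≤ m → ∃ λ e → isRep p e ≡ true × SameOrbit p d e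
    go m d d≤m with isRep p d in eq
    ... | true  = d , eq , ~refl
    ... | false with allB-false (upTo n) eq
    ...   | k , gt with ℕₚ.≰⇒> {toℕ d} {toℕ (iter p k d)} (λ le → subst T gt (ℕₚ.≤⇒≤ᵇ le))
    ...     | lt with m
    ...       | zero  = case ℕₚ.≤-trans lt d≤m of λ ()
    ...       | suc m′ = let (e , r , s) = go m′ (iter p k d) (ℕₚ.≤-pred (ℕₚ.≤-trans lt d≤m)) in e , r , ~trans (k , refl) s

  private
    injective-length : ∀ {X Y : Set} {xs : List X} {ys : List Y} (R : X → Y → Set) → AllPairs _≢_ xs →
      (∀ {x} → x ∈ xs → ∃ λ y → y ∈ ys × R x y) → (∀ {x x′ y} → x ∈ xs → x′ ∈ xs → R x y → R x′ y → x ≡ x′) → length xs ≤ length ys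
    injective-length {X} {Y} {xs} {ys} R uniq to inj = ℕₚ.≤-trans (ℕₚ.≤-reflexive (sym (proj₁ (proj₂ images))))
        (⊆-length (proj₁ (proj₂ (proj₂ images))) λ y∈ → proj₁ (proj₂ (proj₂ (proj₂ images)) y∈))
      where
      collect : ∀ {zs} → AllPairs _≢_ zs → (∀ {z} → z ∈ zs → z ∈ xs) → ∃ λ ws → length ws ≡ length zs × AllPairs _≢_ ws ×
                (∀ {w} → w ∈ ws → w ∈ ys × ∃ λ z → z ∈ zs × R z w)
      collect [] sub = [] , refl , [] , λ ()
      collect {z ∷ zs} (ne ∷ uniq) sub =
        let (ws , len , uws , h) = collect uniq (sub ∘ there)
            (y , y∈ , r) = to (sub (here refl))
        in y ∷ ws , cong suc len
         , All.tabulate (λ { w∈ refl → let (_ , z′ , z′∈ , r′) = h w∈ in All.lookup ne z′∈ (inj (sub (here refl)) (sub (there z′∈)) r r′) }) ∷ uws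
         , λ { (here refl) → y∈ , z , here refl , r ; (there w∈) → let (a , z′ , z′∈ , r′) = h w∈ in a , z′ , there z′∈ , r′ }
      images = collect uniq id

  numOrbits-≤ : ∀ {Y : Set} {ys : List Y} (R : Fin n → Y → Set) → (∀ d → ∃ λ y → y ∈ ys × R d y) →
                (∀ {d e y} → R d y → R e y → SameOrbit p d e) → numOrbits p ≤ length ys
  numOrbits-≤ R to inj = injective-length R (filterᵇ-unique (isRep p) (allFin-unique n)) (λ {x} _ → to x)
    λ x∈ y∈ r r′ → rep-unique (proj₂ (filterᵇ-∈⁻ (isRep p) (allFin n) x∈)) (proj₂ (filterᵇ-∈⁻ (isRep p) (allFin n) y∈)) (inj r r′)

  distinct-≤ : ∀ {xs} → AllPairs (λ d e → ¬ SameOrbit p d e) xs → length xs ≤ numOrbits p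
  distinct-≤ {xs} dis = injective-length (SameOrbit p) (AllPairs.map (λ { ne refl → ne ~refl }) dis)
    (λ {x} _ → let (e , r , s) = representative x in e , filterᵇ-∈⁺ (isRep p) (∈ₚ.∈-allFin e) r , s)
    λ x∈ y∈ s t → case allPairs-lookup (λ ne s → ne (~sym s)) dis x∈ y∈ of λ where
      (inj₁ eq) → eq
      (inj₂ ne) → ⊥-elim (ne (~trans s (~sym t)))

numOrbits-map : ∀ {n} {p q : Fin n → Fin n} → Injective _≡_ _≡_ p → Injective _≡_ _≡_ q → (f : Fin n → Fin n) →
                (∀ {d e} → SameOrbit q (f d) (f e) → SameOrbit p d e) → numOrbits p ≤ numOrbits q
numOrbits-map {n} {p} {q} p-inj q-inj f h = Orbits.numOrbits-≤ p p-inj (λ d y → SameOrbit q (f d) y)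
  (λ d → let (e , r , s) = Orbits.representative q q-inj (f d) in e , filterᵇ-∈⁺ (isRep q) (∈ₚ.∈-allFin e) r , s)
  (λ s t → h (Perm.~trans q q-inj s (Perm.~sym q q-inj t)))

module _ {n r : ℕ} {M : Map n r} (isMap : IsMap M) where
  open Map M using (σ; α; root)
  open IsMap isMap
  open Paths M isMap
  open SimpleLoop

  abstract
    -- If the tree and the cotree covered all edges, then E would be at most (V - 1) + (F - 1),
    -- against Euler's formula with g at least 1. Hence some edge is left over, and it closes a
    -- handle.
    genus-handle : ∀ {g} → 1 ≤ g → HasGenus M g → ∃ λ D → Handle M D
    genus-handle {g} 1≤g hg with Faces.grow-complete {A = λ _ → ⊤} {x₀ = root} (λ _ → yes tt) Faces.start
    ... | fs , ks , gK , cK , _ , _ with Vertices.grow-complete (TreeCotree.Q? isMap gK) (Vertices.start {x₀ = root})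
    ... | vs , ts , gT , cT , _ , _ with Finₚ.any? (λ e → ¬? (edgeIn? α ks e) ×-dec ¬? (edgeIn? α ts e))
    ... | yes (e , ¬k , ¬t) = _ , TreeCotree.handle isMap gK gT cT (Vertices.grow-root gT) e (all-D (connected root e)) (all-D (connected root (α e))) ¬k ¬t
      where
      all-D : ∀ {d} → Conn M root d → Faces.Visited fs d
      all-D here = Faces.grow-root gK
      all-D (viaσ {d} c) = subst (Faces.Visited fs) (cong σ (α-invol d)) (TreeCotree.D-φ isMap gK (cK d tt (all-D c)))
      all-D (viaα {d} c) = cK d tt (all-D c)
    ... | no none = ⊥-elim (ℕₚ.<-irrefl refl (ℕₚ.≤-trans too-many (ℕₚ.≤-trans (ℕₚ.+-monoʳ-≤ (numEdges M) 1≤2g) (ℕₚ.≤-reflexive refl))))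
      where
      1≤2g : 1 ≤ 2 * g
      1≤2g = ℕₚ.≤-trans 1≤g (ℕₚ.m≤m+n g (g + 0))
      edges : numEdges M ≤ length (ks ++ ts)
      edges = Orbits.numOrbits-≤ α α-inj (λ d y → d ≡ y ⊎ α d ≡ y) cover λ where
          (inj₁ refl) (inj₁ refl) → 0 , refl
          (inj₁ refl) (inj₂ refl) → 1 , α-invol _
          (inj₂ refl) (inj₁ refl) → 1 , refl
          (inj₂ refl) (inj₂ eq)   → 0 , α-inj (sym eq)
        where
        cover : ∀ d → ∃ λ y → y ∈ ks ++ ts × (d ≡ y ⊎ α d ≡ y)
        cover d with edgeIn? α ks d | edgeIn? α ts d
        ... | yes (inj₁ d∈) | _ = d , ∈ₚ.∈-++⁺ˡ d∈ , inj₁ refl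
        ... | yes (inj₂ d∈) | _ = α d , ∈ₚ.∈-++⁺ˡ d∈ , inj₂ refl
        ... | no _ | yes (inj₁ d∈) = d , ∈ₚ.∈-++⁺ʳ ks d∈ , inj₁ refl
        ... | no _ | yes (inj₂ d∈) = α d , ∈ₚ.∈-++⁺ʳ ks d∈ , inj₂ refl
        ... | no ¬k | no ¬t = ⊥-elim (none (d , ¬k , ¬t))
      too-many : suc (numEdges M + 2 * g) ≤ numEdges M + 1
      too-many = ℕₚ.+-cancelʳ-≤ 1 _ _ (begin
          suc (numEdges M + 2 * g) + 1            ≡⟨ ℕₚ.+-comm _ 1 ⟩
          2 + (numEdges M + 2 * g)                ≡⟨ ℕₚ.+-assoc 2 (numEdges M) (2 * g) ⟨
          (2 + numEdges M) + 2 * g                ≤⟨ ℕₚ.+-monoˡ-≤ (2 * g) bound ⟩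
          (numVertices M + numFaces M) + 2 * g    ≡⟨ hg ⟩
          numEdges M + 2                          ≡⟨ ℕₚ.+-assoc (numEdges M) 1 1 ⟨
          (numEdges M + 1) + 1                    ∎)
        where
        open ℕₚ.≤-Reasoning
        bound : 2 + numEdges M ≤ numVertices M + numFaces M
        bound = begin
          2 + numEdges M                      ≤⟨ ℕₚ.+-monoʳ-≤ 2 edges ⟩
          2 + length (ks ++ ts)               ≡⟨ cong (2 +_) (Listₚ.length-++ ks) ⟩
          2 + (length ks + length ts)         ≡⟨ cong suc (ℕₚ.+-suc (length ks) (length ts)) ⟨
          suc (length ks) + suc (length ts)   ≡⟨ cong₂ _+_ (Faces.grow-length gK) (Vertices.grow-length gT) ⟨
          length fs + length vs               ≤⟨ ℕₚ.+-mono-≤ (Orbits.distinct-≤ (φ M) φ-inj (Faces.grow-distinct gK)) (Orbits.distinct-≤ σ σ-inj (Vertices.grow-distinct gT)) ⟩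
          numFaces M + numVertices M          ≡⟨ ℕₚ.+-comm (numFaces M) _ ⟩
          numVertices M + numFaces M          ∎

  trail-path : ∀ {x ds y} → Trail σ α x ds y → Path x ds y
  trail-path stop = ~refl
  trail-path (fwd {ds = ds} t) = path-start ds ~step (trail-path t)
  trail-path (bwd {ds = ds} t) = path-start ds (~sym ~step) (trail-path t)
  trail-path (cross t) = ~refl , trail-path t

  onVertexOf? : ∀ xs d → Dec (∃ λ y → y ∈ xs × SameV M d y)
  onVertexOf? xs d = map′ find (λ (y , y∈ , s) → lose y∈ s) (Any.any? (d ~?_) xs)

  repetition : ∀ xs → AllPairs (DistinctV M) xs ⊎ (∃₂ λ as x → ∃₂ λ bs y → ∃ λ cs → xs ≡ as ++ (x ∷ bs) ++ y ∷ cs × SameV M x y)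
  repetition [] = inj₁ []
  repetition (x ∷ xs) with onVertexOf? xs x | repetition xs
  ... | yes (y , y∈ , s) | _ with ∈ₚ.∈-∃++ y∈
  ...   | bs , cs , refl = inj₂ ([] , x , bs , y , cs , refl , s)
  repetition (x ∷ xs) | no _ | inj₂ (as , z , bs , y , cs , eq , s) = inj₂ (x ∷ as , z , bs , y , cs , cong (x ∷_) eq , s)
  repetition (x ∷ xs) | no none | inj₁ dis = inj₁ (All.tabulate (λ y∈ s → none (_ , y∈ , s)) ∷ dis)

  -- A repeated vertex cuts the closed path into two shorter closed paths, and one of them is odd
  -- again.
  odd-loop : ∀ u fuel ds → length ds ≤ fuel → Closed ds → sumB u ds ≡ true → ∃ λ β → SimpleLoop β × sumB u β ≡ true
  odd-loop u fuel ds le c odd with repetition ds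
  ... | inj₁ dis = ds , record { closed = c ; distinct = dis } , odd
  odd-loop u zero ds le c odd | inj₂ (as , x , bs , y , cs , refl , s) with as | le
  ... | []    | ()
  ... | _ ∷ _ | ()
  odd-loop u (suc fuel) _ le (d , p) odd | inj₂ (as , x , bs , y , cs , refl , s) =
      case xor-true (sumB u (x ∷ bs)) (sumB u (as ++ y ∷ cs)) (trans (sym sums) odd) of λ where
        (inj₁ o) → odd-loop u fuel (x ∷ bs) (ℕₚ.≤-pred (ℕₚ.≤-trans shorter₁ le)) (x , path-end (x ∷ bs) (~sym s) (proj₁ mid)) o
        (inj₂ o) → odd-loop u fuel (as ++ y ∷ cs) (ℕₚ.≤-pred (ℕₚ.≤-trans shorter₂ le)) (d , path-++ as (path-end as s (proj₁ outer)) (proj₂ mid)) o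
    where
    outer = path-split as p
    mid = path-split (x ∷ bs) (proj₂ outer)
    sums : sumB u (as ++ (x ∷ bs) ++ y ∷ cs) ≡ sumB u (x ∷ bs) xor sumB u (as ++ y ∷ cs)
    sums = trans (sumB-++ u as) (trans (cong (sumB u as xor_) (sumB-++ u (x ∷ bs)))
             (trans (xor-swap (sumB u as) (sumB u (x ∷ bs)) _) (cong (sumB u (x ∷ bs) xor_) (sym (sumB-++ u as)))))
    total : length (as ++ (x ∷ bs) ++ y ∷ cs) ≡ length (x ∷ bs) + length (as ++ y ∷ cs)
    total = trans (Listₚ.length-++ as) (trans (cong (length as +_) (Listₚ.length-++ (x ∷ bs)))
              (trans (sym (ℕₚ.+-assoc (length as) (length (x ∷ bs)) _)) (trans (cong (_+ length (y ∷ cs)) (ℕₚ.+-comm (length as) (length (x ∷ bs))))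
                (trans (ℕₚ.+-assoc (length (x ∷ bs)) (length as) _) (cong (length (x ∷ bs) +_) (sym (Listₚ.length-++ as)))))))
    shorter₁ : suc (length (x ∷ bs)) ≤ length (as ++ (x ∷ bs) ++ y ∷ cs)
    shorter₁ = ℕₚ.≤-trans (ℕₚ.≤-trans (ℕₚ.≤-reflexive (ℕₚ.+-comm 1 _)) (ℕₚ.+-monoʳ-≤ (length (x ∷ bs))
                 (subst (1 ≤_) (sym (trans (Listₚ.length-++ as) (ℕₚ.+-suc (length as) (length cs)))) (s≤s z≤n)))) (ℕₚ.≤-reflexive (sym total))
    shorter₂ : suc (length (as ++ y ∷ cs)) ≤ length (as ++ (x ∷ bs) ++ y ∷ cs)
    shorter₂ = ℕₚ.≤-trans (ℕₚ.+-monoˡ-≤ (length (as ++ y ∷ cs)) {1} {length (x ∷ bs)} (s≤s z≤n)) (ℕₚ.≤-reflexive (sym total))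

  conn-path : ∀ {d e} → Conn M d e → ∃ λ xs → Path d xs e
  conn-path here = [] , ~refl
  conn-path (viaσ c) = let (xs , p) = conn-path c in xs , path-end xs ~step p
  conn-path (viaα {e} c) = let (xs , p) = conn-path c in xs ++ [ e ] , path-++ xs p (~refl , ~refl)

  -- Stopping at the first vertex on β keeps the path apart from β; when a vertex repeats, the
  -- detour between its two visits is erased.
  path-to-loop : ∀ β {d} xs {e} → Path d xs e → e ∈ β → ∃₂ λ p y → Path d p y × y ∈ β × AllPairs (DistinctV M) p × All (λ x → All (DistinctV M x) β) p
  path-to-loop β {d} xs p e∈ with onVertexOf? β d
  ... | yes (y , y∈ , s) = [] , y , s , y∈ , [] , []
  path-to-loop β [] {e} p e∈ | no off = ⊥-elim (off (e , e∈ , p))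
  path-to-loop β (x ∷ xs) (s , p) e∈ | no off with path-to-loop β xs p e∈
  ... | q , y , pq , y∈ , dis , away with onVertexOf? q x
  ...   | no free = x ∷ q , y , (s , pq) , y∈ , All.tabulate (λ z∈ t → free (_ , z∈ , t)) ∷ dis
                  , All.tabulate (λ z∈ t → off (_ , z∈ , ~trans s t)) ∷ away
  ...   | yes (z , z∈ , t) with ∈ₚ.∈-∃++ z∈
  ...     | as , cs , refl = z ∷ cs , y , path-start (z ∷ cs) (~trans s t) (proj₂ (path-split as pq)) , y∈
                           , allPairs-++ʳ as dis , Allₚ.++⁻ʳ as away

-- The exploration

least : ∀ {P : ℕ → Set} → (∀ j → Dec (P j)) → ∀ {m} → P m → ∃ λ j → P j × (∀ i → i < j → ¬ P i)
least {P} P? {m} pm = go m zero (subst P (sym (ℕₚ.+-identityʳ m)) pm) λ _ ()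
  where
  go : ∀ fuel j → P (fuel + j) → (∀ i → i < j → ¬ P i) → ∃ λ j → P j × (∀ i → i < j → ¬ P i)
  go zero j pj below = j , pj , below
  go (suc fuel) j pj below with P? j
  ... | yes p = j , p , below
  ... | no ¬p = go fuel (suc j) (subst P (sym (ℕₚ.+-suc fuel j)) pj) λ i i<sj → case ℕₚ.m≤n⇒m<n∨m≡n (ℕₚ.≤-pred i<sj) of λ where
    (inj₁ i<j)  → below i i<j
    (inj₂ refl) → ¬p

unsnoc : ∀ {A : Set} (q : List A) → q ≡ [] ⊎ ∃₂ λ a y → q ≡ a ++ [ y ]
unsnoc [] = inj₁ refl
unsnoc (x ∷ q) with unsnoc q
... | inj₁ refl           = inj₂ ([] , x , refl)
... | inj₂ (a , y , refl) = inj₂ (x ∷ a , y , refl)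

split? : ∀ {A : Set} {P : List A → List A → Set} → (∀ xs ys → Dec (P xs ys)) → ∀ w → Dec (∃₂ λ xs ys → w ≡ xs ++ ys × P xs ys)
split? P? [] with P? [] []
... | yes p = yes ([] , [] , refl , p)
... | no ¬p = no λ { ([] , [] , refl , p) → ¬p p }
split? {P = P} P? (x ∷ w) with P? [] (x ∷ w) | split? {P = λ xs ys → P (x ∷ xs) ys} (λ xs → P? (x ∷ xs)) w
... | yes p | _ = yes ([] , x ∷ w , refl , p)
... | no _  | yes (xs , ys , eq , p) = yes (x ∷ xs , ys , cong (x ∷_) eq , p)
... | no ¬p | no none = no λ where
        ([] , _ , refl , p) → ¬p p
        (_ ∷ xs , ys , refl , p) → none (xs , ys , refl , p)

bounded-list? : ∀ {n} {P : List (Fin n) → Set} → (∀ xs → Dec (P xs)) → ∀ m → Dec (∃ λ xs → length xs ≤ m × P xs)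
bounded-list? P? zero with P? []
... | yes p = yes ([] , z≤n , p)
... | no ¬p = no λ { ([] , _ , p) → ¬p p }
bounded-list? {P = P} P? (suc m) with P? [] | Finₚ.any? (λ x → bounded-list? {P = λ xs → P (x ∷ xs)} (λ xs → P? (x ∷ xs)) m)
... | yes p | _ = yes ([] , z≤n , p)
... | no _  | yes (x , xs , le , p) = yes (x ∷ xs , s≤s le , p)
... | no ¬p | no none = no λ where
        ([] , _ , p) → ¬p p
        (x ∷ xs , s≤s le , p) → none (x , xs , le , p)

module Explore {n r : ℕ} {M : Map n r} (isMap : IsMap M) where
  open Map M using (σ; α; root)
  open IsMap isMap
  open Paths M isMap
  open SimpleLoop

  -- `InSSplit` in a uniform form: all incidences become one `Path` from the root that ends where γ
  -- begins, and all disjointness becomes distinctness of the tails in `p ++ γ`.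
  record Lasso (p γ : List (Fin n)) : Set where
    constructor lasso
    field
      origin   : Fin n
      rest     : List (Fin n)
      γ≡       : γ ≡ origin ∷ rest
      path     : Path root (p ++ γ) origin
      apart    : AllPairs (DistinctV M) (p ++ γ)
      essential : ¬ Contractible M γ

    simple : SimpleLoop γ
    simple = record { closed = origin , subst (λ γ → Path origin γ origin) (sym γ≡) (proj₂ (path-split p (subst (λ γ → Path root (p ++ γ) origin) γ≡ path)))
                    ; distinct = allPairs-++ʳ p apart }

  private
    last-++ : ∀ (x : Fin n) xs y ys → lastOf x (xs ++ y ∷ ys) ≡ lastOf y ys
    last-++ x []       y ys = refl
    last-++ x (z ∷ xs) y ys = last-++ z xs y ys

  toLasso : ∀ {p γ} → InSSplit M p γ → Lasso p γ
  toLasso {p} {g ∷ gs} (walk , start , close , dγ , dp , away , ¬c) = lasso g gs refl (path p walk start) (AllPairsₚ.++⁺ (allPairs-++ˡ p dp) dγ away) ¬c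
    where
    path : ∀ p → Walk M (p ++ g ∷ gs) → SameV M root (headOf p g) → Path root (p ++ g ∷ gs) g
    path []      w s = path-start (g ∷ gs) s (walk-path g gs w close)
    path (x ∷ p) w s = path-start (x ∷ p ++ g ∷ gs) s (walk-path x (p ++ g ∷ gs) w (subst (λ l → SameV M (α l) g) (sym (last-++ x p g gs)) close))

  fromLasso : ∀ {p γ} → Lasso p γ → InSSplit M p γ
  fromLasso {p} (lasso g gs refl path distinct ¬c) =
    path-walk (p ++ g ∷ gs) path , start p path , path-last g gs (proj₂ (path-split p path)) , allPairs-++ʳ p distinct ,
    AllPairsₚ.++⁺ (allPairs-++ˡ p distinct) ([] ∷ []) (All.tabulate (λ x∈ → allPairs-++-cross p distinct x∈ (here refl) ∷ [])) ,
    All.tabulate (λ x∈ → All.tabulate (λ y∈ → allPairs-++-cross p distinct x∈ y∈)) , ¬c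
    where
    start : ∀ p → Path root (p ++ g ∷ gs) g → SameV M root (headOf p g)
    start []      (s , _) = s
    start (x ∷ p) (s , _) = s

  inS-distinct : ∀ {w} → InS M w → AllPairs (DistinctV M) w
  inS-distinct (p , γ , refl , sp) = Lasso.apart (toLasso sp)

  inS-length : ∀ {w} → InS M w → length w ≤ n
  inS-length s = unique-length (distinct-unique (inS-distinct s))

  path? : ∀ d xs e → Dec (Path d xs e)
  path? d []       e = d ~? e
  path? d (x ∷ xs) e = (d ~? x) ×-dec path? (α x) xs e

  abstract
    lasso? : ∀ p γ → Dec (Lasso p γ)
    lasso? p []       = no λ { (lasso _ _ () _ _ _) }
    lasso? p (g ∷ gs) with path? root (p ++ g ∷ gs) g | AllPairs.allPairs? (λ x y → ¬? (x ~? y)) (p ++ g ∷ gs)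
    ... | no ¬path | _ = no λ { (lasso _ _ refl path _ _) → ¬path path }
    ... | yes _ | no ¬dis = no λ { (lasso _ _ refl _ dis _) → ¬dis dis }
    ... | yes path | yes dis with contractible? isMap {g ∷ gs} (record { closed = g , proj₂ (path-split p path) ; distinct = allPairs-++ʳ p dis }) (λ ())
    ...   | yes c = no λ { (lasso _ _ refl _ _ ¬c) → ¬c c }
    ...   | no ¬c = yes (lasso g gs refl path dis ¬c)

    inS? : ∀ w → Dec (InS M w)
    inS? = split? λ p γ → map′ fromLasso toLasso (lasso? p γ)

    -- Elements of `S` have distinct tails, hence at most `n` darts, so only finitely many
    -- continuations have to be tried.
    pref? : ∀ q → Dec (Pref M q)
    pref? q = map′ (λ (rest , _ , s) → rest , s)
      (λ (rest , s) → rest , ℕₚ.≤-trans (ℕₚ.m≤n+m (length rest) (length q)) (ℕₚ.≤-trans (ℕₚ.≤-reflexive (sym (Listₚ.length-++ q))) (inS-length s)) , s)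
      (bounded-list? (λ rest → inS? (q ++ rest)) n)

  -- The invariant of a growing path: what `Greedy` demands, apart from membership in `S`.
  record Good (q : List (Fin n)) : Set where
    field
      fresh : ∀ a rest → rest ≢ [] → q ≡ a ++ rest → ¬ InS M a
      start : ∀ x rest → q ≡ x ∷ rest → ∃ λ j → x ≡ iter σ j root × (∀ j′ → j′ < j → ¬ Pref M (iter σ j′ root ∷ []))
      turns : ∀ a y z rest → q ≡ a ++ y ∷ z ∷ rest → ∃ λ j → z ≡ iter σ (suc j) (α y) ×
                (∀ j′ → j′ < j → ¬ Pref M (a ++ y ∷ iter σ (suc j′) (α y) ∷ []))

  private
    snoc-≢[] : ∀ (q : List (Fin n)) {z} → [] ≢ q ++ [ z ]
    snoc-≢[] []      ()
    snoc-≢[] (_ ∷ _) ()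

    snoc-split : ∀ (q : List (Fin n)) {z} a rest → rest ≢ [] → q ++ [ z ] ≡ a ++ rest → ∃ λ rest′ → rest ≡ rest′ ++ [ z ] × q ≡ a ++ rest′
    snoc-split q       []      rest ne eq = q , sym eq , refl
    snoc-split []      (x ∷ []) rest ne eq = ⊥-elim (ne (sym (Listₚ.∷-injectiveʳ eq)))
    snoc-split []      (x ∷ y ∷ a) rest ne ()
    snoc-split (y ∷ q) (x ∷ a) rest ne eq with snoc-split q a rest ne (Listₚ.∷-injectiveʳ eq)
    ... | rest′ , e₁ , e₂ = rest′ , e₁ , cong₂ _∷_ (Listₚ.∷-injectiveˡ eq) e₂

  good-extend : ∀ q {z} → Good q → ¬ InS M q →
    (q ≡ [] → ∃ λ j → z ≡ iter σ j root × (∀ j′ → j′ < j → ¬ Pref M (iter σ j′ root ∷ []))) →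
    (∀ a y → q ≡ a ++ [ y ] → ∃ λ j → z ≡ iter σ (suc j) (α y) × (∀ j′ → j′ < j → ¬ Pref M (a ++ y ∷ iter σ (suc j′) (α y) ∷ []))) →
    Good (q ++ [ z ])
  good-extend q {z} good ¬s atStart atEnd = record { fresh = fresh ; start = start q refl ; turns = turns }
    where
    fresh : ∀ a rest → rest ≢ [] → q ++ [ z ] ≡ a ++ rest → ¬ InS M a
    fresh a rest ne eq with snoc-split q a rest ne eq
    ... | [] , _ , e         = subst (λ w → ¬ InS M w) (trans e (Listₚ.++-identityʳ a)) ¬s
    ... | (x ∷ rest′) , _ , e = Good.fresh good a (x ∷ rest′) (λ ()) e
    start : ∀ q′ → q ≡ q′ → ∀ x rest → q′ ++ [ z ] ≡ x ∷ rest → _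
    start []       eq x .[] refl = atStart eq
    start (y ∷ q′) eq x rest eq′ = subst (λ w → ∃ λ j → w ≡ iter σ j root × _) (Listₚ.∷-injectiveˡ eq′) (Good.start good y q′ eq)
    turns : ∀ a y w rest → q ++ [ z ] ≡ a ++ y ∷ w ∷ rest → _
    turns a y w rest eq with snoc-split q a (y ∷ w ∷ rest) (λ ()) eq
    ... | [] , () , _
    ... | (_ ∷ []) , refl , e = atEnd a y e
    ... | (_ ∷ w′ ∷ rest′) , e₁ , e with Listₚ.∷-injectiveˡ e₁ | Listₚ.∷-injectiveˡ (Listₚ.∷-injectiveʳ e₁)
    ...   | refl | refl = Good.turns good a y w rest′ e

  private
    -- A turn advances at least once, so the starting dart itself is reached only after a full
    -- period.
    orbit-suc : ∀ {x y} → SameV M x y → ∃ λ j → y ≡ iter σ (suc j) x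
    orbit-suc {x} (suc k , eq) = k , sym eq
    orbit-suc {x} (zero , refl) = let (k , _ , per) = period x in k , sym per

    inS-rest : ∀ q → ¬ InS M q → ∀ {rest} → InS M (q ++ rest) → ∃₂ λ z rest′ → rest ≡ z ∷ rest′
    inS-rest q ¬s {[]} s = ⊥-elim (¬s (subst (InS M) (Listₚ.++-identityʳ q) s))
    inS-rest q ¬s {z ∷ rest} s = z , rest , refl

    inS-path : ∀ {w} → InS M w → ∃ λ e → Path root w e
    inS-path (p , γ , refl , sp) = _ , Lasso.path (toLasso sp)

  choose : ∀ q → Good q → Pref M q → ¬ InS M q → ∃ λ z → Good (q ++ [ z ]) × Pref M (q ++ [ z ])
  choose q good (rest , s) ¬s with inS-rest q ¬s s | unsnoc q
  ... | z , rest , refl | inj₁ refl with proj₁ (proj₂ (inS-path s))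
  ...   | m , refl with least {λ j → Pref M (iter σ j root ∷ [])} (λ j → pref? _) {m} (rest , s)
  ...     | j , pj , below = iter σ j root , good-extend [] good ¬s (λ _ → j , refl , below) (λ a y eq → ⊥-elim (snoc-≢[] a eq)) , pj
  choose q good (rest , s) ¬s | z , rest′ , refl | inj₂ (a , y , refl)
    with orbit-suc (proj₁ (proj₂ (proj₂ (path-split a (subst (λ w → Path root w (proj₁ (inS-path s))) (Listₚ.++-assoc a [ y ] (z ∷ rest′)) (proj₂ (inS-path s)))))))
  ...   | m , refl with least {λ j → Pref M (a ++ y ∷ iter σ (suc j) (α y) ∷ [])} (λ j → pref? _) {m}
                         (rest′ , subst (InS M) (trans (Listₚ.++-assoc a [ y ] _) (sym (Listₚ.++-assoc a (y ∷ _ ∷ []) rest′))) s)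
  ...     | j , pj , below = iter σ (suc j) (α y)
      , good-extend (a ++ [ y ]) good ¬s (λ eq → ⊥-elim (snoc-≢[] a (sym eq))) atEnd
      , subst (Pref M) (sym (Listₚ.++-assoc a [ y ] _)) pj
    where
    atEnd : ∀ a′ y′ → a ++ [ y ] ≡ a′ ++ [ y′ ] → _
    atEnd a′ y′ eq with Listₚ.∷ʳ-injective a a′ eq
    ... | refl , refl = j , refl , below

  greedy-from : ∀ fuel q → n ≤ fuel + length q → Good q → Pref M q → ∃ (Greedy M)
  greedy-from fuel q le good pr with inS? q
  ... | yes s = q , s , Good.fresh good , Good.start good , Good.turns good
  ... | no ¬s with choose q good pr ¬s | fuel
  ...   | z , good′ , pr′ | suc f = greedy-from f (q ++ [ z ]) (ℕₚ.≤-trans le (ℕₚ.≤-reflexive (trans (sym (ℕₚ.+-suc f (length q))) (cong (f +_) (trans (ℕₚ.+-comm 1 _) (sym (Listₚ.length-++ q))))))) good′ pr′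
  ...   | z , good′ , (rest , s) | zero = ⊥-elim (ℕₚ.<-irrefl refl (ℕₚ.≤-trans (s≤s le)
            (ℕₚ.≤-trans (ℕₚ.≤-trans (ℕₚ.≤-reflexive (ℕₚ.+-comm 1 _)) (ℕₚ.≤-trans (ℕₚ.≤-reflexive (sym (Listₚ.length-++ q)))
               (ℕₚ.≤-trans (ℕₚ.m≤m+n _ (length rest)) (ℕₚ.≤-reflexive (sym (Listₚ.length-++ (q ++ [ z ]))))))) (inS-length s))))

  -- A handle provides a cocycle that is odd on some simple loop, which is therefore
  -- noncontractible. It remains to join that loop to the root.
  inS-nonempty : ∀ {g} → 1 ≤ g → HasGenus M g → ∃ (InS M)
  inS-nonempty 1≤g hg =
    let (D , h) = genus-handle isMap 1≤g hg
        open Handle h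
        (β , l , o) = odd-loop isMap u (length word) word ℕₚ.≤-refl (base , trail-path isMap loop) odd
    in go u cocycle β l o
    where
    go : ∀ u → Cocycle (φ M) α u → ∀ β → SimpleLoop β → sumB u β ≡ true → ∃ (InS M)
    go u cu (b ∷ bs) l odd with conn-path isMap (connected root b)
    ... | xs , path with path-to-loop isMap (b ∷ bs) xs path (here refl)
    ... | p , y , pp , y∈ , dis , away with ∈ₚ.∈-∃++ y∈
    ... | as , cs , eq = p ++ y ∷ cs ++ as , p , y ∷ cs ++ as , refl , fromLasso (lasso y (cs ++ as) refl
            (path-++ p pp (path-start (y ∷ cs ++ as) (~sym (proj₁ (proj₂ (closed l′)))) (path-end (y ∷ cs ++ as) (proj₁ (proj₂ (closed l′))) (proj₂ (closed l′)))))
            (AllPairsₚ.++⁺ dis (distinct l′) (All.map (λ {x} al → All.tabulate λ z∈ → All.lookup al (subst (_ ∈_) (sym eq) (Perm↭ₚ.∈-resp-↭ (Perm↭ₚ.++-comm (y ∷ cs) as) z∈))) away))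
            λ c → case trans (sym (cocycle-contractible M cu c)) odd′ of λ ())
      where
      l′ : SimpleLoop (y ∷ cs ++ as)
      l′ = loop-rotate as (subst SimpleLoop eq l)
      odd′ : sumB u (y ∷ cs ++ as) ≡ true
      odd′ = trans (sumB-++ u (y ∷ cs)) (trans (Boolₚ.xor-comm (sumB u (y ∷ cs)) (sumB u as)) (trans (sym (sumB-++ u as)) (trans (cong (sumB u) (sym eq)) odd)))

  rightmost-exists : ∀ {g} → 1 ≤ g → HasGenus M g → ∃ (IsRightmost M)
  rightmost-exists 1≤g hg =
    let (w , s) = inS-nonempty 1≤g hg
        (w′ , gr) = greedy-from n [] (ℕₚ.m≤m+n n 0) (record { fresh = λ { [] [] ne eq → ⊥-elim (ne refl) ; [] (_ ∷ _) ne () ; (_ ∷ _) _ ne () }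
                        ; start = λ _ _ () ; turns = λ { [] y z rest () ; (_ ∷ _) y z rest () } }) (w , s)
        (p , γ , eq , sp) = proj₁ gr
    in γ , p , subst (Greedy M) eq gr , sp

-- Left and right sectors at the vertices of a loop

module LoopSides {n r : ℕ} {M : Map n r} (isMap : IsMap M) {γ : List (Fin n)} (l : Paths.SimpleLoop M isMap γ)
  (no-return : ∀ {x} → x ∈ γ → Map.α M x ∉ γ) where
  open Map M using (σ; α)
  open IsMap isMap
  open Paths M isMap
  open SimpleLoop l
  open Arcs σ σ-inj

  prev : Fin n → Fin n
  prev = cycBwd γ

  prev-next : ∀ {y} → y ∈ γ → CycNext γ (prev y) y
  prev-next {y} y∈ = let (x , nx) = cycNext-to y∈ in subst (λ z → CycNext γ z y) (sym (cycBwd-next unique nx)) nx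

  prev∈ : ∀ {y} → y ∈ γ → prev y ∈ γ
  prev∈ y∈ = cycNext-∈ˡ (prev-next y∈)

  arrival : ∀ {y} → y ∈ γ → SameV M (α (prev y)) y
  arrival y∈ = joined (prev-next y∈)

  -- Counterclockwise around the tail of y ∈ γ one meets y, the darts on the
  -- left of γ, the reversed predecessor of y, and the darts on the right of γ.
  Left Right : Fin n → Fin n → Set
  Left y  = Arc σ y (α (prev y))
  Right y = Arc σ (α (prev y)) y

  On Off : Fin n → Set
  On d  = ∃ λ y → y ∈ γ × SameV M y d
  Off d = ¬ On d

  on? : ∀ d → Dec (On d)
  on? d = map′ (λ a → let (y , y∈ , s) = find a in y , y∈ , s) (λ (y , y∈ , s) → lose y∈ s) (Any.any? (_~? d) γ)

  y≢arrival : ∀ {y} → y ∈ γ → y ≢ α (prev y)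
  y≢arrival y∈ eq = no-return (prev∈ y∈) (subst (_∈ γ) eq y∈)

  right-~ : ∀ {y d} → y ∈ γ → Right y d → SameV M y d
  right-~ y∈ a = ~trans (~sym (arrival y∈)) (arc-~ a)

  left-~ : ∀ {y d} → Left y d → SameV M y d
  left-~ = arc-~

  private
    free : ∀ {y d} → y ∈ γ → SameV M y d → d ≢ y → d ≢ α (prev y) → d ∉ γ × α d ∉ γ
    free {y} {d} y∈ s ne ne′ =
      (λ d∈ → ne (sym (tail-inj y∈ d∈ s))) ,
      λ αd∈ → ne′ (trans (sym (α-invol d)) (cong α (head-inj αd∈ (prev∈ y∈)
        (subst (λ z → SameV M z (α (prev y))) (sym (α-invol d)) (~sym (~trans (arrival y∈) s))))))

  right-free : ∀ {y d} → y ∈ γ → Right y d → d ∉ γ × α d ∉ γ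
  right-free y∈ a = free y∈ (right-~ y∈ a) (arc≢end a) (arc≢start (arrival y∈) a)

  left-free : ∀ {y d} → y ∈ γ → Left y d → d ∉ γ × α d ∉ γ
  left-free y∈ a = free y∈ (left-~ a) (arc≢start (~sym (arrival y∈)) a) (arc≢end a)

  off-free : ∀ {d} → Off d → d ∉ γ × α d ∉ γ
  off-free {d} off = (λ d∈ → off (d , d∈ , ~refl)) ,
    λ αd∈ → let (y , nx) = cycNext-from αd∈ in off (y , cycNext-∈ʳ nx , ~sym (subst (λ z → SameV M z y) (α-invol d) (joined nx)))

  sides : ∀ {y d} → y ∈ γ → SameV M y d → d ≡ y ⊎ d ≡ α (prev y) ⊎ Left y d ⊎ Right y d
  sides y∈ = arc-cases (y≢arrival y∈) (~sym (arrival y∈))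

  left-right : ∀ {y d} → y ∈ γ → Left y d → ¬ Right y d
  left-right y∈ = arc-disjoint (y≢arrival y∈) (~sym (arrival y∈))

  private
    isRight : ∀ {y d : Fin n} {A B C : Set} → d ≡ y ⊎ A ⊎ B ⊎ C → Bool
    isRight (inj₁ _)               = false
    isRight (inj₂ (inj₁ _))        = false
    isRight (inj₂ (inj₂ (inj₁ _))) = false
    isRight (inj₂ (inj₂ (inj₂ _))) = true

    decideRight : ∀ {d} → Dec (On d) → Bool
    decideRight {d} (yes (y , y∈ , s)) = isRight {y} {d} (sides y∈ s)
    decideRight (no _)                 = false

  onRight : Fin n → Bool
  onRight d = decideRight (on? d)

  private
    decided : ∀ {y d} → y ∈ γ → SameV M y d → ∃ λ (c : d ≡ y ⊎ d ≡ α (prev y) ⊎ Left y d ⊎ Right y d) → onRight d ≡ isRight {y} {d} c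
    decided {y} {d} y∈ s with on? d
    ... | no off = ⊥-elim (off (y , y∈ , s))
    ... | yes (z , z∈ , t) with tail-inj z∈ y∈ (~trans t (~sym s))
    ...   | refl = sides z∈ t , refl

  onRight-right : ∀ {y d} → y ∈ γ → Right y d → onRight d ≡ true
  onRight-right y∈ a with decided y∈ (right-~ y∈ a)
  ... | inj₁ eq , _                     = ⊥-elim (arc≢end a eq)
  ... | inj₂ (inj₁ eq) , _              = ⊥-elim (arc≢start (arrival y∈) a eq)
  ... | inj₂ (inj₂ (inj₁ b)) , _        = ⊥-elim (left-right y∈ b a)
  ... | inj₂ (inj₂ (inj₂ _)) , eq       = eq

  private
    onRight-not : ∀ {y d} → y ∈ γ → SameV M y d → ¬ Right y d → onRight d ≡ false
    onRight-not y∈ s ¬r with decided y∈ s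
    ... | inj₁ _ , eq               = eq
    ... | inj₂ (inj₁ _) , eq        = eq
    ... | inj₂ (inj₂ (inj₁ _)) , eq = eq
    ... | inj₂ (inj₂ (inj₂ a)) , _  = ⊥-elim (¬r a)

  onRight-self : ∀ {y} → y ∈ γ → onRight y ≡ false
  onRight-self y∈ = onRight-not y∈ ~refl λ a → arc≢end a refl

  onRight-arrival : ∀ {y} → y ∈ γ → onRight (α (prev y)) ≡ false
  onRight-arrival y∈ = onRight-not y∈ (~sym (arrival y∈)) λ a → arc≢start (arrival y∈) a refl

  onRight-left : ∀ {y d} → y ∈ γ → Left y d → onRight d ≡ false
  onRight-left y∈ a = onRight-not y∈ (left-~ a) (left-right y∈ a)

  onRight-off : ∀ {d} → Off d → onRight d ≡ false
  onRight-off {d} off with on? d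
  ... | yes on = ⊥-elim (off on)
  ... | no _   = refl

  onRight-α : ∀ {x} → x ∈ γ → onRight (α x) ≡ false
  onRight-α {x} x∈ = let (y , nx) = cycNext-from x∈ in
    subst (λ z → onRight (α z) ≡ false) (cycBwd-next unique nx) (onRight-arrival (cycNext-∈ʳ nx))

  -- The mod 2 intersection number with the curve obtained by pushing γ off to its right.
  parity : Fin n → Bool
  parity d = onRight d xor onRight (α d)

  private
    on-γ : Fin n → Bool
    on-γ d = does (d ∈? γ)

    yesγ : ∀ {d} → d ∈ γ → on-γ d ≡ true
    yesγ {d} = dec-true (d ∈? γ)

    noγ : ∀ {d} → d ∉ γ → on-γ d ≡ false
    noγ {d} = dec-false (d ∈? γ)

    -- The right side of γ is left only through γ itself.
    jump : ∀ e → onRight (σ e) xor onRight e ≡ on-γ (α e) xor on-γ (σ e)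
    jump e = go (on? e)
      where
      go : Dec (On e) → onRight (σ e) xor onRight e ≡ on-γ (α e) xor on-γ (σ e)
      go (no off) = trans (cong₂ _xor_ (onRight-off offσ) (onRight-off off))
                          (sym (cong₂ _xor_ (noγ (proj₂ (off-free off))) (noγ (proj₁ (off-free offσ)))))
        where
        offσ : Off (σ e)
        offσ (y , y∈ , s) = off (y , y∈ , ~post s)
      go (yes (y , y∈ , s)) with sides y∈ s
      ... | inj₁ refl with σ y ≟F α (prev y)
      ...   | yes eq = trans (cong₂ _xor_ (trans (cong onRight eq) (onRight-arrival y∈)) (onRight-self y∈))
                       (sym (cong₂ _xor_ (noγ (no-return y∈)) (noγ (subst (_∉ γ) (sym eq) (no-return (prev∈ y∈))))))
      ...   | no ne  = let a = first ne in trans (cong₂ _xor_ (onRight-left y∈ a) (onRight-self y∈))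
                       (sym (cong₂ _xor_ (noγ (no-return y∈)) (noγ (proj₁ (left-free y∈ a)))))
      go (yes (y , y∈ , s)) | inj₂ (inj₁ refl) with σ e ≟F y
      ...   | yes eq = trans (cong₂ _xor_ (trans (cong onRight eq) (onRight-self y∈)) (onRight-arrival y∈))
                       (sym (cong₂ _xor_ (yesγ (subst (_∈ γ) (sym (α-invol (prev y))) (prev∈ y∈))) (yesγ (subst (_∈ γ) (sym eq) y∈))))
      ...   | no ne  = let a = first ne in trans (cong₂ _xor_ (onRight-right y∈ a) (onRight-arrival y∈))
                       (sym (cong₂ _xor_ (yesγ (subst (_∈ γ) (sym (α-invol (prev y))) (prev∈ y∈))) (noγ (proj₁ (right-free y∈ a)))))
      go (yes (y , y∈ , s)) | inj₂ (inj₂ (inj₁ b)) with σ e ≟F α (prev y)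
      ...   | yes eq = trans (cong₂ _xor_ (trans (cong onRight eq) (onRight-arrival y∈)) (onRight-left y∈ b))
                       (sym (cong₂ _xor_ (noγ (proj₂ (left-free y∈ b))) (noγ (subst (_∉ γ) (sym eq) (no-return (prev∈ y∈))))))
      ...   | no ne  = let a = next b ne in trans (cong₂ _xor_ (onRight-left y∈ a) (onRight-left y∈ b))
                       (sym (cong₂ _xor_ (noγ (proj₂ (left-free y∈ b))) (noγ (proj₁ (left-free y∈ a)))))
      go (yes (y , y∈ , s)) | inj₂ (inj₂ (inj₂ b)) with σ e ≟F y
      ...   | yes eq = trans (cong₂ _xor_ (trans (cong onRight eq) (onRight-self y∈)) (onRight-right y∈ b))
                       (sym (cong₂ _xor_ (noγ (proj₂ (right-free y∈ b))) (yesγ (subst (_∈ γ) (sym eq) y∈))))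
      ...   | no ne  = let a = next b ne in trans (cong₂ _xor_ (onRight-right y∈ a) (onRight-right y∈ b))
                       (sym (cong₂ _xor_ (noγ (proj₂ (right-free y∈ b))) (noγ (proj₁ (right-free y∈ a)))))

  -- Around a face, `onRight` may be shifted by one dart. By `jump` the sum then consists of
  -- differences of the indicator of γ at consecutive darts, and these cancel cyclically.
  parity-cocycle : Cocycle (φ M) α parity
  parity-cocycle = record
    { sym-α = λ d → trans (cong (onRight (α d) xor_) (cong onRight (α-invol d))) (Boolₚ.xor-comm (onRight (α d)) (onRight d))
    ; faces = λ d k per → begin
        orbitSum (φ M) parity d (suc k)
          ≡⟨ orbitSum-xor (φ M) onRight (onRight ∘ α) d (suc k) ⟩
        orbitSum (φ M) onRight d (suc k) xor orbitSum (φ M) (onRight ∘ α) d (suc k)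
          ≡⟨ cong (_xor orbitSum (φ M) (onRight ∘ α) d (suc k)) (orbitSum-rotate (φ M) onRight d (suc k) per) ⟨
        orbitSum (φ M) (onRight ∘ φ M) d (suc k) xor orbitSum (φ M) (onRight ∘ α) d (suc k)
          ≡⟨ orbitSum-xor (φ M) (onRight ∘ φ M) (onRight ∘ α) d (suc k) ⟨
        orbitSum (φ M) (λ e → onRight (φ M e) xor onRight (α e)) d (suc k)
          ≡⟨ orbitSum-cong (φ M) (λ e → trans (jump (α e)) (cong (λ z → on-γ z xor on-γ (φ M e)) (α-invol e))) d (suc k) ⟩
        orbitSum (φ M) (λ e → on-γ e xor on-γ (φ M e)) d (suc k)
          ≡⟨ orbitSum-xor (φ M) on-γ (on-γ ∘ φ M) d (suc k) ⟩
        orbitSum (φ M) on-γ d (suc k) xor orbitSum (φ M) (on-γ ∘ φ M) d (suc k)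
          ≡⟨ cong (orbitSum (φ M) on-γ d (suc k) xor_) (orbitSum-rotate (φ M) on-γ d (suc k) per) ⟩
        orbitSum (φ M) on-γ d (suc k) xor orbitSum (φ M) on-γ d (suc k)
          ≡⟨ Boolₚ.xor-same (orbitSum (φ M) on-γ d (suc k)) ⟩
        false ∎ }
    where open ≡-Reasoning

-- Rotations

-- Symmetric in `c` and `c⁻`, so that one argument serves both signs and also the rotation back.
record Shift {n : ℕ} (γ : List (Fin n)) (c c⁻ : Fin n → Fin n) : Set where
  field
    cc⁻   : ∀ d → c (c⁻ d) ≡ d
    c⁻c   : ∀ d → c⁻ (c d) ≡ d
    fix   : ∀ {d} → d ∉ γ → c d ≡ d
    shift-next  : ∀ {x y} → CycNext γ x y → CycNext γ (c x) (c y)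
    fix⁻  : ∀ {d} → d ∉ γ → c⁻ d ≡ d
    shift-next⁻ : ∀ {x y} → CycNext γ x y → CycNext γ (c⁻ x) (c⁻ y)
  stays : ∀ {d} → d ∈ γ → c d ∈ γ
  stays d∈ = cycNext-∈ˡ (shift-next (proj₂ (cycNext-from d∈)))
  stays⁻ : ∀ {d} → d ∈ γ → c⁻ d ∈ γ
  stays⁻ d∈ = cycNext-∈ˡ (shift-next⁻ (proj₂ (cycNext-from d∈)))

shift-inverse : ∀ {n} {γ : List (Fin n)} {c c⁻} → Shift γ c c⁻ → Shift γ c⁻ c
shift-inverse s = record { cc⁻ = c⁻c ; c⁻c = cc⁻ ; fix = fix⁻ ; shift-next = shift-next⁻ ; fix⁻ = fix ; shift-next⁻ = shift-next }
  where open Shift s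

shift-cyc : ∀ {n} {γ : List (Fin n)} → AllPairs _≢_ γ → Shift γ (cycFwd γ) (cycBwd γ)
shift-cyc {γ = γ} uniq = record
  { cc⁻ = cycFwd-cycBwd uniq ; c⁻c = cycBwd-cycFwd uniq ; fix = cycFwd-fix ; fix⁻ = cycBwd-fix
  ; shift-next = λ nx → subst (λ z → CycNext γ z _) (sym (cycFwd-next uniq nx)) (cycFwd-cycNext uniq (cycNext-∈ʳ nx))
  ; shift-next⁻ = λ {x} nx → let (w , nw) = cycNext-to (cycNext-∈ˡ nx) in
      subst (CycNext γ _) (sym (cycBwd-next uniq nx)) (subst (λ z → CycNext γ z x) (sym (cycBwd-next uniq nw)) nw) }

conn-trans : ∀ {n r} {M : Map n r} {d e f} → Conn M d e → Conn M e f → Conn M d f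
conn-trans p here = p
conn-trans p (viaσ q) = viaσ (conn-trans p q)
conn-trans p (viaα q) = viaα (conn-trans p q)

conn-~ : ∀ {n r} {M : Map n r} {d e} → SameV M d e → Conn M d e
conn-~ (k , eq) = go k eq
  where
  go : ∀ {n r} {M : Map n r} {d e} k → iter (Map.σ M) k d ≡ e → Conn M d e
  go zero    refl = here
  go (suc k) refl = viaσ (go k refl)

module Rotate {n r : ℕ} {M : Map n r} (isMap : IsMap M) {γ : List (Fin n)} (l : Paths.SimpleLoop M isMap γ)
  (no-return : ∀ {x} → x ∈ γ → Map.α M x ∉ γ) {c c⁻ : Fin n → Fin n} (shift : Shift γ c c⁻)
  (σ′ : Fin n → Fin n) (root′ : Fin n) (lab′ : Fin n → Fin r)
  (σ′≡ : ∀ d → σ′ d ≡ c (Map.σ M (Map.α M (c⁻ (Map.α M d))))) (root′≡ : root′ ≡ c (Map.root M))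
  (lab′≡ : ∀ d → lab′ d ≡ Map.lab M (c⁻ d)) where
  open Map M using (σ; α; root; lab)
  open IsMap isMap
  open Paths M isMap
  open SimpleLoop l
  open Arcs σ σ-inj
  open LoopSides isMap l no-return
  open Shift shift

  M′ : Map n r
  M′ = record { σ = σ′ ; α = α ; root = root′ ; lab = lab′ }

  c-inj : Injective _≡_ _≡_ c
  c-inj {x} {y} eq = trans (sym (c⁻c x)) (trans (cong c⁻ eq) (c⁻c y))

  c⁻-inj : Injective _≡_ _≡_ c⁻
  c⁻-inj {x} {y} eq = trans (sym (cc⁻ x)) (trans (cong c eq) (cc⁻ y))

  -- In terms of faces: the new face permutation is the old one conjugated by `c`. Degrees and
  -- labels of faces carry over through this identity.
  σ′-c : ∀ x → σ′ (α (c x)) ≡ c (σ (α x))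
  σ′-c x = trans (σ′≡ (α (c x))) (cong (c ∘ σ) (trans (cong (α ∘ c⁻) (α-invol (c x))) (cong α (c⁻c x))))

  σ′-free : ∀ {d} → α d ∉ γ → σ′ d ≡ c (σ d)
  σ′-free {d} αd∉ = trans (σ′≡ d) (cong (c ∘ σ) (trans (cong α (fix⁻ αd∉)) (α-invol d)))

  σ′-inj : Injective _≡_ _≡_ σ′
  σ′-inj {x} {y} eq = α-inj (c⁻-inj (α-inj (σ-inj (c-inj (trans (sym (σ′≡ x)) (trans eq (σ′≡ y)))))))

  φ′-iter : ∀ k x → iter (φ M′) k (c x) ≡ c (iter (φ M) k x)
  φ′-iter zero    x = refl
  φ′-iter (suc k) x = trans (cong (φ M′) (φ′-iter k x)) (σ′-c _)

  private
    module P′ = Perm σ′ σ′-inj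
    module A′ = Arcs σ′ σ′-inj

  SameV′ : Fin n → Fin n → Set
  SameV′ = SameOrbit σ′

  -- Turning from s is the same in both maps as long as no dart of γ is met.
  module Turn {s s′ z : Fin n} (start : σ′ s′ ≡ c (σ s)) (free : ∀ {w} → Arc σ s z w → w ∉ γ × α w ∉ γ) where

    arc-back : ∀ {w} → Arc σ′ s′ (c z) w → Arc σ s z w
    arc-back (first ne) = subst (Arc σ s z) (sym (trans start (fix (proj₁ (free a))))) a
      where a = first (λ eq → ne (trans start (cong c eq)))
    arc-back (next {w} a ne) = subst (Arc σ s z) (sym (trans (σ′-free (proj₂ (free ih))) (fix (proj₁ (free b))))) b
      where
      ih = arc-back a
      b = next ih (λ eq → ne (trans (σ′-free (proj₂ (free ih))) (cong c eq)))

    arc-same : ∀ {w} → Arc σ s z w → SameV′ s′ w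
    arc-same a@(first ne) = subst (SameV′ s′) (trans start (fix (proj₁ (free a)))) P′.~step
    arc-same (next a ne)  = subst (SameV′ s′) (trans (σ′-free (proj₂ (free a))) (fix (proj₁ (free (next a ne))))) (P′.~trans (arc-same a) P′.~step)

    end-same : SameV M s z → SameV′ s′ (c z)
    end-same s~z = arc-through (λ w → SameV′ s′ (c w)) s~z (subst (SameV′ s′) start P′.~step)
      λ w a h → subst (SameV′ s′) (trans (cong σ′ (fix (proj₁ (free a)))) (σ′-free (proj₂ (free a)))) (P′.~trans h P′.~step)

  c-prev : ∀ {y} → y ∈ γ → prev (c y) ≡ c (prev y)
  c-prev y∈ = cycBwd-next unique (shift-next (prev-next y∈))

  module _ {y : Fin n} (y∈ : y ∈ γ) where
    private
      module TR = Turn {α (prev y)} {α (c (prev y))} {y} (σ′-c (prev y)) (right-free y∈)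

    -- The turn from the new predecessor of `c y` sweeps the right sector of `y`, which the rotation
    -- has moved to the vertex of `c y`.
    arrival′ : SameV′ (α (c (prev y))) (c y)
    arrival′ = TR.end-same (arrival y∈)

    right′ : ∀ {d} → Right y d → SameV′ d (c y)
    right′ a = P′.~trans (P′.~sym (TR.arc-same a)) arrival′

  joined′ : ∀ {x y} → CycNext γ x y → SameV′ (α x) y
  joined′ {x} {y} nx = subst (λ z → SameV′ (α z) y) (trans (cong c (cycBwd-next unique (shift-next⁻ nx))) (cc⁻ x))
    (subst (SameV′ _) (cc⁻ y) (arrival′ (stays⁻ (cycNext-∈ʳ nx))))

  off-σ : ∀ {d} → Off d → Off (σ d)
  off-σ off (y , y∈ , s) = off (y , y∈ , ~post s)

  σ′-off : ∀ {d} → Off d → σ′ d ≡ σ d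
  σ′-off off = trans (σ′-free (proj₂ (off-free off))) (fix (proj₁ (off-free (off-σ off))))

  iter-off : ∀ k {d} → Off d → iter σ′ k d ≡ iter σ k d × Off (iter σ k d)
  iter-off zero    off = refl , off
  iter-off (suc k) off = let (eq , off′) = iter-off k off in trans (cong σ′ eq) (σ′-off off′) , off-σ off′

  off-~ : ∀ {d e} → Off d → SameV M d e → Off e
  off-~ off s (y , y∈ , t) = off (y , y∈ , ~trans t (~sym s))

  to′-off : ∀ {d e} → Off d → SameV M d e → SameV′ d e
  to′-off off (k , eq) = k , trans (proj₁ (iter-off k off)) eq

  from′-off : ∀ {d e} → Off d → SameV′ d e → SameV M d e
  from′-off off (k , eq) = k , trans (sym (proj₁ (iter-off k off))) eq

  -- The vertex of M′ carrying c y consists of c y, the left side of c y, the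
  -- reversed predecessor of c y, and the right side of y.
  Vertex′ : Fin n → Fin n → Set
  Vertex′ y d = d ≡ c y ⊎ d ≡ α (prev (c y)) ⊎ Left (c y) d ⊎ Right y d

  module _ {y : Fin n} (y∈ : y ∈ γ) where
    private
      cy∈ = stays y∈

      leftward : ∀ {d} → (σ d ≢ α (prev (c y)) → Left (c y) (σ d)) → α d ∉ γ → Vertex′ y (σ′ d)
      leftward {d} step αd∉ with σ d ≟F α (prev (c y))
      ... | yes eq = inj₂ (inj₁ (trans (σ′-free αd∉) (trans (cong c eq) (fix (no-return (prev∈ cy∈))))))
      ... | no ne  = inj₂ (inj₂ (inj₁ (subst (Left (c y)) (sym (trans (σ′-free αd∉) (fix (proj₁ (left-free cy∈ (step ne)))))) (step ne))))

      rightward : ∀ {d e} → σ′ d ≡ c (σ e) → (σ e ≢ y → Right y (σ e)) → Vertex′ y (σ′ d)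
      rightward {d} {e} eq step with σ e ≟F y
      ... | yes eq′ = inj₁ (trans eq (cong c eq′))
      ... | no ne   = inj₂ (inj₂ (inj₂ (subst (Right y) (sym (trans eq (fix (proj₁ (right-free y∈ (step ne)))))) (step ne))))

    vertex′-σ′ : ∀ {d} → Vertex′ y d → Vertex′ y (σ′ d)
    vertex′-σ′ (inj₁ refl) = leftward first (no-return cy∈)
    vertex′-σ′ (inj₂ (inj₁ refl)) = rightward {e = α (prev y)} (trans (cong (σ′ ∘ α) (c-prev y∈)) (σ′-c (prev y))) first
    vertex′-σ′ (inj₂ (inj₂ (inj₁ a))) = leftward (next a) (proj₂ (left-free cy∈ a))
    vertex′-σ′ (inj₂ (inj₂ (inj₂ a))) = rightward (σ′-free (proj₂ (right-free y∈ a))) (next a)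

    vertex′ : ∀ {d} → SameV′ (c y) d → Vertex′ y d
    vertex′ (k , eq) = go k eq
      where
      go : ∀ k {d} → iter σ′ k (c y) ≡ d → Vertex′ y d
      go zero    refl = inj₁ refl
      go (suc k) refl = vertex′-σ′ (go k refl)

    vertex′-on : ∀ {d} → Vertex′ y d → On d
    vertex′-on (inj₁ refl) = c y , cy∈ , ~refl
    vertex′-on (inj₂ (inj₁ refl)) = c y , cy∈ , ~sym (arrival cy∈)
    vertex′-on (inj₂ (inj₂ (inj₁ a))) = c y , cy∈ , left-~ a
    vertex′-on (inj₂ (inj₂ (inj₂ a))) = y , y∈ , right-~ y∈ a

  on-from′ : ∀ {y d} → y ∈ γ → SameV′ y d → On d
  on-from′ {y} y∈ s = vertex′-on (stays⁻ y∈) (vertex′ (stays⁻ y∈) (subst (λ z → SameV′ z _) (sym (cc⁻ y)) s))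

  -- Of the four parts of a new vertex, only the first contains a dart of γ.
  tail-inj′ : ∀ {x y} → x ∈ γ → y ∈ γ → SameV′ x y → x ≡ y
  tail-inj′ {x} {y} x∈ y∈ s with vertex′ (stays⁻ x∈) (subst (λ z → SameV′ z y) (sym (cc⁻ x)) s)
  ... | inj₁ eq = sym (trans eq (cc⁻ x))
  ... | inj₂ (inj₁ eq) = ⊥-elim (no-return (prev∈ (stays (stays⁻ x∈))) (subst (_∈ γ) eq y∈))
  ... | inj₂ (inj₂ (inj₁ a)) = ⊥-elim (proj₁ (left-free (stays (stays⁻ x∈)) a) y∈)
  ... | inj₂ (inj₂ (inj₂ a)) = ⊥-elim (proj₁ (right-free (stays⁻ x∈) a) y∈)

  private
    loop-conn : ∀ {x y} → x ∈ γ → y ∈ γ → Conn M′ x y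
    loop-conn {x} x∈ = cyc-induct (Conn M′ x) (λ nx p → conn-trans (viaα p) (conn-~ (joined′ nx))) x∈ here

    -- The shift moves darts only along γ, and γ is still a closed walk in `M′`.
    c-conn : ∀ x → Conn M′ x (c x) × Conn M′ (c x) x
    c-conn x with x ∈? γ
    ... | yes x∈ = loop-conn x∈ (stays x∈) , loop-conn (stays x∈) x∈
    ... | no x∉ rewrite fix x∉ = here , here

    σ-conn : ∀ d → Conn M′ d (σ d)
    σ-conn d = conn-trans (viaα here) (conn-trans (proj₁ (c-conn (α d))) (conn-trans (viaσ (viaα here))
                 (subst (λ z → Conn M′ z (σ d)) (sym (trans (σ′-c (α d)) (cong (c ∘ σ) (α-invol d)))) (proj₂ (c-conn (σ d))))))

    conn′ : ∀ {d e} → Conn M d e → Conn M′ d e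
    conn′ here     = here
    conn′ (viaσ p) = conn-trans (conn′ p) (σ-conn _)
    conn′ (viaα p) = viaα (conn′ p)

  isMap′ : IsMap M′
  isMap′ = record
    { σ-inj = σ′-inj ; α-invol = α-invol ; α-free = α-free
    ; connected = λ d e → conn′ (connected d e)
    ; lab-face = λ d → trans (lab′≡ (φ M′ d)) (trans (cong (lab ∘ c⁻) (trans (cong (φ M′) (sym (cc⁻ d))) (σ′-c (c⁻ d))))
                   (trans (cong lab (c⁻c _)) (trans (lab-face (c⁻ d)) (sym (lab′≡ d)))))
    ; lab-inj = λ d e eq → let (k , eq′) = lab-inj (c⁻ d) (c⁻ e) (trans (sym (lab′≡ d)) (trans eq (lab′≡ e))) in
        k , trans (cong (iter (φ M′) k) (sym (cc⁻ d))) (trans (φ′-iter k (c⁻ d)) (trans (cong c eq′) (cc⁻ e)))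
    ; lab-surj = λ i → let (d , eq) = lab-surj i in c d , trans (lab′≡ (c d)) (trans (cong lab (c⁻c d)) eq) }

  -- Inequalities suffice here and for the two orbit counts below: the rotation back is another
  -- instance of this module and supplies the converses.
  faceDeg-≤ : ∀ i → faceDeg M′ i ≤ faceDeg M i
  faceDeg-≤ i = ℕₚ.≤-trans (ℕₚ.≤-reflexive (cong length (Listₚ.filter-≐ _ _ ((λ {d} → subst T (same d)) , λ {d} → subst T (sym (same d))) (allFin n))))
                  (countB-∘ (λ d → does (lab d ≟F i)) c⁻ c c⁻c cc⁻)
    where
    same : ∀ d → does (lab′ d ≟F i) ≡ does (lab (c⁻ d) ≟F i)
    same d = cong (λ j → does (j ≟F i)) (lab′≡ d)

  numFaces-≤ : numFaces M ≤ numFaces M′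
  numFaces-≤ = numOrbits-map φ-inj (Basics.φ-inj isMap′) c λ {d} {e} (k , eq) → k , c-inj (trans (sym (φ′-iter k d)) eq)

  numVertices-≤ : numVertices M ≤ numVertices M′
  -- A vertex on γ is represented by its dart in γ, since `tail-inj′` keeps these apart in `M′`; a
  -- vertex off γ is not changed at all.
  numVertices-≤ = numOrbits-map σ-inj σ′-inj (λ d → pick d (on? d)) λ {d} {e} s → reflect (on? d) (on? e) s
    where
    pick : ∀ d → Dec (On d) → Fin n
    pick d (yes (y , _)) = y
    pick d (no _)        = d
    reflect : ∀ {d e} (a : Dec (On d)) (b : Dec (On e)) → SameV′ (pick d a) (pick e b) → SameV M d e
    reflect (yes (x , x∈ , s)) (yes (y , y∈ , t)) u with tail-inj′ x∈ y∈ u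
    ... | refl = ~trans (~sym s) t
    reflect (yes (x , x∈ , s)) (no off) u = ⊥-elim (off (on-from′ x∈ u))
    reflect (no off) (yes (y , y∈ , t)) u = ⊥-elim (off (on-from′ y∈ (P′.~sym u)))
    reflect (no off) (no _) u = from′-off off u

  module Q′ = Paths M′ isMap′

  loop′ : Q′.SimpleLoop γ
  loop′ = record { closed = subst Q′.Closed (Listₚ.map-id γ) (Q′.closed-map id joined′)
                 ; distinct = allPairs-from unique λ x∈ y∈ ne s → ne (tail-inj′ x∈ y∈ s) }

  -- A disc of M whose interior avoids γ is not affected by the rotation.
  module Transfer {D : Fin n → Set} (D? : ∀ d → Dec (D d)) (D-φ : ∀ {d} → D d → D (φ M d))
    (avoids : ∀ {d} → D d → D (α d) → d ∉ γ × α d ∉ γ) (filled : Disc isMap D) where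
    open Words M′ α-invol

    private
      -- A dart in `D` travels with its face; outside `D`, a letter is chosen as the inverse of the
      -- image of its reversal. On an interior edge both sides lie in `D`, and `avoids` makes their
      -- images inverse to each other.
      moved : Fin n → Fin n
      moved d with D? d
      ... | yes _ = c d
      ... | no _  = α (c (α d))

      letter : Fin n → List (Fin n)
      letter d = moved d ∷ []

      moved-in : ∀ {d} → D d → moved d ≡ c d
      moved-in {d} Dd with D? d
      ... | yes _  = refl
      ... | no ¬Dd = ⊥-elim (¬Dd Dd)

      moved-out : ∀ {d} → ¬ D d → moved d ≡ α (c (α d))
      moved-out {d} ¬Dd with D? d
      ... | yes Dd = ⊥-elim (¬Dd Dd)
      ... | no _   = refl

      module R = Reps wordGroup M isMap

      prod-map : ∀ xs → R.prod letter xs ≡ map moved xs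
      prod-map []       = refl
      prod-map (x ∷ xs) = cong (moved x ∷_) (prod-map xs)

      moved-α : ∀ {d} → D d → moved (α d) ≡ α (c d)
      moved-α {d} Dd with D? (α d)
      ... | yes Dαd = trans (fix (proj₂ (avoids Dd Dαd))) (cong α (sym (fix (proj₁ (avoids Dd Dαd)))))
      ... | no _    = cong (α ∘ c) (α-invol d)

      map-orbit : ∀ d m → D d → map moved (orbitList (φ M) d m) ≡ orbitList (φ M′) (c d) m
      map-orbit d zero    Dd = refl
      map-orbit d (suc m) Dd = cong₂ _∷_ (moved-in Dd) (trans (map-orbit (φ M d) m (D-φ Dd)) (cong (λ z → orbitList (φ M′) z m) (sym (σ′-c d))))

      rep : R.Rep D letter
      rep = record
        { inv = λ d Dd → subst (_≈w []) (cong₂ (λ x y → x ∷ y ∷ []) (sym (moved-in Dd)) (sym (moved-α Dd))) (≈w-sym (≈w-step (back [] [] (c d))))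
        ; faces = λ d k Dd per → subst (_≈w []) (sym (trans (prod-map (orbitList (φ M) d (suc k))) (map-orbit d (suc k) Dd)))
            (≈w-sym (≈w-step (subst (HStep M′ []) (Listₚ.++-identityʳ _) (face [] [] (c d) k (trans (φ′-iter (suc k) d) (cong c per)))))) }

      trivial : ∀ {xs ys} → Closed xs → All (λ d → D d ⊎ D (α d)) xs → map moved xs ≡ ys → Contractible M′ ys
      trivial {xs} cl i eq = subst (Contractible M′) (trans (prod-map xs) eq) (disc-trivial isMap filled wordGroup letter rep cl i)

    right-disc : ∀ {xs} → Closed xs → (∀ {d} → d ∈ xs → D d) → Contractible M′ (map c xs)
    right-disc cl i = trivial cl (All.tabulate (inj₁ ∘ i)) (Listₚ.map-cong-local (All.tabulate (moved-in ∘ i)))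

    -- Here only the reversals of the border darts lie in `D`. They are not on γ, so the loop itself
    -- is not shifted.
    left-disc : ∀ {xs} → Closed xs → (∀ {d} → d ∈ xs → D (α d) × ¬ D d × α d ∉ γ) → Contractible M′ xs
    left-disc {xs} cl i = trivial cl (All.tabulate (inj₂ ∘ proj₁ ∘ i))
      (Listₚ.map-id-local (All.tabulate (λ {x} x∈ → let (_ , ¬D , αx∉) = i x∈ in trans (moved-out ¬D) (trans (cong α (fix αx∉)) (α-invol x)))))

  -- A disc on the right of γ is shifted as a whole, and one on its left stays in place. `δ` stands
  -- for γ read from another dart: for the rotation back, it is the image `map c γ`, which is
  -- thereby seen to be noncontractible.
  γ-contractible : ∀ {x} → x ∈ γ → ∀ {δ} → SimpleLoop δ → (∀ {d} → d ∈ γ → d ∈ δ) → (∀ {d} → d ∈ δ → d ∈ γ) →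
                   Contractible M δ → Contractible M′ γ
  γ-contractible {x₀} x₀∈ {δ} lδ to from cδ = case classify isMap lδ (λ { refl → case to x₀∈ of λ () }) of λ where
      (inj₁ ¬c) → ⊥-elim (¬c cδ)
      (inj₂ (inj₁ (b , refl))) → ⊥-elim (no-return (from (here refl)) (from (there (here refl))))
      (inj₂ (inj₂ (inj₁ bd))) → let open BoundsDisc bd in
        subst (Contractible M′) (trans (sym (Listₚ.map-∘ γ)) (trans (Listₚ.map-cong cc⁻ γ) (Listₚ.map-id γ)))
          (Transfer.right-disc D? D-φ
            (λ Dd Dαd → (λ d∈ → out (to d∈) Dαd) , λ αd∈ → out (to αd∈) (subst D (sym (α-invol _)) Dd)) filled
            (closed-map c⁻ (joined ∘ shift-next⁻)) (λ d∈ → let (x , x∈ , eq) = ∈ₚ.∈-map⁻ c⁻ d∈ in subst D (sym eq) (border (to (stays⁻ x∈)))))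
      (inj₂ (inj₂ (inj₂ bd))) → let open BoundsDisc bd in
        Transfer.left-disc D? D-φ
          (λ Dd Dαd → (λ d∈ → out (reversal-∈ (to d∈)) (subst D (sym (α-invol _)) Dd)) , λ αd∈ → out (reversal-∈ (to αd∈)) (subst D (sym (α-invol _)) Dαd)) filled
          closed (λ d∈ → border (reversal-∈ (to d∈)) , (λ Dd → out (reversal-∈ (to d∈)) (subst D (sym (α-invol _)) Dd)) , no-return d∈)

  -- By `misses`, the disc bounded by β contains no face on the left of γ, so no edge of γ lies in
  -- its interior and `Transfer` applies. If the disc is on the left of β, the same fact keeps β off
  -- γ, and the shift fixes β.
  transfer : ∀ {x} → x ∈ γ → ¬ Contractible M γ → ∀ {β} → SimpleLoop β → β ≢ [] →
             (∀ {d} → d ∈ β → α d ∉ γ) → (∀ {y d} → y ∈ γ → Left y d → d ∉ β × α d ∉ β) →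
             Contractible M β → Contractible M′ (map c β)
  transfer {x₀} x₀∈ ¬cγ {β} lβ ne forward offLeft cβ = case classify isMap lβ ne of λ where
      (inj₁ ¬c) → ⊥-elim (¬c cβ)
      (inj₂ (inj₁ (b , refl))) →
        let b∉ : b ∉ γ
            b∉ = λ b∈ → forward (there (here refl)) (subst (_∈ γ) (sym (α-invol b)) b∈)
        in subst (Contractible M′) (cong₂ (λ x y → x ∷ y ∷ []) (sym (fix b∉)) (sym (fix (forward (here refl)))))
             (Words.≈w-sym M′ α-invol (Words.≈w-step M′ α-invol (back [] [] b)))
      (inj₂ (inj₂ (inj₁ bd))) → let open BoundsDisc bd in
        Transfer.right-disc D? D-φ (avoid bd offLeft) filled (SimpleLoop.closed lβ) border
      (inj₂ (inj₂ (inj₂ bd))) →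
        let open BoundsDisc bd
            offLeft′ = λ {y} {d} y∈ a → (λ d∈ → proj₂ (offLeft {y} {d} y∈ a) (reversal-∈⁻ d∈)) ,
                                       (λ αd∈ → proj₁ (offLeft y∈ a) (subst (_∈ β) (α-invol d) (reversal-∈⁻ αd∈)))
            b∉γ : ∀ {b} → b ∈ β → b ∉ γ
            b∉γ = λ b∈ b∈γ → misses bd offLeft′ b∈γ (border (reversal-∈ b∈))
        in subst (Contractible M′) (sym (Listₚ.map-id-local (All.tabulate (fix ∘ b∉γ))))
             (Transfer.left-disc D? D-φ (avoid bd offLeft′) filled (SimpleLoop.closed lβ)
               λ b∈ → border (reversal-∈ b∈) , (λ Db → out (reversal-∈ b∈) (subst D (sym (α-invol _)) Db)) , forward b∈)
    where
    module _ {δ : List (Fin n)} (bd : BoundsDisc isMap δ) (offLeft : ∀ {y d} → y ∈ γ → Left y d → d ∉ δ × α d ∉ δ) where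
      open BoundsDisc bd

      -- A disc touching the left side of γ would contain all of γ.
      misses : ∀ {y} → y ∈ γ → ¬ D (α y)
      misses y∈ Dαy = ¬cγ (disc-contractible isMap filled closed (All.tabulate λ x∈ → inj₂ (all x∈)))
        where
        backwards : ∀ {y x} → CycNext (reverse γ) y x → D (α y) → D (α x)
        backwards {y} {x} nx Dαy = arc-through D y~x (subst D (cong σ (α-invol y)) (D-φ Dαy))
            λ w a Dw → subst D (cong σ (α-invol w)) (D-φ (D-α Dw (proj₁ (offLeft y∈′ (left a)))))
          where
          nx′ : CycNext γ x y
          nx′ = subst (λ δ → CycNext δ x y) (Listₚ.reverse-involutive γ) (cycNext-reverse nx)
          y∈′ = cycNext-∈ʳ nx′
          y~x : SameV M y (α x)
          y~x = ~sym (joined nx′)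
          left : ∀ {w} → Arc σ y (α x) w → Left y w
          left {w} = subst (λ z → Arc σ y (α z) w) (sym (cycBwd-next unique nx′))
        all : ∀ {x} → x ∈ γ → D (α x)
        all x∈ = cyc-induct (D ∘ α) backwards (Anyₚ.reverse⁺ y∈) Dαy (Anyₚ.reverse⁺ x∈)

      avoid : ∀ {d} → D d → D (α d) → d ∉ γ × α d ∉ γ
      avoid Dd Dαd = (λ d∈ → misses d∈ Dαd) , λ αd∈ → misses αd∈ (subst D (sym (α-invol _)) Dd)

-- Uniqueness of the rightmost loop after a rotation

lastOf-map : ∀ {A B : Set} (f : A → B) x xs → lastOf (f x) (map f xs) ≡ f (lastOf x xs)
lastOf-map f x []       = refl
lastOf-map f x (y ∷ ys) = lastOf-map f y ys

lastOf-snoc : ∀ {A : Set} (x : A) xs {y} → lastOf x (xs ++ [ y ]) ≡ y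
lastOf-snoc x []       = refl
lastOf-snoc x (z ∷ xs) = lastOf-snoc z xs

lastOf-∈ : ∀ {A : Set} (x : A) xs → lastOf x xs ∈ x ∷ xs
lastOf-∈ x []       = here refl
lastOf-∈ x (y ∷ ys) = there (lastOf-∈ y ys)

++-position : ∀ {A : Set} (p : List A) {γ} q {z r} → p ++ γ ≡ q ++ z ∷ r →
              (∃ λ p₂ → p ≡ q ++ z ∷ p₂ × r ≡ p₂ ++ γ) ⊎ (∃ λ γₐ → q ≡ p ++ γₐ × γ ≡ γₐ ++ z ∷ r)
++-position []      q       eq = inj₂ (q , refl , eq)
++-position (x ∷ p) []      eq with refl ← Listₚ.∷-injectiveˡ eq = inj₁ (p , refl , sym (Listₚ.∷-injectiveʳ eq))
++-position (x ∷ p) (y ∷ q) eq with refl ← Listₚ.∷-injectiveˡ eq with ++-position p q (Listₚ.∷-injectiveʳ eq)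
... | inj₁ (p₂ , e , e′) = inj₁ (p₂ , cong (x ∷_) e , e′)
... | inj₂ (γₐ , e , e′) = inj₂ (γₐ , cong (x ∷_) e , e′)

unique-split : ∀ {A : Set} (as : List A) {x bs} cs {ds} → AllPairs _≢_ (as ++ x ∷ bs) → as ++ x ∷ bs ≡ cs ++ x ∷ ds → as ≡ cs × bs ≡ ds
unique-split []       []       u eq = refl , Listₚ.∷-injectiveʳ eq
unique-split []       (c ∷ cs) (ne ∷ _) eq with refl ← Listₚ.∷-injectiveˡ eq =
  ⊥-elim (All.lookup ne (subst (_ ∈_) (sym (Listₚ.∷-injectiveʳ eq)) (∈ₚ.∈-++⁺ʳ cs (here refl))) refl)
unique-split (a ∷ as) []       (ne ∷ _) eq with refl ← Listₚ.∷-injectiveˡ eq = ⊥-elim (All.lookup ne (∈ₚ.∈-++⁺ʳ as (here refl)) refl)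
unique-split (a ∷ as) (c ∷ cs) (_ ∷ u) eq with refl ← Listₚ.∷-injectiveˡ eq with unique-split as cs u (Listₚ.∷-injectiveʳ eq)
... | e , e′ = cong (a ∷_) e , e′

map-split : ∀ {A B : Set} (f : A → B) xs q {z r} → map f xs ≡ q ++ z ∷ r →
            ∃₂ λ q₀ z₀ → ∃ λ r₀ → xs ≡ q₀ ++ z₀ ∷ r₀ × q ≡ map f q₀ × z ≡ f z₀
map-split f (x ∷ xs) []      eq = [] , x , xs , refl , refl , sym (Listₚ.∷-injectiveˡ eq)
map-split f (x ∷ xs) (y ∷ q) eq with map-split f xs q (Listₚ.∷-injectiveʳ eq)
... | q₀ , z₀ , r₀ , e₁ , e₂ , e₃ = x ∷ q₀ , z₀ , r₀ , cong (x ∷_) e₁ , cong₂ _∷_ (sym (Listₚ.∷-injectiveˡ eq)) e₂ , e₃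

data Compare {A : Set} (xs ys : List A) : Set where
  same    : xs ≡ ys → Compare xs ys
  longer  : ∀ z r → xs ≡ ys ++ z ∷ r → Compare xs ys
  shorter : ∀ z r → ys ≡ xs ++ z ∷ r → Compare xs ys
  diverge : ∀ q x z r s → x ≢ z → xs ≡ q ++ x ∷ r → ys ≡ q ++ z ∷ s → Compare xs ys

compare : ∀ {n} (xs ys : List (Fin n)) → Compare xs ys
compare []       []       = same refl
compare []       (y ∷ ys) = shorter y ys refl
compare (x ∷ xs) []       = longer x xs refl
compare (x ∷ xs) (y ∷ ys) with x ≟F y
... | no ne = diverge [] x y xs ys ne refl refl
... | yes refl with compare xs ys
...   | same eq                    = same (cong (x ∷_) eq)
...   | longer z r eq              = longer z r (cong (x ∷_) eq)
...   | shorter z r eq             = shorter z r (cong (x ∷_) eq)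
...   | diverge q a b r s ne e₁ e₂ = diverge (x ∷ q) a b r s ne (cong (x ∷_) e₁) (cong (x ∷_) e₂)

first-hit : ∀ {A : Set} {P : A → Set} → (∀ x → Dec (P x)) → ∀ xs → ∃₂ λ us rest → xs ≡ us ++ rest × All (¬_ ∘ P) us ×
            (rest ≡ [] ⊎ ∃₂ λ s rest′ → rest ≡ s ∷ rest′ × P s)
first-hit P? [] = [] , [] , refl , [] , inj₁ refl
first-hit P? (x ∷ xs) with P? x
... | yes px = [] , x ∷ xs , refl , [] , inj₂ (x , xs , refl , px)
... | no ¬px = let (us , rest , eq , all , end) = first-hit P? xs in x ∷ us , rest , cong (x ∷_) eq , ¬px ∷ all , end

module Steps {n r : ℕ} {M : Map n r} (isMap : IsMap M) (x₀ : Fin n) (x₀-root : Map.σ M (Map.α M x₀) ≡ Map.root M) where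
  open Map M using (σ; α; root)
  open IsMap isMap
  open Paths M isMap
  open Explore isMap

  -- `x₀` serves as a predecessor of the first dart: the root comes right after its reversal, so
  -- that the first choice of the exploration is a turn like all others.
  from : List (Fin n) → Fin n
  from q = α (lastOf x₀ q)

  path-from : ∀ {w e} → Path root w e → Path (α x₀) w e
  path-from {w} = path-start w (subst (SameV M (α x₀)) x₀-root ~step)

  path-at : ∀ {x} q {z r e} → Path (α x) (q ++ z ∷ r) e → SameV M (α (lastOf x q)) z
  path-at []      (s , _) = s
  path-at (y ∷ q) (_ , p) = path-at q p

  greedy-step : ∀ {w} → Greedy M w → ∀ q {z r} → w ≡ q ++ z ∷ r → ∃ λ j → z ≡ iter σ (suc j) (from q) ×
                (∀ i → i < j → ¬ Pref M (q ++ [ iter σ (suc i) (from q) ]))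
  greedy-step (_ , _ , start , turns) q {z} {r} eq with unsnoc q
  ... | inj₁ refl = let (j , e , h) = start z r eq in
        j , trans e (shift j) , λ i i<j → subst (λ y → ¬ Pref M [ y ]) (shift i) (h i i<j)
    where
    shift : ∀ j → iter σ j root ≡ iter σ (suc j) (α x₀)
    shift j = trans (cong (iter σ j) (sym x₀-root)) (iter-comm σ j)
  ... | inj₂ (a , y , refl) = let (j , e , h) = turns a y z r (trans eq (Listₚ.++-assoc a [ y ] (z ∷ r))) in
        j , trans e (at j) , λ i i<j → subst (λ w → ¬ Pref M w) (trans (cong (λ v → a ++ y ∷ v ∷ []) (at i)) (sym (Listₚ.++-assoc a [ y ] _))) (h i i<j)
    where
    at : ∀ j → iter σ (suc j) (α y) ≡ iter σ (suc j) (from (a ++ [ y ]))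
    at j = cong (λ v → iter σ (suc j) (α v)) (sym (lastOf-snoc x₀ a))

  greedy-before : ∀ {w} → Greedy M w → ∀ q {z r} → w ≡ q ++ z ∷ r → ∀ {x} → Arc σ (from q) z x → ¬ Pref M (q ++ [ x ])
  greedy-before gr q eq a with greedy-step gr q eq | arc-iter a
  ... | j , z≡ , h | m , refl , before with m ℕ.<? j
  ...   | yes m<j = h m m<j
  ...   | no m≮j  = ⊥-elim (before j (ℕₚ.≮⇒≥ m≮j) (sym z≡))

  -- Turning as far as `z` would have offered an admissible dart before `x`, so the turn to `x` does
  -- not pass `z`.
  greedy-first : ∀ {w} → Greedy M w → ∀ q {x r} → w ≡ q ++ x ∷ r → ∀ {z} → x ≢ z → Pref M (q ++ [ z ]) → Arc σ (from q) z x
  greedy-first gr q {x} eq {z} ne pz with greedy-step gr q eq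
  ... | j , refl , h = iter-arc j λ i i≤j eq′ → case ℕₚ.m≤n⇒m<n∨m≡n i≤j of λ where
        (inj₁ i<j)  → h i i<j (subst (λ y → Pref M (q ++ [ y ])) (sym eq′) pz)
        (inj₂ refl) → ne eq′

  path-ends : ∀ {d} xs {e f} → Path d xs e → Path d xs f → SameV M e f
  path-ends []       p q = ~trans (~sym p) q
  path-ends (x ∷ xs) (_ , p) (_ , q) = path-ends xs p q

  lasso-split : ∀ {p γ} (la : Lasso p γ) as y bs → p ++ γ ≡ as ++ y ∷ bs → SameV M y (Lasso.origin la) → γ ≡ y ∷ bs
  lasso-split {p} la@(lasso o rest refl path apart _) as y bs eq s
    with distinct-≡ apart (subst (y ∈_) (sym eq) (∈ₚ.∈-++⁺ʳ as (here refl))) (∈ₚ.∈-++⁺ʳ p (here refl)) s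
  ... | refl = cong (o ∷_) (proj₂ (unique-split p as (distinct-unique apart) eq))

  lasso-unique : ∀ {p γ p′ γ′} → Lasso p γ → Lasso p′ γ′ → p ++ γ ≡ p′ ++ γ′ → γ ≡ γ′
  lasso-unique {p′ = p′} la (lasso o rest refl path apart _) eq =
    lasso-split la p′ o rest eq (path-ends (p′ ++ o ∷ rest) path (subst (λ w → Path root w (Lasso.origin la)) eq (Lasso.path la)))

  -- An element of `S` ends at a vertex that it has visited before, so every continuation repeats a
  -- tail.
  inS-maximal : ∀ {w z r} → InS M w → ¬ InS M (w ++ z ∷ r)
  inS-maximal {z = z} {r} (p , γ , refl , sp) s with toLasso sp
  ... | lasso o rest refl path apart _ =
    allPairs-++-cross (p ++ o ∷ rest) (inS-distinct s) (∈ₚ.∈-++⁺ʳ p (here refl)) (here refl)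
      (path-ends (p ++ o ∷ rest) path (proj₁ (path-split (p ++ o ∷ rest) (Lasso.path (toLasso (proj₂ (proj₂ (proj₂ s)))) ▹ sym (proj₁ (proj₂ (proj₂ s)))))))
    where
    _▹_ : ∀ {w w′ e} → Path root w e → w ≡ w′ → Path root w′ e
    p ▹ refl = p

-- The rightmost lasso and its detours

module Rightmost {n r : ℕ} {M : Map n r} (isMap : IsMap M) {p γ : List (Fin n)}
  (la : Explore.Lasso isMap p γ) (gr : Greedy M (p ++ γ)) where
  open Map M using (σ; α; root; lab)
  open IsMap isMap
  open Paths M isMap
  open Explore isMap
  open Lasso la public
  open Arcs σ σ-inj

  no-return : ∀ {x} → x ∈ γ → α x ∉ γ
  no-return x∈ αx∈ with backtrack isMap simple x∈ αx∈
  ... | b , refl = essential (Words.≈w-sym M α-invol (Words.≈w-step M α-invol (back [] [] b)))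

  open SimpleLoop simple
  open LoopSides isMap simple no-return

  x₀ : Fin n
  x₀ = α (proj₁ (inverse root))

  x₀-root : σ (α x₀) ≡ root
  x₀-root = trans (cong σ (α-invol _)) (proj₂ (inverse root))

  open Steps isMap x₀ x₀-root public

  origin∈ : origin ∈ γ
  origin∈ = subst (origin ∈_) (sym γ≡) (here refl)

  off-p : ∀ {d} → d ∈ p → Off d
  off-p d∈ (y , y∈ , s) = allPairs-++-cross p apart d∈ y∈ (~sym s)

  from-~ : ∀ q {z r} → p ++ γ ≡ q ++ z ∷ r → SameV M (from q) z
  from-~ q eq = path-at q (subst (λ w → Path (α x₀) w origin) eq (path-from path))

  private
    reversal-on : ∀ {d} → d ∈ reversal γ → On d
    reversal-on {d} d∈ = let (y , nx) = cycNext-from (reversal-∈⁻ d∈) in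
      y , cycNext-∈ʳ nx , ~sym (subst (λ z → SameV M z y) (α-invol d) (joined nx))

    reversal-head : ∃ λ rest → reversal γ ≡ α (prev origin) ∷ rest
    reversal-head with unsnoc γ
    ... | inj₁ eq = ⊥-elim (case subst (origin ∈_) eq origin∈ of λ ())
    ... | inj₂ (as , x , eq) = reversal as , trans (cong reversal eq) (trans (cong reverse (Listₚ.map-++ α as [ x ])) (trans (Listₚ.reverse-++ (map α as) [ α x ])
                                 (cong (λ z → α z ∷ reversal as) (sym (cycBwd-next unique (inj₂ (as , rest , eq , γ≡)))))))

    pref-reversal : Pref M (p ++ [ α (prev origin) ])
    pref-reversal with reversal-head
    ... | rest′ , eq = rest′ , p , α (prev origin) ∷ rest′ , Listₚ.++-assoc p [ _ ] rest′ , fromLasso (lasso (α (prev origin)) rest′ refl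
          (subst (λ w → Path root (p ++ w) (α (prev origin))) eq
            (path-++ p (proj₁ split) (path-end (reversal γ) (~sym (arrival origin∈)) (path-reversal γ (subst (λ w → Path origin w origin) (sym γ≡) (proj₂ split))))))
          (subst (λ w → AllPairs (DistinctV M) (p ++ w)) eq (AllPairsₚ.++⁺ (allPairs-++ˡ p apart) (SimpleLoop.distinct (loop-reversal simple))
            (All.tabulate λ d∈ → All.tabulate λ w∈ s → let (y , y∈ , t) = reversal-on w∈ in off-p d∈ (y , y∈ , ~trans t (~sym s)))))
          (subst (λ w → ¬ Contractible M w) eq λ cr → essential (subst (Contractible M) (Words.reversal² M α-invol γ) (Words.contractible-reversal M α-invol cr))))
      where
      split = path-split p (subst (λ w → Path root (p ++ w) origin) γ≡ path)

    left-step : ∀ {y} → Left origin y → σ y ≢ origin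
    left-step {y} a eq with σ y ≟F α (prev origin)
    ... | yes eq′ = y≢arrival origin∈ (trans (sym eq) eq′)
    ... | no ne   = arc≢start (~sym (arrival origin∈)) (next a ne) eq

    -- Otherwise p followed by the reversed loop would be explored first.
    no-turn : ¬ Arc σ (from p) origin (α (prev origin))
    no-turn a = greedy-before gr p (cong (p ++_) γ≡) a pref-reversal

  -- A turn that starts on the left of γ meets `α (prev origin)` before `origin`, which `no-turn`
  -- excludes.
  end-not-left : ∀ p′ {a} → p ≡ p′ ++ [ a ] → ∀ {y} → y ∈ γ → ¬ Left y (α a)
  end-not-left p′ {a} refl {y} y∈ b with tail-inj y∈ origin∈ (~trans (left-~ b) (subst (λ v → SameV M (α v) origin) (lastOf-snoc x₀ p′) (from-~ p (cong (p ++_) γ≡))))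
  ... | refl with arc-onwards (λ w → w ≡ α a ⊎ Arc σ (α a) origin w) (~sym (arrival origin∈)) b (inj₁ refl)
                    (λ { w lw (inj₁ refl) → inj₂ (first (left-step lw)) ; w lw (inj₂ aw) → inj₂ (next aw (left-step lw)) })
  ...   | inj₁ eq = arc≢end b (sym eq)
  ...   | inj₂ t  = no-turn (subst (λ v → Arc σ (α v) origin (α (prev origin))) (sym (lastOf-snoc x₀ p′)) t)

  -- Inside γ the turn starts at the reversed predecessor of `z`, so it sweeps the right sector. At
  -- the origin it starts at the end of `p`, and `no-turn` keeps it from sweeping any part of the
  -- left sector.
  sector-right : ∀ q {z r} → p ++ γ ≡ q ++ z ∷ r → z ∈ γ → ∀ {w} → Arc σ (from q) z w → Right z w
  sector-right q {z} {r} eq z∈ {w} a with ++-position p q eq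
  ... | inj₁ (p₂ , e , _) = ⊥-elim (off-p (subst (z ∈_) (sym e) (∈ₚ.∈-++⁺ʳ q (here refl))) (z , z∈ , ~refl))
  ... | inj₂ (γₐ , e , e′) with unsnoc γₐ
  ...   | inj₂ (b , y , refl) = subst (λ v → Arc σ (α v) z w)
            (trans (cong (lastOf x₀) (trans e (sym (Listₚ.++-assoc p b [ y ])))) (trans (lastOf-snoc x₀ (p ++ b))
              (sym (cycBwd-next unique (inj₁ (b , r , trans e′ (Listₚ.++-assoc b [ y ] (z ∷ r)))))))) a
  ...   | inj₁ refl with Listₚ.∷-injectiveˡ (trans (sym γ≡) e′) | trans e (Listₚ.++-identityʳ p)
  ...     | refl | refl with sides origin∈ (~trans (~sym (from-~ p (cong (p ++_) γ≡))) (arc-~ a))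
  ...       | inj₁ eq′ = ⊥-elim (arc≢end a eq′)
  ...       | inj₂ (inj₁ refl) = ⊥-elim (no-turn a)
  ...       | inj₂ (inj₂ (inj₂ c)) = c
  ...       | inj₂ (inj₂ (inj₁ b)) = ⊥-elim (no-turn (arc-onwards (Arc σ (from p) origin) (~sym (arrival origin∈)) b a
                (λ w lw aw → next aw (left-step lw))))

  sector-~ : ∀ q {z r} → p ++ γ ≡ q ++ z ∷ r → ∀ {w} → Arc σ (from q) z w → SameV M z w
  sector-~ q eq a = ~trans (~sym (from-~ q eq)) (arc-~ a)

  z-cases : ∀ q {z r} → p ++ γ ≡ q ++ z ∷ r → z ∈ p ⊎ z ∈ γ
  z-cases q eq = ∈ₚ.∈-++⁻ p (subst (_ ∈_) (sym eq) (∈ₚ.∈-++⁺ʳ q (here refl)))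

  sector : ∀ q {z r} → p ++ γ ≡ q ++ z ∷ r → ∀ {w} → Arc σ (from q) z w → w ∉ γ × α w ∉ γ
  sector q eq a with z-cases q eq
  ... | inj₁ z∈p = off-free λ (y , y∈ , s) → off-p z∈p (y , y∈ , ~trans s (~sym (sector-~ q eq a)))
  ... | inj₂ z∈γ = right-free z∈γ (sector-right q eq z∈γ a)

  On℘ : Fin n → Set
  On℘ d = ∃ λ y → y ∈ p ++ γ × SameV M y d

  on℘? : ∀ d → Dec (On℘ d)
  on℘? d = map′ (λ a → let (y , y∈ , s) = find a in y , y∈ , s) (λ (y , y∈ , s) → lose y∈ s) (Any.any? (_~? d) (p ++ γ))

  off℘-off : ∀ {d} → ¬ On℘ d → Off d
  off℘-off off (y , y∈ , s) = off (y , ∈ₚ.∈-++⁺ʳ p y∈ , s)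

  -- A path leaving p ++ γ to its right just before z.
  module Detour (q : List (Fin n)) {z : Fin n} {r : List (Fin n)} (eq : p ++ γ ≡ q ++ z ∷ r) {x : Fin n} (arc : Arc σ (from q) z x)
    (u : List (Fin n)) (off-u : All (¬_ ∘ On℘) u) (apart-u : AllPairs (DistinctV M) u) {ē : Fin n} (path-u : Path (α x) u ē) where

    z~x : SameV M z x
    z~x = sector-~ q eq arc

    x-on : On℘ x
    x-on = z , subst (z ∈_) (sym eq) (∈ₚ.∈-++⁺ʳ q (here refl)) , z~x

    ℘-apart : AllPairs (DistinctV M) (q ++ z ∷ r)
    ℘-apart = subst (AllPairs (DistinctV M)) eq apart

    q∈℘ : ∀ {d} → d ∈ q → d ∈ p ++ γ
    q∈℘ d∈ = subst (_ ∈_) (sym eq) (∈ₚ.∈-++⁺ˡ d∈)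

    r∈℘ : ∀ {d} → d ∈ r → d ∈ p ++ γ
    r∈℘ d∈ = subst (_ ∈_) (sym eq) (∈ₚ.∈-++⁺ʳ q (there d∈))

    detour : List (Fin n)
    detour = q ++ x ∷ u

    detour-path : Path root detour ē
    detour-path = path-++ q (proj₁ (path-split q (subst (λ w → Path root w origin) eq path))) (z~x , path-u)

    detour-apart : AllPairs (DistinctV M) detour
    detour-apart = AllPairsₚ.++⁺ (allPairs-++ˡ q ℘-apart)
      (All.tabulate (λ d∈ s → All.lookup off-u d∈ (let (y , y∈ , t) = x-on in y , y∈ , ~trans t s)) ∷ apart-u)
      (All.tabulate λ {d} d∈ → (λ s → allPairs-++-cross q ℘-apart d∈ (here refl) (~trans s (~sym z~x))) ∷
         All.tabulate λ w∈ s → All.lookup off-u w∈ (d , q∈℘ d∈ , s))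

    avoids-r : ∀ {d w} → d ∈ detour → w ∈ r → DistinctV M d w
    avoids-r {d} {w} d∈ w∈ s with ∈ₚ.∈-++⁻ q d∈
    ... | inj₁ d∈q           = allPairs-++-cross q ℘-apart d∈q (there w∈) s
    ... | inj₂ (here refl)   = All.lookup (AllPairs.head (allPairs-++ʳ q ℘-apart)) w∈ (~trans z~x s)
    ... | inj₂ (there d∈u)   = All.lookup off-u d∈u (w , r∈℘ w∈ , ~sym s)

    not-pref : ∀ {v} → ¬ InS M ((q ++ x ∷ u) ++ v)
    not-pref {v} s = greedy-before gr q eq arc (u ++ v , subst (InS M) (trans (Listₚ.++-assoc q (x ∷ u) v) (sym (Listₚ.++-assoc q [ x ] (u ++ v)))) s)

    extend-apart : ∀ {ws} → AllPairs (DistinctV M) ws → (∀ {w} → w ∈ ws → ∃ λ v → v ∈ r × SameV M w v) → AllPairs (DistinctV M) (detour ++ ws)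
    extend-apart dis on-r = AllPairsₚ.++⁺ detour-apart dis (All.tabulate λ d∈ → All.tabulate λ w∈ s →
      let (v , v∈ , t) = on-r w∈ in avoids-r d∈ v∈ (~trans s t))

    -- An essential loop would complete the detour to an element of `S` through `x`, which the
    -- exploration meets before `z`.
    no-lasso : ∀ {ws} p° g gs → detour ++ ws ≡ p° ++ g ∷ gs → ∀ {e} → Path ē ws e → SameV M e g → AllPairs (DistinctV M) ws →
               (∀ {w} → w ∈ ws → ∃ λ v → v ∈ r × SameV M w v) → ¬ ¬ Contractible M (g ∷ gs)
    no-lasso {ws} p° g gs e pws s dis on-r ¬c = not-pref {ws} (p° , g ∷ gs , e , fromLasso (lasso g gs refl
      (subst (λ w → Path root w g) e (path-++ detour detour-path (path-end ws s pws))) (subst (AllPairs (DistinctV M)) e (extend-apart dis on-r)) ¬c))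

    returns : ∀ A y B → detour ≡ A ++ y ∷ B → SameV M ē y → ¬ ¬ Contractible M (y ∷ B)
    returns A y B e s = no-lasso {[]} A y B (trans (Listₚ.++-identityʳ detour) e) ~refl s [] (λ ())

    -- If the detour rejoins the stem, the rest of the stem and γ complete it to a forbidden lasso.
    -- If it leaves the stem and rejoins γ, then γ read from `y` does so.
    later : ∀ {y} → y ∈ r → ¬ SameV M y ē
    later {y} y∈ s with ++-position p q eq
    later {y} y∈ s | inj₁ (p₂ , e , e′) with ∈ₚ.∈-++⁻ p₂ (subst (y ∈_) e′ y∈)
    ... | inj₁ y∈p₂ with ∈ₚ.∈-∃++ y∈p₂
    ...   | p₃ , p₄ , refl = no-lasso {y ∷ p₄ ++ γ} (detour ++ y ∷ p₄) origin rest
              (trans (cong (λ w → detour ++ y ∷ p₄ ++ w) γ≡) (sym (Listₚ.++-assoc detour (y ∷ p₄) (origin ∷ rest))))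
              (path-start (y ∷ p₄ ++ γ) (~sym s) (proj₂ (path-split (q ++ z ∷ p₃) (subst (λ w → Path root w origin) whole path)))) ~refl
              (allPairs-++ʳ (q ++ z ∷ p₃) (subst (AllPairs (DistinctV M)) whole apart))
              (λ w∈ → _ , subst (_ ∈_) (sym (trans e′ (Listₚ.++-assoc p₃ (y ∷ p₄) γ))) (∈ₚ.∈-++⁺ʳ p₃ w∈) , ~refl) (subst (λ w → ¬ Contractible M w) γ≡ essential)
      where
      whole : p ++ γ ≡ (q ++ z ∷ p₃) ++ y ∷ p₄ ++ γ
      whole = trans (cong (_++ γ) (trans e (sym (Listₚ.++-assoc q (z ∷ p₃) (y ∷ p₄))))) (Listₚ.++-assoc (q ++ z ∷ p₃) (y ∷ p₄) γ)
    later {y} y∈ s | inj₁ (p₂ , e , e′) | inj₂ y∈γ with ∈ₚ.∈-∃++ y∈γ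
    ...   | γ₁ , γ₂ , refl = no-lasso {y ∷ γ₂ ++ γ₁} detour y (γ₂ ++ γ₁) refl
              (path-++ (y ∷ γ₂) (path-start (y ∷ γ₂) (~sym s) (proj₂ (path-split γ₁ loop-path))) (proj₁ (path-split γ₁ loop-path))) ~refl
              (SimpleLoop.distinct (loop-rotate γ₁ simple))
              (λ w∈ → _ , subst (_ ∈_) (sym e′) (∈ₚ.∈-++⁺ʳ p₂ (Perm↭ₚ.∈-resp-↭ (Perm↭ₚ.++-comm (y ∷ γ₂) γ₁) w∈)) , ~refl)
              λ c → essential (Words.contractible-rotate M α-invol (y ∷ γ₂) γ₁ c)
      where
      loop-path : Path origin (γ₁ ++ y ∷ γ₂) origin
      loop-path = subst (λ w → Path origin w origin) (sym γ≡) (proj₂ (path-split p (subst (λ w → Path root (p ++ w) origin) γ≡ path)))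
    later {y} y∈ s | inj₂ (γₐ , e , e′) with ∈ₚ.∈-∃++ y∈
    -- Both ends are on γ, so γ and the detour form a theta graph. Two of its three cycles are loops
    -- of lassos through `x`: γ with the skipped part replaced by the detour, and the detour closed
    -- by the reversed skipped part. If both are contractible, so is the third, which is γ.
    ... | γc , γd , refl = over λ c₁ → back-over λ c₂ → essential (subst (Contractible M) (sym e′) (combine c₁ c₂))
      where
      module W = Words M α-invol
      loop-path : Path origin (γₐ ++ z ∷ γc ++ y ∷ γd) origin
      loop-path = subst (λ w → Path origin w origin) (trans (sym γ≡) e′) (proj₂ (path-split p (subst (λ w → Path root (p ++ w) origin) γ≡ path)))
      tail-path : Path y (y ∷ γd) origin
      tail-path = proj₂ (path-split (z ∷ γc) (proj₂ (path-split γₐ loop-path)))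
      over-word : List (Fin n)
      over-word = γₐ ++ (x ∷ u) ++ y ∷ γd
      whole : detour ++ y ∷ γd ≡ p ++ over-word
      whole = trans (cong (λ w → (w ++ x ∷ u) ++ y ∷ γd) e) (trans (Listₚ.++-assoc (p ++ γₐ) (x ∷ u) (y ∷ γd)) (Listₚ.++-assoc p γₐ _))
      over-head : ∀ δ → γ ≡ δ ++ z ∷ γc ++ y ∷ γd → ∃₂ λ g gs → δ ++ (x ∷ u) ++ y ∷ γd ≡ g ∷ gs × SameV M origin g
      over-head []      e″ = x , u ++ y ∷ γd , refl , ~trans (~reflexive (Listₚ.∷-injectiveˡ (trans (sym γ≡) e″))) z~x
      over-head (g ∷ δ) e″ = g , δ ++ (x ∷ u) ++ y ∷ γd , refl , ~reflexive (Listₚ.∷-injectiveˡ (trans (sym γ≡) e″))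
      over : ¬ ¬ Contractible M over-word
      over with over-head γₐ e′
      ... | g , gs , e° , s° = subst (λ w → ¬ ¬ Contractible M w) (sym e°) (no-lasso {y ∷ γd} p g gs (trans whole (cong (p ++_) e°))
              (path-start (y ∷ γd) (~sym s) tail-path) s° (allPairs-++ʳ (z ∷ γc) (allPairs-++ʳ q ℘-apart)) (λ w∈ → _ , ∈ₚ.∈-++⁺ʳ γc w∈ , ~refl))
      skipped : List (Fin n)
      skipped = z ∷ γc
      skipped-path : Path z skipped y
      skipped-path = proj₁ (path-split skipped (proj₂ (path-split γₐ loop-path)))
      in-γ : ∀ {d} → d ∈ skipped → d ∈ γ
      in-γ d∈ = subst (_ ∈_) (sym e′) (∈ₚ.∈-++⁺ʳ γₐ (∈ₚ.∈-++⁺ˡ d∈))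
      ends-in-r : ∀ w ws {d} → Path w ws y → (∀ {v} → v ∈ ws → v ∈ γc ⊎ v ≡ z) → d ∈ ws →
                  (∀ as v bs → ws ≡ as ++ v ∷ bs → as ≢ [] → v ∈ γc) → ∃ λ v → v ∈ γc ++ y ∷ γd × SameV M (α d) v
      ends-in-r w (a ∷ []) (_ , s₁) h (here refl) tl = y , ∈ₚ.∈-++⁺ʳ γc (here refl) , s₁
      ends-in-r w (a ∷ b ∷ ws) (_ , s₁ , _) h (here refl) tl = b , ∈ₚ.∈-++⁺ˡ (tl (a ∷ []) b ws refl λ ()) , s₁
      ends-in-r w (a ∷ b ∷ ws) (_ , p₁) h (there d∈) tl = ends-in-r (α a) (b ∷ ws) p₁ (h ∘ there) d∈ λ as v bs e° _ → tl (a ∷ as) v bs (cong (a ∷_) e°) λ ()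
      reversed-on-r : ∀ {w} → w ∈ reversal skipped → ∃ λ v → v ∈ γc ++ y ∷ γd × SameV M w v
      reversed-on-r {w} w∈ = subst (λ d → ∃ λ v → v ∈ γc ++ y ∷ γd × SameV M d v) (α-invol w)
        (ends-in-r z skipped skipped-path (λ { (here e°) → inj₂ e° ; (there v∈) → inj₁ v∈ }) (reversal-∈⁻ w∈)
          λ { [] v bs _ ne → ⊥-elim (ne refl) ; (_ ∷ as) v bs refl _ → ∈ₚ.∈-++⁺ʳ as (here refl) })
      reversed-apart : AllPairs (DistinctV M) (reversal skipped)
      reversed-apart = allPairs-↭ distinct-sym (Perm↭.↭-sym (Perm↭ₚ.↭-reverse (map α skipped)))
        (AllPairsₚ.map⁺ (allPairs-from (allPairs-++ˡ skipped (allPairs-++ʳ γₐ (subst (AllPairs _≢_) e′ unique)))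
          λ a∈ b∈ ne s₁ → ne (head-inj (in-γ a∈) (in-γ b∈) s₁)))
      back-over : ¬ ¬ Contractible M ((x ∷ u) ++ reversal skipped)
      back-over = no-lasso {reversal skipped} q x (u ++ reversal skipped) (Listₚ.++-assoc q (x ∷ u) (reversal skipped))
        (path-start (reversal skipped) (~sym s) (path-reversal skipped skipped-path)) z~x reversed-apart reversed-on-r
      combine : Contractible M over-word → Contractible M ((x ∷ u) ++ reversal skipped) → Contractible M (γₐ ++ z ∷ γc ++ y ∷ γd)
      combine c₁ c₂ = W.≈w-trans (W.++-congˡ γₐ (W.++-congʳ (y ∷ γd) (W.≈w-sym same-word))) c₁
        where
        same-word : (x ∷ u) W.≈w skipped
        same-word = W.≈w-trans (subst (W._≈w ((x ∷ u) ++ reversal skipped ++ skipped)) (Listₚ.++-identityʳ (x ∷ u)) (W.++-congˡ (x ∷ u) (W.≈w-sym (W.reversal-inverseˡ skipped))))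
          (subst (W._≈w skipped) (Listₚ.++-assoc (x ∷ u) (reversal skipped) skipped) (W.++-congʳ skipped c₂))

-- The rightmost lasso after the rotation

module Turned {n r : ℕ} {M : Map n r} (isMap : IsMap M) {p γ : List (Fin n)}
  (la : Explore.Lasso isMap p γ) (gr : Greedy M (p ++ γ)) {c c⁻ : Fin n → Fin n} (shift : Shift γ c c⁻)
  (σ′ : Fin n → Fin n) (root′ : Fin n) (lab′ : Fin n → Fin r)
  (σ′≡ : ∀ d → σ′ d ≡ c (Map.σ M (Map.α M (c⁻ (Map.α M d))))) (root′≡ : root′ ≡ c (Map.root M))
  (lab′≡ : ∀ d → lab′ d ≡ Map.lab M (c⁻ d)) where
  open Map M using (σ; α; root; lab)
  open IsMap isMap
  open Paths M isMap
  open Explore isMap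
  open Rightmost isMap la gr
  open SimpleLoop simple
  open LoopSides isMap simple no-return
  open Shift shift
  open Rotate isMap simple no-return shift σ′ root′ lab′ σ′≡ root′≡ lab′≡ public

  module Back = Rotate isMap′ loop′ no-return (shift-inverse shift) σ root lab
    (λ d → trans (sym (c⁻c (σ d))) (cong c⁻ (sym (trans (σ′-c (α d)) (cong (c ∘ σ) (α-invol d))))))
    (trans (sym (c⁻c root)) (cong c⁻ (sym root′≡)))
    (λ d → trans (cong lab (sym (c⁻c d))) (sym (lab′≡ (c d))))

  module E′ = Explore isMap′
  module S′ = Steps isMap′ (c x₀) (trans (σ′-c x₀) (trans (cong c x₀-root) (sym root′≡)))

  private
    module P′ = Perm σ′ σ′-inj

    fix-p : ∀ {d} → d ∈ p → c d ≡ d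
    fix-p d∈ = fix (proj₁ (off-free (off-p d∈)))

    -- The sector swept before `z` contains no edge of γ, so the same turn is made in `M′`.
    step′ : ∀ q {z r} → p ++ γ ≡ q ++ z ∷ r → SameV′ (α (c (lastOf x₀ q))) (c z)
    step′ q {z} eq = Turn.end-same {from q} {_} {z} (σ′-c (lastOf x₀ q)) (sector q eq) (from-~ q eq)

    path′ : ∀ q z r → p ++ γ ≡ q ++ z ∷ r → Q′.Path (α (c (lastOf x₀ q))) (map c (z ∷ r)) (c origin)
    path′ q z [] eq = step′ q eq , close (++-position p q eq)
      where
      close : (∃ λ p₂ → p ≡ q ++ z ∷ p₂ × [] ≡ p₂ ++ γ) ⊎ (∃ λ γₐ → q ≡ p ++ γₐ × γ ≡ γₐ ++ z ∷ []) → SameV′ (α (c z)) (c origin)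
      close (inj₁ (p₂ , _ , e)) = ⊥-elim (case subst (origin ∈_) (Listₚ.++-conicalʳ p₂ γ (sym e)) origin∈ of λ ())
      close (inj₂ (γₐ , _ , e)) = joined′ (shift-next (inj₂ (γₐ , rest , e , γ≡)))
    path′ q z (w ∷ r) eq = step′ q eq , subst (λ v → Q′.Path (α (c v)) (map c (w ∷ r)) (c origin)) (lastOf-snoc x₀ q)
                                          (path′ (q ++ [ z ]) w r (trans eq (sym (Listₚ.++-assoc q [ z ] (w ∷ r)))))

    root-path′ : ∀ w → p ++ γ ≡ w → Q′.Path root′ (map c w) (c origin)
    root-path′ []      eq = ⊥-elim (case subst (origin ∈_) (Listₚ.++-conicalʳ p γ eq) origin∈ of λ ())
    root-path′ (z ∷ r) eq = Q′.path-start (map c (z ∷ r)) (subst (λ v → SameV′ v (α (c x₀))) (trans (σ′-c x₀) (trans (cong c x₀-root) (sym root′≡))) (P′.~sym P′.~step)) (path′ [] z r eq)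

    γ-image : ∀ {d} → d ∈ map c γ → d ∈ γ
    γ-image d∈ = let (x , x∈ , eq) = ∈ₚ.∈-map⁻ c d∈ in subst (_∈ γ) (sym eq) (stays x∈)

    γ-preimage : ∀ {d} → d ∈ γ → d ∈ map c γ
    γ-preimage {d} d∈ = subst (_∈ map c γ) (cc⁻ d) (∈ₚ.∈-map⁺ c (stays⁻ d∈))

    image-loop : Q′.SimpleLoop (map c γ)
    image-loop = record { closed = Q′.closed-map c (joined′ ∘ shift-next)
                        ; distinct = AllPairsₚ.map⁺ (allPairs-from unique λ x∈ y∈ ne s → ne (c-inj (tail-inj′ (stays x∈) (stays y∈) s))) }

  image-essential : ¬ Contractible M′ (map c γ)
  image-essential = essential ∘ Back.γ-contractible origin∈ image-loop γ-preimage γ-image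

  image-lasso : E′.Lasso (map c p) (map c γ)
  image-lasso = E′.lasso (c origin) (map c rest) (cong (map c) γ≡)
    (subst (λ w → Q′.Path root′ w (c origin)) (Listₚ.map-++ c p γ) (root-path′ (p ++ γ) refl))
    (subst (λ w → AllPairs (DistinctV M′) (w ++ map c γ)) (sym (Listₚ.map-id-local (All.tabulate fix-p)))
      (AllPairsₚ.++⁺ (allPairs-from (distinct-unique (allPairs-++ˡ p apart)) (λ x∈ y∈ ne s → ne (distinct-≡ (allPairs-++ˡ p apart) x∈ y∈ (from′-off (off-p x∈) s))))
        (Q′.SimpleLoop.distinct image-loop)
        (All.tabulate λ x∈ → All.tabulate λ y∈ s → off-p x∈ (_ , γ-image y∈ , ~sym (from′-off (off-p x∈) s)))))
    image-essential

  -- The detour of M′ leaves the image of p ++ γ to its right, hence also p ++ γ in M.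
  module Diverging (q : List (Fin n)) {z : Fin n} {r : List (Fin n)} (eq : p ++ γ ≡ q ++ z ∷ r) {x : Fin n} (arc : Arc σ (from q) z x)
    (u : List (Fin n)) (off-u : All (¬_ ∘ On℘) u) (apart-u′ : AllPairs (DistinctV M′) u) {e : Fin n} (path-u′ : Q′.Path (α x) u e)
    (hit : On℘ e ⊎ e ∈ map c q ++ x ∷ u)
    (unreturned : ∀ A y B → map c q ++ x ∷ u ≡ A ++ y ∷ B → SameV′ y e → ¬ Contractible M′ (y ∷ B)) where

    private
      -- The hit takes place in `M′`, where the vertices along γ are regrouped, so the vertex of `e`
      -- in `M` may be a different one. The case distinctions below refer to the vertex of `ē` in
      -- `M`.
      ē : Fin n
      ē = α (lastOf x u)

      ē~e : SameV′ ē e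
      ē~e = Q′.path-last x u {e = e} (P′.~refl , path-u′)

      back-path : ∀ {d} xs → All (¬_ ∘ On℘) xs → Q′.Path (α d) xs e → Path (α d) xs (α (lastOf d xs))
      back-path []       []          _       = ~refl
      back-path (v ∷ xs) (off ∷ all) (s , t) = ~sym (from′-off (off℘-off off) (P′.~sym s)) , back-path xs all t

      apart-u : AllPairs (DistinctV M) u
      apart-u = allPairs-from (Q′.distinct-unique apart-u′) λ v∈ w∈ ne s → ne (Q′.distinct-≡ apart-u′ v∈ w∈ (to′-off (off℘-off (All.lookup off-u v∈)) s))

      module De = Detour q eq arc u off-u apart-u {ē} (back-path u off-u path-u′)
      open De using (detour; z~x)

      x-free : x ∉ γ × α x ∉ γ
      x-free = sector q eq arc

      u-free : ∀ {d} → d ∈ u → d ∉ γ × α d ∉ γ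
      u-free d∈ = off-free (off℘-off (All.lookup off-u d∈))

      u-fix : ∀ {d} → d ∈ x ∷ u → c d ≡ d
      u-fix (here refl) = fix (proj₁ x-free)
      u-fix (there d∈)  = fix (proj₁ (u-free d∈))

      map-detour : map c detour ≡ map c q ++ x ∷ u
      map-detour = trans (Listₚ.map-++ c q (x ∷ u)) (cong (map c q ++_) (Listₚ.map-id-local (All.tabulate u-fix)))

      x-side : On x → z ∈ γ × Right z x
      x-side on with z-cases q eq
      ... | inj₂ z∈γ = z∈γ , sector-right q eq z∈γ arc
      ... | inj₁ z∈p = ⊥-elim (let (y , y∈ , s) = on in off-p z∈p (y , y∈ , ~trans s (~sym z~x)))

      q-cases : ∀ {d} → d ∈ q → d ∈ p ⊎ d ∈ γ
      q-cases d∈ = ∈ₚ.∈-++⁻ p (De.q∈℘ d∈)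

      forward : ∀ {d} → d ∈ detour → α d ∉ γ
      forward d∈ with ∈ₚ.∈-++⁻ q d∈
      ... | inj₂ (here refl) = proj₂ x-free
      ... | inj₂ (there d∈u) = proj₂ (u-free d∈u)
      ... | inj₁ d∈q with q-cases d∈q
      ...   | inj₁ d∈p = proj₂ (off-free (off-p d∈p))
      ...   | inj₂ d∈γ = no-return d∈γ

      tails-not-left : ∀ {y d} → y ∈ γ → Left y d → d ∉ detour
      tails-not-left {y} {d} y∈ a d∈ with ∈ₚ.∈-++⁻ q d∈
      ... | inj₂ (there d∈u) = off℘-off (All.lookup off-u d∈u) (y , y∈ , left-~ a)
      ... | inj₂ (here refl) with x-side (y , y∈ , left-~ a)
      ...   | z∈ , b with tail-inj y∈ z∈ (~trans (left-~ a) (~sym z~x))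
      ...     | refl = left-right y∈ a b
      tails-not-left {y} {d} y∈ a d∈ | inj₁ d∈q with q-cases d∈q
      ... | inj₁ d∈p = off-p d∈p (y , y∈ , left-~ a)
      ... | inj₂ d∈γ = proj₁ (left-free y∈ a) d∈γ

      last-heads : ∀ xs d → All (¬_ ∘ On℘) xs → Path (α d) xs (α (lastOf d xs)) →
                   ∀ {v} → v ∈ d ∷ xs → α v ≡ α (lastOf d xs) ⊎ Off (α v)
      last-heads []       d _ _ (here refl) = inj₁ refl
      last-heads (w ∷ xs) d (off ∷ _) (s , _) (here refl) = inj₂ λ (y , y∈ , s′) → off℘-off off (y , y∈ , ~trans s′ s)
      last-heads (w ∷ xs) d (_ ∷ all) (_ , t) (there v∈) = last-heads xs w all t v∈

      u-ends : ∀ {v} → v ∈ x ∷ u → α v ≡ ē ⊎ Off (α v)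
      u-ends = last-heads u x off-u (back-path u off-u path-u′)

      p-heads : ∀ {a} → a ∈ p → ∀ {y} → y ∈ γ → ¬ Left y (α a)
      p-heads {a} a∈ {y} y∈ b with ∈ₚ.∈-∃++ a∈
      ... | p′ , [] , e₁ = end-not-left p′ e₁ y∈ b
      ... | p′ , a′ ∷ p₂ , e₁ = off-p (subst (a′ ∈_) (sym e₁) (∈ₚ.∈-++⁺ʳ p′ (there (here refl)))) (y , y∈ , ~trans (left-~ b)
              (proj₁ (proj₂ (proj₂ (path-split p′ {a} {a′ ∷ p₂ ++ γ} (subst (λ w → Path root w origin) (trans (cong (_++ γ) e₁) (Listₚ.++-assoc p′ (a ∷ a′ ∷ p₂) γ)) path))))))

      heads-not-left : (∀ {y} → y ∈ γ → ¬ Left y ē) → ∀ {y d} → y ∈ γ → Left y d → α d ∉ detour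
      heads-not-left ¬left {y} {d} y∈ a αd∈ with ∈ₚ.∈-++⁻ q αd∈
      ... | inj₂ αd∈u with u-ends αd∈u
      ...   | inj₁ e₁  = ¬left y∈ (subst (Left y) (trans (sym (α-invol d)) e₁) a)
      ...   | inj₂ off = off (y , y∈ , subst (SameV M y) (sym (α-invol d)) (left-~ a))
      heads-not-left ¬left {y} {d} y∈ a αd∈ | inj₁ αd∈q with q-cases αd∈q
      ... | inj₂ αd∈γ = proj₂ (left-free y∈ a) αd∈γ
      ... | inj₁ αd∈p = p-heads αd∈p y∈ (subst (Left y) (sym (α-invol d)) a)

      -- By `returns` the loop closed in `M` is contractible, up to double negation, and `transfer`
      -- contracts its image in `M′`. By `s′` the image closes up there as well, against
      -- `unreturned`.
      return : ∀ A y B → detour ≡ A ++ y ∷ B → SameV M ē y → (∀ {t} → t ∈ γ → ¬ Left t ē) → SameV′ (c y) ē → ⊥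
      return A y B e₁ s ¬left s′ = De.returns A y B e₁ s λ cyB →
          unreturned (map c A) (c y) (map c B) (trans (sym map-detour) (trans (cong (map c) e₁) (Listₚ.map-++ c A (y ∷ B)))) (P′.~trans s′ ē~e)
            (transfer origin∈ essential loop-yB (λ ()) (forward ∘ sub) (λ t∈ a → tails-not-left t∈ a ∘ sub , heads-not-left ¬left t∈ a ∘ sub) cyB)
        where
        sub : ∀ {d} → d ∈ y ∷ B → d ∈ detour
        sub d∈ = subst (_ ∈_) (sym e₁) (∈ₚ.∈-++⁺ʳ A d∈)
        loop-yB : SimpleLoop (y ∷ B)
        loop-yB = record { closed = y , path-end (y ∷ B) s (proj₂ (path-split A (subst (λ w → Path root w ē) e₁ De.detour-path)))
                         ; distinct = allPairs-++ʳ A (subst (AllPairs (DistinctV M)) e₁ De.detour-apart) }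

      off-return : ∀ A y B → detour ≡ A ++ y ∷ B → SameV M ē y → Off ē → ⊥
      off-return A y B e₁ s off = return A y B e₁ s (λ t∈ a → off (_ , t∈ , left-~ a))
        (subst (λ v → SameV′ v ē) (sym (fix (proj₁ (off-free (off-~ off s))))) (P′.~sym (to′-off off s)))

      -- The loop leaves γ on its right; if it came back on the left, it would cross γ exactly once.
      on-return : ∀ A y B → detour ≡ A ++ y ∷ B → SameV M ē y → ∀ {t} → t ∈ γ → SameV M t y → z ∈ γ →
                  (∃ λ γ₂ → y ∷ B ≡ γ₂ ++ x ∷ u × (∀ {d} → d ∈ γ₂ → d ∈ γ)) → (y ≡ t ⊎ y ≡ x) → ⊥
      on-return A y B e₁ s {t} t∈ t~y z∈ (γ₂ , e₂ , in-γ) y-is = case sides t∈ t~ē of λ where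
          (inj₁ e₃)              → ē∉γ (subst (_∈ γ) (sym e₃) t∈)
          (inj₂ (inj₁ e₃))       → last∉γ (subst (_∈ γ) (sym (α-inj e₃)) (prev∈ t∈))
          (inj₂ (inj₂ (inj₁ a))) → De.returns A y B e₁ s λ cyB → case trans (sym (crosses a)) (cocycle-contractible M parity-cocycle cyB) of λ ()
          (inj₂ (inj₂ (inj₂ b))) → return A y B e₁ s (λ t′∈ a → case tail-inj t′∈ t∈ (~trans (left-~ a) (~sym t~ē)) of λ { refl → left-right t∈ a b })
                                     (P′.~trans (image y-is) (P′.~sym (right′ t∈ b)))
        where
        t~ē : SameV M t ē
        t~ē = ~trans t~y (~sym s)
        last∈ : lastOf x u ∈ x ∷ u
        last∈ = lastOf-∈ x u
        x∷u-free : ∀ {d} → d ∈ x ∷ u → d ∉ γ × α d ∉ γ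
        x∷u-free (here refl) = x-free
        x∷u-free (there d∈)  = u-free d∈
        ē∉γ : ē ∉ γ
        ē∉γ = proj₂ (x∷u-free last∈)
        last∉γ : lastOf x u ∉ γ
        last∉γ = proj₁ (x∷u-free last∈)
        x-right : Right z x
        x-right = sector-right q eq z∈ arc
        image : y ≡ t ⊎ y ≡ x → SameV′ (c y) (c t)
        image (inj₁ refl) = P′.~refl
        image (inj₂ refl) = subst (λ v → SameV′ v (c t)) (sym (u-fix (here refl)))
          (subst (λ w → SameV′ x (c w)) (tail-inj z∈ t∈ (~trans z~x (~sym t~y))) (right′ z∈ x-right))
        -- The loop follows γ, leaves it at `x` on the right and arrives on the left. Darts of γ and
        -- darts of `u` contribute nothing to the parity, so the departure at `x` is the only
        -- contribution.
        crosses : Left t ē → sumB parity (y ∷ B) ≡ true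
        crosses a = trans (cong (sumB parity) e₂) (trans (sumB-++ parity γ₂) (cong₂ _xor_
            (sumB-false {f = parity} {γ₂} (All.tabulate λ d∈ → cong₂ _xor_ (onRight-self (in-γ d∈)) (onRight-α (in-γ d∈))))
            (cong₂ _xor_ (cong₂ _xor_ (onRight-right z∈ x-right) (head-false (here refl)))
              (sumB-false {f = parity} {u} (All.tabulate λ d∈ → cong₂ _xor_ (onRight-off (off℘-off (All.lookup off-u d∈))) (head-false (there d∈)))))))
          where
          head-false : ∀ {d} → d ∈ x ∷ u → onRight (α d) ≡ false
          head-false d∈ with u-ends d∈
          ... | inj₁ e₃  = trans (cong onRight e₃) (onRight-left t∈ a)
          ... | inj₂ off = onRight-off off

      on-or-off : ∀ A y B → detour ≡ A ++ y ∷ B → SameV M ē y → (On ē → ∃ λ t → t ∈ γ × SameV M t y × z ∈ γ ×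
                    (∃ λ γ₂ → y ∷ B ≡ γ₂ ++ x ∷ u × (∀ {d} → d ∈ γ₂ → d ∈ γ)) × (y ≡ t ⊎ y ≡ x)) → ⊥
      on-or-off A y B e₁ s h with on? ē
      ... | no off = off-return A y B e₁ s off
      ... | yes on = let (t , t∈ , t~y , z∈ , split , y-is) = h on in on-return A y B e₁ s t∈ t~y z∈ split y-is

      hit-x : SameV M z ē → ⊥
      hit-x s = on-or-off q x u refl (~trans (~sym s) z~x) λ (t , t∈ , t~ē) →
        let (z∈ , _) = x-side (t , t∈ , ~trans t~ē (~trans (~sym s) z~x)) in z , z∈ , z~x , z∈ , ([] , refl , λ ()) , inj₂ refl

      hit-q : ∀ {y} → y ∈ q → SameV M y ē → ⊥
      hit-q {y} y∈ s with ++-position p q eq | q-cases y∈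
      ... | inj₁ (p₂ , e₁ , _) | inj₂ y∈γ = off-p (subst (y ∈_) (sym e₁) (∈ₚ.∈-++⁺ˡ y∈)) (y , y∈γ , ~refl)
      ... | _ | inj₁ y∈p with ∈ₚ.∈-∃++ y∈
      ...   | A , B , refl = off-return A y (B ++ x ∷ u) (Listₚ.++-assoc A (y ∷ B) (x ∷ u)) (~sym s) (off-~ (off-p y∈p) s)
      hit-q {y} y∈ s | inj₂ (γₐ , refl , e₁) | inj₂ y∈γ with ∈ₚ.∈-++⁻ p y∈
      ...   | inj₁ y∈p = off-p y∈p (y , y∈γ , ~refl)
      ...   | inj₂ y∈γₐ with ∈ₚ.∈-∃++ y∈γₐ
      ...     | γ₁ , γ₂ , refl = on-or-off (p ++ γ₁) y (γ₂ ++ x ∷ u)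
                  (trans (Listₚ.++-assoc p (γ₁ ++ y ∷ γ₂) (x ∷ u)) (trans (cong (p ++_) (Listₚ.++-assoc γ₁ (y ∷ γ₂) (x ∷ u))) (sym (Listₚ.++-assoc p γ₁ (y ∷ γ₂ ++ x ∷ u)))))
                  (~sym s) λ _ → y , y∈γ , ~refl , subst (z ∈_) (sym e₁) (∈ₚ.∈-++⁺ʳ (γ₁ ++ y ∷ γ₂) (here refl)) ,
                    (y ∷ γ₂ , refl , λ d∈ → subst (_ ∈_) (sym e₁) (∈ₚ.∈-++⁺ˡ (∈ₚ.∈-++⁺ʳ γ₁ d∈))) , inj₁ refl

      hit-℘ : On℘ ē → ⊥
      hit-℘ (y , y∈ , s) with ∈ₚ.∈-++⁻ q (subst (y ∈_) eq y∈)
      ... | inj₁ y∈q         = hit-q y∈q s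
      ... | inj₂ (here refl) = hit-x s
      ... | inj₂ (there y∈r) = De.later y∈r s

      image-℘ : ∀ {d} → d ∈ q → c d ∈ p ++ γ
      image-℘ d∈ with q-cases d∈
      ... | inj₁ d∈p = subst (_∈ p ++ γ) (sym (fix-p d∈p)) (∈ₚ.∈-++⁺ˡ d∈p)
      ... | inj₂ d∈γ = ∈ₚ.∈-++⁺ʳ p (stays d∈γ)

      -- Off γ the vertices of both maps agree. The hit can then only be a return of the detour to
      -- one of the darts of `u`, within a part that the rotation does not touch.
      miss-℘ : ¬ On℘ ē → On℘ e ⊎ e ∈ map c q ++ x ∷ u → ⊥
      miss-℘ off h = go h
        where
        ē~ : SameV M ē e
        ē~ = from′-off (off℘-off off) ē~e
        e-off : ¬ On℘ e
        e-off (y , y∈ , s) = off (y , y∈ , ~trans s (~sym ē~))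
        go : On℘ e ⊎ e ∈ map c q ++ x ∷ u → ⊥
        go (inj₁ on) = e-off on
        go (inj₂ e∈) with ∈ₚ.∈-++⁻ (map c q) e∈
        ... | inj₂ (here refl) = e-off De.x-on
        ... | inj₁ e∈q = let (d , d∈ , eq′) = ∈ₚ.∈-map⁻ c e∈q in e-off (e , subst (_∈ p ++ γ) (sym eq′) (image-℘ d∈) , ~refl)
        ... | inj₂ (there e∈u) = let (as , B , e₁) = ∈ₚ.∈-∃++ e∈u in
          off-return (q ++ x ∷ as) e B (trans (cong (λ w → q ++ x ∷ w) e₁) (sym (Listₚ.++-assoc q (x ∷ as) (e ∷ B)))) ē~ (off℘-off off)

    impossible : ⊥
    impossible = case on℘? ē of λ where
      (yes on) → hit-℘ on
      (no off) → miss-℘ off hit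

  -- Elements of `S` are not proper prefixes of one another, so the two lassos agree or diverge. If
  -- they diverge, the new one turns off before the image of `p ++ γ`, and its part up to the next
  -- vertex of `p ++ γ` is a detour that `Diverging` excludes.
  rightmost-image : ∀ {p″ γ″} → E′.Lasso p″ γ″ → Greedy M′ (p″ ++ γ″) → γ″ ≡ map c γ
  rightmost-image {p″} {γ″} la″ gr″ with compare (p″ ++ γ″) (map c (p ++ γ))
  ... | same eq = S′.lasso-unique la″ image-lasso (trans eq (Listₚ.map-++ c p γ))
  ... | longer z r eq = ⊥-elim (proj₁ (proj₂ gr″) (map c (p ++ γ)) (z ∷ r) (λ ()) eq (map c p , map c γ , Listₚ.map-++ c p γ , E′.fromLasso image-lasso))
  ... | shorter z r eq = ⊥-elim (S′.inS-maximal (proj₁ gr″) (subst (InS M′) eq (map c p , map c γ , Listₚ.map-++ c p γ , E′.fromLasso image-lasso)))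
  ... | diverge q x z rest r ne eq″ eq with map-split c (p ++ γ) q eq
  ...   | q₀ , z₀ , r₀ , e₀ , refl , refl = ⊥-elim (hits (first-hit on℘? rest))
    where
    apart″ : AllPairs (DistinctV M′) (map c q₀ ++ x ∷ rest)
    apart″ = subst (AllPairs (DistinctV M′)) eq″ (E′.Lasso.apart la″)
    o″ = E′.Lasso.origin la″
    o″∈ : o″ ∈ map c q₀ ++ x ∷ rest
    o″∈ = subst (o″ ∈_) eq″ (∈ₚ.∈-++⁺ʳ p″ (subst (o″ ∈_) (sym (E′.Lasso.γ≡ la″)) (here refl)))
    path″ : Q′.Path x (x ∷ rest) o″
    path″ = proj₂ (Q′.path-split (map c q₀) (subst (λ w → Q′.Path root′ w o″) eq″ (E′.Lasso.path la″)))
    arc″ : Arc σ (from q₀) z₀ x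
    arc″ = Turn.arc-back {from q₀} {_} {z₀} (σ′-c (lastOf x₀ q₀)) (sector q₀ e₀)
      (subst (λ v → Arc σ′ (α v) (c z₀) x) (lastOf-map c x₀ q₀)
        (S′.greedy-first gr″ (map c q₀) eq″ ne
          (r , map c p , map c γ , trans (Listₚ.++-assoc (map c q₀) [ c z₀ ] r) (trans (sym eq) (Listₚ.map-++ c p γ)) , E′.fromLasso image-lasso)))
    hits : (∃₂ λ us tl → rest ≡ us ++ tl × All (¬_ ∘ On℘) us × (tl ≡ [] ⊎ ∃₂ λ s rest′ → tl ≡ s ∷ rest′ × On℘ s)) → ⊥
    hits (us , .[] , e , off , inj₁ refl) with trans e (Listₚ.++-identityʳ us)
    -- Without a further dart on `p ++ γ`, the detour is the whole remainder. The only loop that it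
    -- can close is the loop of the lasso, which is essential.
    ... | refl = Diverging.impossible q₀ e₀ arc″ rest off (AllPairs.tail (allPairs-++ʳ (map c q₀) apart″)) {o″} (proj₂ path″) (inj₂ o″∈)
          λ A y B e₁ s → subst (λ w → ¬ Contractible M′ w) (S′.lasso-split la″ A y B (trans eq″ e₁) s) (E′.Lasso.essential la″)
    -- The detour is cut just before `s`. The tails of a lasso are distinct, so no loop is closed at
    -- `s` and `unreturned` holds vacuously.
    hits (us , .(s ∷ rest′) , refl , off , inj₂ (s , rest′ , refl , on)) =
      Diverging.impossible q₀ e₀ arc″ us off (allPairs-++ˡ us (AllPairs.tail (allPairs-++ʳ (map c q₀) apart″))) {s}
        (proj₂ (proj₁ (Q′.path-split (x ∷ us) path″))) (inj₁ on)
        λ A y B e₁ y~s _ → allPairs-++-cross (map c q₀ ++ x ∷ us) (subst (AllPairs (DistinctV M′)) (sym (Listₚ.++-assoc (map c q₀) (x ∷ us) (s ∷ rest′))) apart″)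
          (subst (y ∈_) (sym e₁) (∈ₚ.∈-++⁺ʳ A (here refl))) (here refl) y~s

-- The two rotations are inverse to each other

module _ {n r : ℕ} {M : Map n r} (isMap : IsMap M) {γ : List (Fin n)} (right : IsRightmost M γ) where
  open Map M using (σ; α; root; lab)
  open IsMap isMap
  open Explore isMap

  private
    la : Lasso (proj₁ right) γ
    la = toLasso (proj₂ (proj₂ right))

    uniq : AllPairs _≢_ γ
    uniq = Paths.SimpleLoop.unique (Lasso.simple la)

  module _ {c c⁻ : Fin n → Fin n} (shift : Shift γ c c⁻) {σ′ : Fin n → Fin n} {root′ : Fin n} {lab′ : Fin n → Fin r}
    (σ′≡ : ∀ d → σ′ d ≡ c (σ (α (c⁻ (α d))))) (root′≡ : root′ ≡ c root) (lab′≡ : ∀ d → lab′ d ≡ lab (c⁻ d)) where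
    private
      module R = Turned isMap la (proj₁ (proj₂ right)) shift σ′ root′ lab′ σ′≡ root′≡ lab′≡

    rotation-faceDeg : ∀ i → faceDeg R.M′ i ≡ faceDeg M i
    rotation-faceDeg i = ℕₚ.≤-antisym (R.faceDeg-≤ i) (R.Back.faceDeg-≤ i)

    rotation-InMg : ∀ g → InMg M g → InMg R.M′ g
    rotation-InMg g (_ , genus , even) = R.isMap′ ,
      subst (_≡ numEdges M + 2) (cong₂ (λ v f → v + f + 2 * g) (ℕₚ.≤-antisym R.numVertices-≤ R.Back.numVertices-≤)
                                                               (ℕₚ.≤-antisym R.numFaces-≤ R.Back.numFaces-≤)) genus ,
      λ i → subst (2 ∣_) (sym (rotation-faceDeg i)) (even i)

    rotation-rightmost : ∀ {γ′} → IsRightmost R.M′ γ′ → γ′ ≡ map c γ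
    rotation-rightmost (p′ , gr′ , sp′) = R.rightmost-image (R.E′.toLasso sp′) gr′

    rotation-back : ∀ d → c⁻ (σ′ (α (c (α d)))) ≡ σ d
    rotation-back d = trans (cong c⁻ (trans (R.σ′-c (α d)) (cong (c ∘ σ) (α-invol d)))) (Shift.c⁻c shift (σ d))

  -- Moving `α` out of the cycle brings the vertex permutation of `Φ` into the form that `Rotate`
  -- assumes.
  reversed-plus : ∀ d → Map.σ (Φ plus M γ) d ≡ cycFwd γ (σ (α (cycBwd γ (α d))))
  reversed-plus d = cong (cycFwd γ ∘ σ) (cycBwd-map α-invol α-invol uniq d)

  reversed-minus : ∀ d → Map.σ (Φ minus M γ) d ≡ cycBwd γ (σ (α (cycFwd γ (α d))))
  reversed-minus d = cong (cycBwd γ ∘ σ) (cycFwd-map α-invol α-invol uniq d)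

  private
    fwd-shift : Shift γ (cycFwd γ) (cycBwd γ)
    fwd-shift = shift-cyc uniq

    bwd-shift : Shift γ (cycBwd γ) (cycFwd γ)
    bwd-shift = shift-inverse fwd-shift

  module _ {c c⁻ : Fin n → Fin n} (shift : Shift γ c c⁻) (commutes : ∀ d → c (cycFwd γ (c⁻ d)) ≡ cycFwd γ d)
           (commutes⁻ : ∀ d → c (cycBwd γ (c⁻ d)) ≡ cycBwd γ d) where
    open Shift shift

    -- The cycle of the image loop is a conjugate of that of γ by `c`. Since `c` commutes with the
    -- latter, the image defines the same shift, only read from another dart.
    cycFwd-image : ∀ d → cycFwd (map c γ) d ≡ cycFwd γ d
    cycFwd-image d = trans (cycFwd-map cc⁻ c⁻c uniq d) (commutes d)

    cycBwd-image : ∀ d → cycBwd (map c γ) d ≡ cycBwd γ d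
    cycBwd-image d = trans (cycBwd-map cc⁻ c⁻c uniq d) (commutes⁻ d)

    private
      image-unique : AllPairs _≢_ (map c γ)
      image-unique = AllPairsₚ.map⁺ (AllPairs.map (λ ne eq → ne (trans (sym (c⁻c _)) (trans (cong c⁻ eq) (c⁻c _)))) uniq)

    cycFwd-image-α : ∀ d → cycFwd (map α (map c γ)) d ≡ α (cycFwd γ (α d))
    cycFwd-image-α d = trans (cycFwd-map α-invol α-invol image-unique d) (cong α (cycFwd-image (α d)))

    cycBwd-image-α : ∀ d → cycBwd (map α (map c γ)) d ≡ α (cycBwd γ (α d))
    cycBwd-image-α d = trans (cycBwd-map α-invol α-invol image-unique d) (cong α (cycBwd-image (α d)))

  -- The rightmost loop of the rotated map is the image of γ, so the second rotation uses the
  -- inverse shift on the same darts. It restores the map exactly, and the isomorphism is the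
  -- identity.
  rotation-inverse : ∀ ε γ′ → IsRightmost (Φ ε M γ) γ′ → Φ (neg ε) (Φ ε M γ) γ′ ≅ M
  rotation-inverse plus γ′ right′ with rotation-rightmost fwd-shift reversed-plus refl (λ _ → refl) right′
  ... | refl = record
    { f = id ; f⁻¹ = id ; inv₁ = λ _ → refl ; inv₂ = λ _ → refl ; f-α = λ _ → refl
    ; f-σ = λ d → trans (unimage (Map.σ (Φ plus M γ) (cycFwd (map α (map (cycFwd γ) γ)) d)))
        (trans (cong (cycBwd γ ∘ Map.σ (Φ plus M γ)) (cycFwd-image-α fwd-shift comm comm⁻ d)) (rotation-back fwd-shift reversed-plus refl (λ _ → refl) d))
    ; f-root = trans (unimage _) (cycBwd-cycFwd uniq root)
    ; f-lab = λ d → sym (cong lab (trans (cong (cycBwd γ) (cycFwd-image fwd-shift comm comm⁻ d)) (cycBwd-cycFwd uniq d))) }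
    where
    comm : ∀ d → cycFwd γ (cycFwd γ (cycBwd γ d)) ≡ cycFwd γ d
    comm d = cong (cycFwd γ) (cycFwd-cycBwd uniq d)
    comm⁻ : ∀ d → cycFwd γ (cycBwd γ (cycBwd γ d)) ≡ cycBwd γ d
    comm⁻ d = cycFwd-cycBwd uniq (cycBwd γ d)
    unimage : ∀ d → cycBwd (map (cycFwd γ) γ) d ≡ cycBwd γ d
    unimage = cycBwd-image fwd-shift comm comm⁻
  rotation-inverse minus γ′ right′ with rotation-rightmost bwd-shift reversed-minus refl (λ _ → refl) right′
  ... | refl = record
    { f = id ; f⁻¹ = id ; inv₁ = λ _ → refl ; inv₂ = λ _ → refl ; f-α = λ _ → refl
    ; f-σ = λ d → trans (unimage (Map.σ (Φ minus M γ) (cycBwd (map α (map (cycBwd γ) γ)) d)))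
        (trans (cong (cycFwd γ ∘ Map.σ (Φ minus M γ)) (cycBwd-image-α bwd-shift comm comm⁻ d)) (rotation-back bwd-shift reversed-minus refl (λ _ → refl) d))
    ; f-root = trans (unimage _) (cycFwd-cycBwd uniq root)
    ; f-lab = λ d → sym (cong lab (trans (cong (cycFwd γ) (cycBwd-image bwd-shift comm comm⁻ d)) (cycFwd-cycBwd uniq d))) }
    where
    comm : ∀ d → cycBwd γ (cycFwd γ (cycFwd γ d)) ≡ cycFwd γ d
    comm d = cycBwd-cycFwd uniq (cycFwd γ d)
    comm⁻ : ∀ d → cycBwd γ (cycBwd γ (cycFwd γ d)) ≡ cycBwd γ d
    comm⁻ d = cong (cycBwd γ) (cycBwd-cycFwd uniq d)
    unimage : ∀ d → cycFwd (map (cycBwd γ) γ) d ≡ cycFwd γ d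
    unimage = cycFwd-image bwd-shift comm comm⁻

  Φ-InMg : ∀ ε g → InMg M g → InMg (Φ ε M γ) g
  Φ-InMg plus  = rotation-InMg fwd-shift reversed-plus refl (λ _ → refl)
  Φ-InMg minus = rotation-InMg bwd-shift reversed-minus refl (λ _ → refl)

  Φ-numEdges : ∀ ε → numEdges (Φ ε M γ) ≡ numEdges M
  Φ-numEdges plus  = refl
  Φ-numEdges minus = refl

  Φ-faceDeg : ∀ ε i → faceDeg (Φ ε M γ) i ≡ faceDeg M i
  Φ-faceDeg plus  = rotation-faceDeg fwd-shift reversed-plus refl (λ _ → refl)
  Φ-faceDeg minus = rotation-faceDeg bwd-shift reversed-minus refl (λ _ → refl)

theorem3 : ∀ {n r : ℕ} (g : ℕ) → 1 ≤ g → (M : Map n r) → InMg M g →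
    (∃ λ γ → IsRightmost M γ)
    × (∀ (ε : Sign) (γ : List (Fin n)) → IsRightmost M γ →
    InMg (Φ ε M γ) g
    × numEdges (Φ ε M γ) ≡ numEdges M
    × (∀ i → faceDeg (Φ ε M γ) i ≡ faceDeg M i)
    × (∀ (γ' : List (Fin n)) → IsRightmost (Φ ε M γ) γ' →
    Φ (neg ε) (Φ ε M γ) γ' ≅ M))
theorem3 g 1≤g M inMg@(isMap , genus , _) =
  Explore.rightmost-exists isMap {g} 1≤g genus ,
  λ ε γ right → Φ-InMg isMap right ε g inMg , Φ-numEdges isMap right ε , Φ-faceDeg isMap right ε , rotation-inverse isMap right ε
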